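{- Let $n\ge 4$, $k>0$, let $\tilde R$ be a quiver on $[1,n-1]$ with $b_{ij}(\tilde R)\ge 2$ whenever $i<j$, and let $Q$ be the quiver on $[1,n]$ whose full subquiver on $[1,n-1]$ is obtained from $\tilde R$ by mutating successively at $2,1,2,1,\dots,2,1$ ($2k$ mutations, starting with $2$), and whose entries $b_{in}(Q)\ge 2$ ($1\le i\le n-1$) are arbitrary. Let $j_1,\dots,j_{n+4k}$ be the vertex sequence $$n,\ 1,2,\dots,1,2\ (2k\text{ terms}),\ n-1,n-2,\dots,2,1,\ 2,1,\dots,2,1\ (2k\text{ terms}),$$ let $Q^{(0)}=Q$ and $Q^{(m)}=\mu[j_m](Q^{(m-1)})$ for $1\le m\le n+4k$, and let $R=Q^{(2k+1)}$ (the quiver obtained from $Q$ by mutating at $n$ and then at $1,2,1,2,\dots,1,2$, $2k$ mutations). Suppose that either $n\ge 5$, or $n=4$ and $b_{14}(Q)\ne b_{23}(R)$. Then for any $0\le \ell<m\le n+4k-1$, the quiver $Q^{(\ell)}$ is not isomorphic to $Q^{(m)}$, nor to the quiver obtained from $Q^{(m)}$ by reversing all arrows; here isomorphism means equality after relabeling the vertices by a permutation.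
   Context: A quiver on $[1,n]$ is a finite directed multigraph with no loops and no oriented 2-cycles; quivers are labeled. It is encoded by the skew-symmetric matrix $B(Q)=(b_{ij})$, $b_{ij}>0$ meaning $b_{ij}$ arrows from $i$ to $j$. Mutation at $k$: $\mu[k](Q)$ has $b'_{ij}=-b_{ij}$ if $k\in\{i,j\}$ and $b'_{ij}=b_{ij}+\tfrac12(|b_{ik}|b_{kj}+b_{ik}|b_{kj}|)$ otherwise. -}

module Defs where

open import Data.Nat as ℕ using (ℕ; zero; suc)
open import Data.Integer as ℤ using (ℤ; +_; -_; ∣_∣)
open import Data.Integer.DivMod using (_/ℕ_)
open import Data.Fin using (Fin; zero; suc; inject₁; fromℕ; _≟_)
open import Data.List using (List; []; _∷_; _++_; map; reverse; take; foldl)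
open import Data.List using (allFin) public
open import Data.Fin.Permutation using (Permutation′; _⟨$⟩ʳ_)
open import Data.Product using (Σ; ∃)
open import Relation.Binary.PropositionalEquality using (_≡_)
open import Relation.Nullary using (does)
open import Data.Bool using (if_then_else_; _∨_)

-- A quiver on [1,n] is encoded by its exchange matrix B(Q) = (b_ij);
-- vertex i ∈ [1,n] corresponds to the index (i-1) : Fin n.
Mat : ℕ → Set
Mat n = Fin n → Fin n → ℤ

-- B is skew-symmetric (these matrices are exactly the quivers)
SkewSymmetric : ∀ {n} → Mat n → Set
SkewSymmetric {n} B = ∀ (i j : Fin n) → B i j ≡ - B j i

-- Mutation at k (paper's formula; the numerator is always even)
μ : ∀ {n} → Fin n → Mat n → Mat n
μ k B i j =
  if does (k ≟ i) ∨ does (k ≟ j)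
  then - B i j
  else B i j ℤ.+ ((+ ∣ B i k ∣) ℤ.* B k j ℤ.+ B i k ℤ.* (+ ∣ B k j ∣)) /ℕ 2

μs : ∀ {n} → List (Fin n) → Mat n → Mat n
μs ks B = foldl (λ C k → μ k C) B ks

alt : ∀ {A : Set} → ℕ → A → A → List A
alt zero    a b = []
alt (suc k) a b = a ∷ b ∷ alt k a b

restrict : ∀ {m} → Mat (suc m) → Mat m
restrict B i j = B (inject₁ i) (inject₁ j)

opp : ∀ {n} → Mat n → Mat n
opp B i j = - B i j

Isomorphic : ∀ {n} → Mat n → Mat n → Set
Isomorphic {n} B C = Σ (Permutation′ n) λ σ →
  ∀ (i j : Fin n) → C (σ ⟨$⟩ʳ i) (σ ⟨$⟩ʳ j) ≡ B i j

-- Setting with n = 4 + p.  Vertex 1 = zero, vertex 2 = suc zero,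
-- vertex n = fromℕ (3 + p).
v1 : ∀ {p} → Fin (4 ℕ.+ p)
v1 = zero

v2 : ∀ {p} → Fin (4 ℕ.+ p)
v2 = suc zero

vn : ∀ {p} → Fin (4 ℕ.+ p)
vn {p} = fromℕ (3 ℕ.+ p)

seqR̃ : ∀ p → ℕ → List (Fin (3 ℕ.+ p))
seqR̃ p k = alt k (suc zero) zero

jseq : ∀ p → ℕ → List (Fin (4 ℕ.+ p))
jseq p k = vn {p} ∷ alt k (v1 {p}) (v2 {p})
           ++ map inject₁ (reverse (allFin (3 ℕ.+ p)))
           ++ alt k (v2 {p}) (v1 {p})

Qat : ∀ p → ℕ → Mat (4 ℕ.+ p) → ℕ → Mat (4 ℕ.+ p)
Qat p k Q ℓ = μs (take ℓ (jseq p k)) Q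

{-# OPTIONS --safe #-}
-- Every quiver on the way is determined by a = |b₁₂|, which never changes, and by terms of the
-- recurrences u(s+2) = a u(s+1) - u(s): one sequence d for the arrows joining n to {1,2}, and one
-- sequence e i for those joining each of the vertices 3, …, n-1 to {1,2}. From their initial signs
-- the sequences increase strictly and exceed a from index 2 on. While 1 and 2 are mutated for the
-- first time d climbs and the e i descend; the second time d descends and the e i climb again.
--
-- Isomorphic or opposite quivers have corresponding 3-cycles. Right after the mutation at n, before
-- it, and while the mutations are at sinks, some vertex lies on no 3-cycle; in all other quivers each
-- vertex lies on one. In most of the latter all 3-cycles share exactly one arrow (a "book"); in the
-- others they share a single vertex (a "hub"), which for n = 4 becomes a book as well. The weight of
-- the common arrow and the order of the weights on the 3-cycles through it then separate the
-- quivers, except when two consecutive terms of d agree with two consecutive terms of e i: going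
-- back along the recurrence gives d 1 = e i 1, which for n = 4 is b₁₄(Q) = b₂₃(R).
module Submission where

open import Defs
import Data.Nat as ℕ
import Data.Nat.DivMod as ℕ
import Data.Nat.Properties as ℕ
import Data.Fin as Fin
import Data.Sum as Sum
open import Data.Bool using (Bool; true; false; not; T; _∧_; _∨_)
open import Data.Empty using (⊥; ⊥-elim)
open import Data.Fin.Permutation using (_⟨$⟩ʳ_; _⟨$⟩ˡ_; inverseˡ; inverseʳ)
open import Data.Fin.Relation.Unary.Top using (view; ‵fromℕ; ‵inject₁; view-fromℕ; view-inject₁)
open import Data.Unit using (tt)
open import Function using (_∘_; const; id)
open import Relation.Binary.Definitions using (tri<; tri≈; tri>)
open import Relation.Nullary using (yes; no; does; contradiction)
open import Relation.Nullary.Decidable using (dec-true; dec-false)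

-- The alternation between 1 and 2 disappears when the two vertices exchange names after every
-- mutation at one of them: the rise becomes one rule repeated at `P`, the descent one rule repeated
-- at `Q`, each moving the indices of `d` and of the `e i` by one in opposite directions. The same
-- exchange of names brings the opposite of such a quiver back into the same shape, so that reversal
-- of arrows needs no theory of its own. Apart from the entries at 1 and 2, only those between n and
-- 3, ..., n-1 change by more than a sign. They change twice at the turn and again at the end, by
-- products of a term of `d` and a term of `e i`; a bilinear identity for the recurrences makes
-- these contributions cancel. One further mutation would turn `finish` back into `start`: the walk
-- is closed, and the claim stops one step short of its end. Reversal exchanges the two weights
-- which a vertex has on its 3-cycle with 1 and 2, and so makes n look like one of 3, ..., n-1. If
-- there are at least two of the latter, they would all have to be sent to n and collide; for n = 4
-- the inequality in the hypothesis takes over.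

module MutationCycle where

  open import Data.Nat using (ℕ; zero; suc)
  open import Data.Nat.Solver using (module +-*-Solver)
  open +-*-Solver using (solve; con; _:+_; _:*_; _:=_)
  open import Data.Integer hiding (suc; pred; _≟_)
  open import Data.Integer.DivMod using (_/ℕ_)
  open import Data.Integer.Properties hiding (_≟_)
  open import Data.Integer.Tactic.RingSolver using (solve-∀)
  open import Data.Fin using (Fin; zero; suc; toℕ; opposite; inject₁; inject≤; fromℕ; fromℕ<; _≟_)
  open import Data.Fin.Properties using (toℕ<n; toℕ-injective; toℕ-inject≤; toℕ-fromℕ<; fromℕ<-injective; injective⇒≤)
  open import Data.Fin.Properties using (suc-injective; opposite-prop; opposite-involutive)
  open import Data.List using (List; []; _∷_; _++_; _∷ʳ_; map; reverse; take; tabulate; length)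
  open import Data.List.Properties using (unfold-reverse; tabulate-cong; take-suc-tabulate; take-all; foldl-∷ʳ)
  open import Data.List.Properties using (++-assoc; map-tabulate; map-++; length-tabulate)
  open import Data.Product using (∃; ∃₂; Σ; _×_; _,_; proj₁; proj₂)
  open import Data.Sum using (_⊎_; inj₁; inj₂; [_,_]′)
  open import Relation.Binary.PropositionalEquality
  open import Relation.Nullary using (¬_)

  -- Signs of integers and the increment of a mutation

  infix 4 _≺_
  _≺_ : ℤ → ℤ → Set
  i ≺ j = 0ℤ < j - i

  Pos Neg : ℤ → Set
  Pos z = 0ℤ < z
  Neg z = z < 0ℤ

  *-pos : ∀ {i j} → Pos i → Pos j → Pos (i * j)
  *-pos {+[1+ _ ]} {+[1+ _ ]} _ _ = +<+ ℕ.z<s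
  *-pos {+0} (+<+ ()) _
  *-pos {+[1+ _ ]} {+0} _ (+<+ ())

  +-pos : ∀ {i j} → Pos i → Pos j → Pos (i + j)
  +-pos = +-mono-<

  <⇒pos : ∀ {i j} → i < j → Pos (j - i)
  <⇒pos {i} {j} i<j = subst (_< j - i) (+-inverseʳ i) (+-monoˡ-< (- i) i<j)

  pos⇒< : ∀ {i j} → Pos (j - i) → i < j
  pos⇒< {i} {j} p = subst₂ _<_ (+-identityˡ i) (eq j i) (+-monoˡ-< i p)
    where eq : ∀ j i → j - i + i ≡ j
          eq = solve-∀

  -- Makes the halving in the mutation formula exact. As `_/ℕ_` rounds down, the negative case has
  -- to know that the remainder vanishes.
  *2/ℕ2 : ∀ z → (z * + 2) /ℕ 2 ≡ z
  *2/ℕ2 (+ n) = trans (cong (_/ℕ 2) (sym (pos-* n 2))) (cong +_ (ℕ.m*n/n≡m n 2))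
  *2/ℕ2 -[1+ n ] rewrite ℕ.m*n%n≡0 (ℕ.suc n) 2 {{_}} = cong (λ m → - (+ m)) (ℕ.m*n/n≡m (ℕ.suc n) 2 {{_}})

  -- The change of b_ij under the mutation at k, for u = b_ik and v = b_kj.
  τ : ℤ → ℤ → ℤ
  τ u v = ((+ ∣ u ∣) * v + u * (+ ∣ v ∣)) /ℕ 2

  +∣i∣≡-i : ∀ {i} → i ≤ 0ℤ → + ∣ i ∣ ≡ - i
  +∣i∣≡-i {i} i≤0 = trans (cong +_ (sym (∣-i∣≡∣i∣ i))) (0≤i⇒+∣i∣≡i (neg-mono-≤ i≤0))

  τ-abs : ∀ u v {p q} → + ∣ u ∣ ≡ p → + ∣ v ∣ ≡ q → τ u v ≡ (p * v + u * q) /ℕ 2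
  τ-abs u v refl refl = refl

  τ⁺⁺ : ∀ {u v} → 0ℤ ≤ u → 0ℤ ≤ v → τ u v ≡ u * v
  τ⁺⁺ {u} {v} p q =
    trans (τ-abs u v (0≤i⇒+∣i∣≡i p) (0≤i⇒+∣i∣≡i q)) (trans (cong (_/ℕ 2) (eq u v)) (*2/ℕ2 (u * v)))
    where eq : ∀ u v → u * v + u * v ≡ u * v * + 2
          eq = solve-∀

  τ⁻⁻ : ∀ {u v} → u ≤ 0ℤ → v ≤ 0ℤ → τ u v ≡ - (u * v)
  τ⁻⁻ {u} {v} p q =
    trans (τ-abs u v (+∣i∣≡-i p) (+∣i∣≡-i q)) (trans (cong (_/ℕ 2) (eq u v)) (*2/ℕ2 (- (u * v))))
    where eq : ∀ u v → - u * v + u * - v ≡ - (u * v) * + 2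
          eq = solve-∀

  τ⁺⁻ : ∀ {u v} → 0ℤ ≤ u → v ≤ 0ℤ → τ u v ≡ 0ℤ
  τ⁺⁻ {u} {v} p q = trans (τ-abs u v (0≤i⇒+∣i∣≡i p) (+∣i∣≡-i q)) (cong (_/ℕ 2) (eq u v))
    where eq : ∀ u v → u * v + u * - v ≡ 0ℤ
          eq = solve-∀

  τ⁻⁺ : ∀ {u v} → u ≤ 0ℤ → 0ℤ ≤ v → τ u v ≡ 0ℤ
  τ⁻⁺ {u} {v} p q = trans (τ-abs u v (+∣i∣≡-i p) (0≤i⇒+∣i∣≡i q)) (cong (_/ℕ 2) (eq u v))
    where eq : ∀ u v → - u * v + u * v ≡ 0ℤ
          eq = solve-∀

  τ-comm : ∀ u v → τ u v ≡ τ v u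
  τ-comm u v = cong (_/ℕ 2) (eq (+ ∣ u ∣) u (+ ∣ v ∣) v)
    where eq : ∀ a u b v → a * v + u * b ≡ b * u + v * a
          eq = solve-∀

  τ-neg : ∀ u v → τ (- u) (- v) ≡ - τ u v
  τ-neg u v with ≤-total 0ℤ u | ≤-total 0ℤ v
  ... | inj₁ p | inj₁ q = trans (τ⁻⁻ (neg-mono-≤ p) (neg-mono-≤ q)) (trans (eq u v) (cong -_ (sym (τ⁺⁺ p q))))
    where eq : ∀ u v → - (- u * - v) ≡ - (u * v)
          eq = solve-∀
  ... | inj₂ p | inj₂ q = trans (τ⁺⁺ (neg-mono-≤ p) (neg-mono-≤ q)) (trans (eq u v) (cong -_ (sym (τ⁻⁻ p q))))
    where eq : ∀ u v → - u * - v ≡ - - (u * v)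
          eq = solve-∀
  ... | inj₁ p | inj₂ q = trans (τ⁻⁺ (neg-mono-≤ p) (neg-mono-≤ q)) (cong -_ (sym (τ⁺⁻ p q)))
  ... | inj₂ p | inj₁ q = trans (τ⁺⁻ (neg-mono-≤ p) (neg-mono-≤ q)) (cong -_ (sym (τ⁻⁺ p q)))

  τ-inv : ∀ u → τ u (- u) ≡ 0ℤ
  τ-inv u with ≤-total 0ℤ u
  ... | inj₁ p = τ⁺⁻ p (neg-mono-≤ p)
  ... | inj₂ p = τ⁻⁺ p (neg-mono-≤ p)

  -- The form in which inequalities are proved below: the difference is written as a visibly
  -- positive expression, and the ring solver checks the rewriting.
  pos-≡⇒< : ∀ {i j k} → Pos k → k ≡ j - i → i < j
  pos-≡⇒< p refl = pos⇒< p

  +-pos-nonneg : ∀ {i j} → Pos i → 0ℤ ≤ j → Pos (i + j)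
  +-pos-nonneg = +-mono-<-≤

  *-nonneg-pos : ∀ {i j} → 0ℤ ≤ i → Pos j → 0ℤ ≤ i * j
  *-nonneg-pos {+ m} {+[1+ n ]} _ _ = subst (0ℤ ≤_) (pos-* m (suc n)) (+≤+ ℕ.z≤n)
  *-nonneg-pos {+ _} {+0} _ (+<+ ())

  -- Linear recurrences

  lin : (a u₀ u₁ : ℤ) → ℕ → ℤ
  lin a u₀ u₁ 0             = u₀
  lin a u₀ u₁ 1             = u₁
  lin a u₀ u₁ (suc (suc n)) = a * lin a u₀ u₁ (suc n) - lin a u₀ u₁ n

  module Growth {a u₀ u₁ : ℤ} (2≤a : + 2 ≤ a) (u₀<0 : Neg u₀) (0<u₁ : Pos u₁) where

    private
      u : ℕ → ℤ
      u = lin a u₀ u₁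

    -- Positivity and growth need each other: the next difference is the previous one plus `a - 2`
    -- times a positive term.
    pos∧step : ∀ n → Pos (u (suc n)) × u n < u (suc n)
    pos∧step zero    = 0<u₁ , <-trans u₀<0 0<u₁
    pos∧step (suc n) with pos∧step n
    ... | 0<u , u< = <-trans 0<u step , step
      where
      eq : ∀ a v w → (v - w) + (a - + 2) * v ≡ a * v - w - v
      eq = solve-∀
      step : u (suc n) < u (suc (suc n))
      step = pos-≡⇒< (+-pos-nonneg (<⇒pos u<) (*-nonneg-pos (i≤j⇒0≤j-i 2≤a) 0<u)) (eq a (u (suc n)) (u n))

    lin-pos : ∀ n → Pos (u (suc n))
    lin-pos n = proj₁ (pos∧step n)

    lin-step : ∀ n → u n < u (suc n)
    lin-step n = proj₂ (pos∧step n)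

    lin-mono : ∀ m k → u m < u (suc (k ℕ.+ m))
    lin-mono m zero    = lin-step m
    lin-mono m (suc k) = <-trans (lin-mono m k) (lin-step (suc (k ℕ.+ m)))

    lin-mono-< : ∀ {m n} → m ℕ.< n → u m < u n
    lin-mono-< {m} {n} m<n = subst (λ l → u m < u l) eq (lin-mono m (n ℕ.∸ suc m))
      where
      eq : suc (n ℕ.∸ suc m ℕ.+ m) ≡ n
      eq = trans (sym (ℕ.+-suc (n ℕ.∸ suc m) m)) (ℕ.m∸n+n≡m m<n)

    lin-injective : ∀ {m n} → u m ≡ u n → m ≡ n
    lin-injective {m} {n} eq with ℕ.<-cmp m n
    ... | tri< m<n _ _ = contradiction eq (<⇒≢ (lin-mono-< m<n))
    ... | tri≈ _ m≡n _ = m≡n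
    ... | tri> _ _ n<m = contradiction (sym eq) (<⇒≢ (lin-mono-< n<m))

    -- Integrality enters here: `u₁` is at least 1, so `a * u₁` is at least `a`, and subtracting the
    -- negative `u₀` makes the bound strict.
    a<lin : ∀ n → a < u (suc (suc n))
    a<lin zero    = pos-≡⇒< (+-pos-nonneg (neg-mono-< u₀<0) (*-nonneg-pos 0≤u₁-1 0<a)) (eq a u₀ u₁)
      where
      0<a : Pos a
      0<a = <-≤-trans (+<+ ℕ.z<s) 2≤a
      0≤u₁-1 : 0ℤ ≤ u₁ - 1ℤ
      0≤u₁-1 = i≤j⇒0≤j-i (i<j⇒suc[i]≤j 0<u₁)
      eq : ∀ a u₀ u₁ → - u₀ + (u₁ - 1ℤ) * a ≡ a * u₁ - u₀ - a
      eq = solve-∀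
    a<lin (suc n) = <-trans (a<lin n) (lin-step (suc (suc n)))

  -- Both sequences can be run backwards, and only their 0-th terms are negative;
  -- two consecutive common values therefore force the sequences to be in phase.
  lin-phase : ∀ {a u₀ u₁ w₀ w₁} → + 2 ≤ a → Neg u₀ → Pos u₁ → Neg w₀ → Pos w₁ → ∀ m n →
              lin a u₀ u₁ m ≡ lin a w₀ w₁ n → lin a u₀ u₁ (suc m) ≡ lin a w₀ w₁ (suc n) → u₁ ≡ w₁
  lin-phase 2≤a nu pu nw pw zero    zero    _ eq = eq
  lin-phase 2≤a nu pu nw pw zero    (suc n) eq _ = ⊥-elim (<-asym nu (subst Pos (sym eq) (Growth.lin-pos 2≤a nw pw n)))
  lin-phase 2≤a nu pu nw pw (suc m) zero    eq _ = ⊥-elim (<-asym nw (subst Pos eq (Growth.lin-pos 2≤a nu pu m)))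
  lin-phase {a} 2≤a nu pu nw pw (suc m) (suc n) eq eq′ = lin-phase 2≤a nu pu nw pw m n (back _ _ _ _ eq eq′) eq
    where
    rev : ∀ a v w → a * v - (a * v - w) ≡ w
    rev = solve-∀
    back : ∀ v w v′ w′ → v ≡ v′ → a * v - w ≡ a * v′ - w′ → w ≡ w′
    back v w v′ w′ e e′ = trans (sym (rev a v w)) (trans (cong₂ (λ s t → a * s - t) e e′) (rev a v′ w′))

  -- The left side depends on `i + j` only: one use of each recurrence moves a unit of index from
  -- `u` to `w`.
  lin-wronskian : ∀ a u₀ u₁ w₀ w₁ i j → let u = lin a u₀ u₁ ; w = lin a w₀ w₁ in
                  w (suc j) * u (suc i) - w j * u i ≡ w (suc (i ℕ.+ j)) * u₁ - w (i ℕ.+ j) * u₀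
  lin-wronskian a u₀ u₁ w₀ w₁ zero    j = refl
  lin-wronskian a u₀ u₁ w₀ w₁ (suc i) j = begin
    w (suc j) * (a * u (suc i) - u i) - w j * u (suc i)                ≡⟨ eq a (w j) (w (suc j)) (u i) (u (suc i)) ⟩
    (a * w (suc j) - w j) * u (suc i) - w (suc j) * u i                ≡⟨ lin-wronskian a u₀ u₁ w₀ w₁ i (suc j) ⟩
    w (suc (i ℕ.+ suc j)) * u₁ - w (i ℕ.+ suc j) * u₀                  ≡⟨ cong (λ l → w (suc l) * u₁ - w l * u₀) (ℕ.+-suc i j) ⟩
    w (suc (suc (i ℕ.+ j))) * u₁ - w (suc (i ℕ.+ j)) * u₀              ∎
    where
    open ≡-Reasoning
    u = lin a u₀ u₁
    w = lin a w₀ w₁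
    eq : ∀ a wj wj′ ui ui′ → wj′ * (a * ui′ - ui) - wj * ui′ ≡ (a * wj′ - wj) * ui′ - wj′ * ui
    eq = solve-∀

  -- Weighted quivers and their mutations

  -- P and Q stand for the vertices 1 and 2, exchanging their names at each mutation at one of
  -- them; X stands for n, and I 0, I 1, … for n-1, n-2, …, 3, the order in which they are mutated.
  data Vtx (N : ℕ) : Set where
    P Q X : Vtx N
    I     : Fin N → Vtx N

  -- The signs are chosen such that positive `a`, `x`, `y` give a 3-cycle P → Q → X → P and positive
  -- `a`, `f i`, `g i` a 3-cycle P → Q → I i → P; a positive `h i` is directed from `X` to `I i`.
  record Params (N : ℕ) : Set where
    field
      a x y : ℤ
      f g h : Fin N → ℤ
      r     : Fin N → Fin N → ℤ

  Weights : Set → Set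
  Weights V = V → V → ℤ

  K : ∀ {N} → Params N → Weights (Vtx N)
  K S P     P     = 0ℤ
  K S P     Q     = Params.a S
  K S P     X     = - Params.x S
  K S P     (I i) = - Params.f S i
  K S Q     P     = - Params.a S
  K S Q     Q     = 0ℤ
  K S Q     X     = Params.y S
  K S Q     (I i) = Params.g S i
  K S X     P     = Params.x S
  K S X     Q     = - Params.y S
  K S X     X     = 0ℤ
  K S X     (I i) = Params.h S i
  K S (I i) P     = Params.f S i
  K S (I i) Q     = - Params.g S i
  K S (I i) X     = - Params.h S i
  K S (I i) (I j) = Params.r S i j

  Skew : ∀ {V} → Weights V → Set
  Skew M = ∀ u v → M u v ≡ - M v u

  K-skew : ∀ {N} (S : Params N) → Skew (Params.r S) → Skew (K S)
  K-skew S sk P     P     = refl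
  K-skew S sk P     Q     = sym (neg-involutive _)
  K-skew S sk P     X     = refl
  K-skew S sk P     (I i) = refl
  K-skew S sk Q     P     = refl
  K-skew S sk Q     Q     = refl
  K-skew S sk Q     X     = sym (neg-involutive _)
  K-skew S sk Q     (I i) = sym (neg-involutive _)
  K-skew S sk X     P     = sym (neg-involutive _)
  K-skew S sk X     Q     = refl
  K-skew S sk X     X     = refl
  K-skew S sk X     (I i) = sym (neg-involutive _)
  K-skew S sk (I i) P     = sym (neg-involutive _)
  K-skew S sk (I i) Q     = refl
  K-skew S sk (I i) X     = refl
  K-skew S sk (I i) (I j) = sk i j

  swap₁₂ : ∀ {N} → Vtx N → Vtx N
  swap₁₂ P     = Q
  swap₁₂ Q     = P
  swap₁₂ X     = X
  swap₁₂ (I i) = I i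

  swap₁₂-involutive : ∀ {N} (u : Vtx N) → swap₁₂ (swap₁₂ u) ≡ u
  swap₁₂-involutive P     = refl
  swap₁₂-involutive Q     = refl
  swap₁₂-involutive X     = refl
  swap₁₂-involutive (I i) = refl

  -- Reversing all arrows keeps the shape of `K` once `P` and `Q` exchange names. Opposite quivers
  -- thus stay within `Params`, and an isomorphism onto an opposite is again one between two
  -- matrices `K`.
  reversed : ∀ {N} → Params N → Params N
  reversed S = record
    { a = S.a ; x = S.y ; y = S.x ; f = S.g ; g = S.f
    ; h = λ i → - S.h i ; r = λ i j → - S.r i j }
    where module S = Params S

  K-reversed : ∀ {N} (S : Params N) u v → K (reversed S) (swap₁₂ u) (swap₁₂ v) ≡ - K S u v
  K-reversed S P     P     = refl
  K-reversed S P     Q     = refl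
  K-reversed S P     X     = sym (neg-involutive _)
  K-reversed S P     (I i) = sym (neg-involutive _)
  K-reversed S Q     P     = sym (neg-involutive _)
  K-reversed S Q     Q     = refl
  K-reversed S Q     X     = refl
  K-reversed S Q     (I i) = refl
  K-reversed S X     P     = refl
  K-reversed S X     Q     = sym (neg-involutive _)
  K-reversed S X     X     = refl
  K-reversed S X     (I i) = refl
  K-reversed S (I i) P     = refl
  K-reversed S (I i) Q     = sym (neg-involutive _)
  K-reversed S (I i) X     = refl
  K-reversed S (I i) (I j) = refl

  record Mutates {V : Set} (k : V) (M M′ : Weights V) : Set where
    field
      left  : ∀ v → M′ k v ≡ - M k v
      right : ∀ u → M′ u k ≡ - M u k
      away  : ∀ u v → k ≢ u → k ≢ v → M′ u v ≡ M u v + τ (M u k) (M k v)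

  -- Halves the case checks below. `τ` is symmetric and changes sign when both arguments do, so both
  -- sides of the mutation rule are skew.
  away-sym : ∀ {V : Set} {M M′ : Weights V} → Skew M → Skew M′ → ∀ {k} u v →
             M′ u v ≡ M u v + τ (M u k) (M k v) → M′ v u ≡ M v u + τ (M v k) (M k u)
  away-sym {M = M} {M′} sk sk′ {k} u v eq = begin
    M′ v u                               ≡⟨ sk′ v u ⟩
    - M′ u v                             ≡⟨ cong -_ eq ⟩
    - (M u v + τ (M u k) (M k v))        ≡⟨ neg-distrib-+ (M u v) _ ⟩
    - M u v + - τ (M u k) (M k v)        ≡⟨ cong₂ _+_ (sym (sk v u)) (sym (τ-neg (M u k) (M k v))) ⟩
    M v u + τ (- M u k) (- M k v)        ≡⟨ cong (_+_ (M v u)) (cong₂ τ (sym (sk k u)) (sym (sk v k))) ⟩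
    M v u + τ (M k u) (M v k)            ≡⟨ cong (_+_ (M v u)) (τ-comm (M k u) (M v k)) ⟩
    M v u + τ (M v k) (M k u)            ∎
    where open ≡-Reasoning

  -- The new parameters are read after the exchange of names, so the vertex just mutated is then
  -- called `P`. By `g-sign` no path leads from one `I i` through `Q` to another, hence no arrows
  -- arise between these.
  record StepQ {N} (S S′ : Params N) : Set where
    private
      module S  = Params S
      module S′ = Params S′
    field
      a-eq : S′.a ≡ S.a
      x-eq : S′.x ≡ S.y
      y-eq : S′.y ≡ - S.x + τ S.a S.y
      f-eq : ∀ i → S′.f i ≡ S.g i
      g-eq : ∀ i → S′.g i ≡ - S.f i + τ S.a (S.g i)
      h-eq : ∀ i → S′.h i ≡ S.h i + τ (- S.y) (S.g i)
      r-eq : ∀ i j → S′.r i j ≡ S.r i j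
      g-sign : (∀ i → 0ℤ ≤ S.g i) ⊎ (∀ i → S.g i ≤ 0ℤ)

  -- By the three sign conditions every path through `P` ends at `Q`, so only entries at the old `Q`
  -- gain a product.
  record StepP {N} (S S′ : Params N) : Set where
    private
      module S  = Params S
      module S′ = Params S′
    field
      a-eq : S′.a ≡ S.a
      x-eq : S′.x ≡ S.a * S.x - S.y
      y-eq : S′.y ≡ S.x
      f-eq : ∀ i → S′.f i ≡ S.a * S.f i - S.g i
      g-eq : ∀ i → S′.g i ≡ S.f i
      h-eq : ∀ i → S′.h i ≡ S.h i
      r-eq : ∀ i j → S′.r i j ≡ S.r i j
      0≤a  : 0ℤ ≤ S.a
      0≤x  : 0ℤ ≤ S.x
      0≤f  : ∀ i → 0ℤ ≤ S.f i

  +0-by : ∀ {u u′ t} → u′ ≡ u → t ≡ 0ℤ → u′ ≡ u + t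
  +0-by {u} refl refl = sym (+-identityʳ u)

  module _ {N} {S S′ : Params N} (sk : Skew (Params.r S)) (sk′ : Skew (Params.r S′)) where
    private
      module S  = Params S
      module S′ = Params S′
      M M′ : Weights (Vtx N)
      M      = K S
      M′ u v = K S′ (swap₁₂ u) (swap₁₂ v)
      skM′ : Skew M′
      skM′ u v = K-skew S′ sk′ (swap₁₂ u) (swap₁₂ v)
      skM : Skew M
      skM = K-skew S sk
      diag : ∀ k u → M u u ≡ 0ℤ → M′ u u ≡ 0ℤ → M′ u u ≡ M u u + τ (M u k) (M k u)
      diag k u z z′ = +0-by (trans z′ (sym z)) (trans (cong (τ (M u k)) (skM k u)) (τ-inv (M u k)))
      right-of : ∀ {k} → (∀ v → M′ k v ≡ - M k v) → ∀ u → M′ u k ≡ - M u k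
      right-of {k} l u = trans (skM′ u k) (cong -_ (trans (l u) (sym (skM u k))))
      flip-away : ∀ k u v → M′ u v ≡ M u v + τ (M u k) (M k v) → M′ v u ≡ M v u + τ (M v k) (M k u)
      flip-away k = away-sym {M = M} {M′} skM skM′ {k}

    mutates-Q : StepQ S S′ → Mutates Q (K S) (λ u v → K S′ (swap₁₂ u) (swap₁₂ v))
    mutates-Q st = record { left = left ; right = right-of left ; away = away }
      where
      open StepQ st
      left : ∀ v → M′ Q v ≡ - M Q v
      left P     = trans a-eq (sym (neg-involutive S.a))
      left Q     = refl
      left X     = cong -_ x-eq
      left (I i) = cong -_ (f-eq i)
      τ-g : ∀ i j → τ (- S.g i) (S.g j) ≡ 0ℤ
      τ-g i j with g-sign
      ... | inj₁ s = τ⁻⁺ (neg-mono-≤ (s i)) (s j)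
      ... | inj₂ s = τ⁺⁻ (neg-mono-≤ (s i)) (s j)
      away : ∀ u v → Q ≢ u → Q ≢ v → M′ u v ≡ M u v + τ (M u Q) (M Q v)
      away Q     v     ne _ = contradiction refl ne
      away u     Q     _ ne = contradiction refl ne
      away P     P     _ _ = diag Q P refl refl
      away P     X     _ _ = y-eq
      away P     (I i) _ _ = g-eq i
      away X     P     _ _ = flip-away Q P X y-eq
      away X     X     _ _ = diag Q X refl refl
      away X     (I i) _ _ = h-eq i
      away (I i) P     _ _ = flip-away Q P (I i) (g-eq i)
      away (I i) X     _ _ = flip-away Q X (I i) (h-eq i)
      away (I i) (I j) _ _ = +0-by (r-eq i j) (τ-g i j)

    mutates-P : StepP S S′ → Mutates P (K S) (λ u v → K S′ (swap₁₂ u) (swap₁₂ v))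
    mutates-P st = record { left = left ; right = right-of left ; away = away }
      where
      open StepP st
      left : ∀ v → M′ P v ≡ - M P v
      left P     = refl
      left Q     = cong -_ a-eq
      left X     = trans y-eq (sym (neg-involutive S.x))
      left (I i) = trans (g-eq i) (sym (neg-involutive (S.f i)))
      via-P : ∀ {v w z} → 0ℤ ≤ v → z ≡ S.a * v - w → - z ≡ w + τ (- S.a) (- v)
      via-P {v} {w} 0≤v refl = trans (eq S.a v w)
        (cong (_+_ w) (sym (trans (τ-neg S.a v) (cong -_ (τ⁺⁺ 0≤a 0≤v)))))
        where
        eq : ∀ a v w → - (a * v - w) ≡ w + - (a * v)
        eq = solve-∀
      away : ∀ u v → P ≢ u → P ≢ v → M′ u v ≡ M u v + τ (M u P) (M P v)
      away P     v     ne _ = contradiction refl ne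
      away u     P     _ ne = contradiction refl ne
      away Q     Q     _ _ = diag P Q refl refl
      away Q     X     _ _ = via-P 0≤x x-eq
      away Q     (I i) _ _ = via-P (0≤f i) (f-eq i)
      away X     Q     _ _ = flip-away P Q X (via-P 0≤x x-eq)
      away X     X     _ _ = diag P X refl refl
      away X     (I i) _ _ = +0-by (h-eq i) (τ⁺⁻ 0≤x (neg-mono-≤ (0≤f i)))
      away (I i) Q     _ _ = flip-away P Q (I i) (via-P (0≤f i) (f-eq i))
      away (I i) X     _ _ = flip-away P X (I i) (+0-by (h-eq i) (τ⁺⁻ 0≤x (neg-mono-≤ (0≤f i))))
      away (I i) (I j) _ _ = +0-by (r-eq i j) (τ⁺⁻ (0≤f i) (neg-mono-≤ (0≤f j)))

  negIf : Bool → ℤ → ℤ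
  negIf true  z = - z
  negIf false z = z

  negIf-neg : ∀ b z → negIf b (- z) ≡ - negIf b z
  negIf-neg true  z = refl
  negIf-neg false z = refl

  below : ∀ {N} → ℕ → Fin N → Bool
  below m i = does (toℕ i ℕ.<? m)

  -- No path runs through a sink, so a mutation there merely negates the entries at the vertex. An
  -- entry between two mutated vertices is negated twice.
  flipped : ∀ {N} → ℕ → Params N → Params N
  flipped m S = record
    { a = S.a ; x = S.x ; y = S.y
    ; f = λ i → negIf (below m i) (S.f i)
    ; g = λ i → negIf (below m i) (S.g i)
    ; h = λ i → negIf (below m i) (S.h i)
    ; r = λ i j → negIf (below m i) (negIf (below m j) (S.r i j)) }
    where module S = Params S

  negIf-comm : ∀ b c z → negIf b (negIf c z) ≡ negIf c (negIf b z)
  negIf-comm true  true  z = refl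
  negIf-comm true  false z = refl
  negIf-comm false true  z = refl
  negIf-comm false false z = refl

  flipped-skew : ∀ {N} m (S : Params N) → Skew (Params.r S) → Skew (Params.r (flipped m S))
  flipped-skew m S sk i j = begin
    negIf b (negIf c (S.r i j))       ≡⟨ cong (negIf b ∘ negIf c) (sk i j) ⟩
    negIf b (negIf c (- S.r j i))     ≡⟨ cong (negIf b) (negIf-neg c (S.r j i)) ⟩
    negIf b (- negIf c (S.r j i))     ≡⟨ negIf-neg b (negIf c (S.r j i)) ⟩
    - negIf b (negIf c (S.r j i))     ≡⟨ cong -_ (negIf-comm b c (S.r j i)) ⟩
    - negIf c (negIf b (S.r j i))     ∎
    where
    open ≡-Reasoning
    module S = Params S
    b = below m i
    c = below m j

  skew-diag : ∀ {V} {M : Weights V} → Skew M → ∀ u → M u u ≡ 0ℤ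
  skew-diag {M = M} sk u = self-neg (M u u) (sk u u)
    where
    self-neg : ∀ z → z ≡ - z → z ≡ 0ℤ
    self-neg (+ zero)  _ = refl
    self-neg +[1+ n ] ()
    self-neg -[1+ n ] ()

  -- `I k` is a sink when its turn comes: its arrows originally lead only to vertices `I j` with `j`
  -- below `k`, and the mutations at these have just reversed them.
  mutates-I : ∀ {N} {S : Params N} → Skew (Params.r S) → (∀ i → Params.f S i ≤ 0ℤ) → (∀ i → 0ℤ ≤ Params.g S i) →
              (∀ i → 0ℤ ≤ Params.h S i) → (∀ {i j} → toℕ j ℕ.< toℕ i → 0ℤ ≤ Params.r S i j) → ∀ k →
              Mutates (I k) (K (flipped (toℕ k) S)) (K (flipped (suc (toℕ k)) S))
  mutates-I {N} {S} sk f≤0 0≤g 0≤h 0≤r k = record { left = left ; right = right ; away = away }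
    where
    module S = Params S
    m = toℕ k
    M  = K (flipped m S)
    M′ = K (flipped (suc m) S)
    skM : Skew M
    skM = K-skew (flipped m S) (flipped-skew m S sk)
    skM′ : Skew M′
    skM′ = K-skew (flipped (suc m) S) (flipped-skew (suc m) S sk)

    now : below m k ≡ false
    now = dec-false (toℕ k ℕ.<? m) (ℕ.<-irrefl refl)
    then : below (suc m) k ≡ true
    then = dec-true (toℕ k ℕ.<? suc m) ℕ.≤-refl
    same : ∀ {j} → k ≢ j → below (suc m) j ≡ below m j
    same {j} k≢j with ℕ.<-cmp (toℕ j) m
    ... | tri< j<m _ _ = trans (dec-true (toℕ j ℕ.<? suc m) (ℕ.m<n⇒m<1+n j<m)) (sym (dec-true (toℕ j ℕ.<? m) j<m))
    ... | tri≈ _ j≡m _ = contradiction (toℕ-injective (sym j≡m)) k≢j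
    ... | tri> j≮m _ m<j = trans (dec-false (toℕ j ℕ.<? suc m) (ℕ.≤⇒≯ m<j)) (sym (dec-false (toℕ j ℕ.<? m) j≮m))

    flip-k : ∀ z → negIf (below (suc m) k) z ≡ - negIf (below m k) z
    flip-k z = trans (cong (λ b → negIf b z) then) (cong (λ b → - negIf b z) (sym now))

    left : ∀ v → M′ (I k) v ≡ - M (I k) v
    left P     = flip-k (S.f k)
    left Q     = cong -_ (flip-k (S.g k))
    left X     = cong -_ (flip-k (S.h k))
    left (I j) with k ≟ j
    ... | yes refl = trans (skew-diag {M = M′} skM′ (I k)) (cong -_ (sym (skew-diag {M = M} skM (I k))))
    ... | no k≢j   = trans (flip-k _) (cong (λ b → - negIf (below m k) (negIf b (S.r k j))) (same k≢j))

    right : ∀ u → M′ u (I k) ≡ - M u (I k)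
    right u = trans (skM′ u (I k)) (cong -_ (trans (left u) (sym (skM u (I k)))))

    unchanged : ∀ u v → I k ≢ u → I k ≢ v → M′ u v ≡ M u v
    unchanged P     P     _ _ = refl
    unchanged P     Q     _ _ = refl
    unchanged P     X     _ _ = refl
    unchanged P     (I j) _ q = cong (λ b → - negIf b (S.f j)) (same (q ∘ cong I))
    unchanged Q     P     _ _ = refl
    unchanged Q     Q     _ _ = refl
    unchanged Q     X     _ _ = refl
    unchanged Q     (I j) _ q = cong (λ b → negIf b (S.g j)) (same (q ∘ cong I))
    unchanged X     P     _ _ = refl
    unchanged X     Q     _ _ = refl
    unchanged X     X     _ _ = refl
    unchanged X     (I j) _ q = cong (λ b → negIf b (S.h j)) (same (q ∘ cong I))
    unchanged (I i) P     p _ = cong (λ b → negIf b (S.f i)) (same (p ∘ cong I))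
    unchanged (I i) Q     p _ = cong (λ b → - negIf b (S.g i)) (same (p ∘ cong I))
    unchanged (I i) X     p _ = cong (λ b → - negIf b (S.h i)) (same (p ∘ cong I))
    unchanged (I i) (I j) p q = cong₂ (λ b c → negIf b (negIf c (S.r i j))) (same (p ∘ cong I)) (same (q ∘ cong I))

    into-k : ∀ {z} → 0ℤ ≤ z → 0ℤ ≤ negIf (below m k) z
    into-k {z} = subst (λ b → 0ℤ ≤ negIf b z) (sym now)

    sink : ∀ u → 0ℤ ≤ M u (I k)
    sink P     = subst (0ℤ ≤_) (negIf-neg (below m k) (S.f k)) (into-k (neg-mono-≤ (f≤0 k)))
    sink Q     = into-k (0≤g k)
    sink X     = into-k (0≤h k)
    sink (I j) with ℕ.<-cmp (toℕ j) m
    ... | tri< j<m _ _ = subst (λ b → 0ℤ ≤ negIf b (negIf (below m k) (S.r j k))) (sym (dec-true (toℕ j ℕ.<? m) j<m))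
                           (subst (0ℤ ≤_) (trans (cong (negIf (below m k)) (sk k j)) (negIf-neg (below m k) (S.r j k)))
                             (into-k (0≤r j<m)))
    ... | tri≈ _ j≡m _ = ≤-reflexive (sym (trans (cong (M (I j)) (cong I (sym (toℕ-injective j≡m)))) (skew-diag {M = M} skM (I j))))
    ... | tri> j≮m _ m<j = subst (λ b → 0ℤ ≤ negIf b (negIf (below m k) (S.r j k))) (sym (dec-false (toℕ j ℕ.<? m) j≮m))
                           (into-k (0≤r m<j))

    away : ∀ u v → I k ≢ u → I k ≢ v → M′ u v ≡ M u v + τ (M u (I k)) (M (I k) v)
    away u v p q = +0-by (unchanged u v p q)
      (τ⁺⁻ (sink u) (subst (_≤ 0ℤ) (sym (skM (I k) v)) (neg-mono-≤ (sink v))))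

  μ-mutates : ∀ {n} {V : Set} {B : Mat n} (e : V → Fin n) → (∀ {u v} → e u ≡ e v → u ≡ v) → ∀ {k M M′} →
              Mutates k M M′ → (∀ u v → B (e u) (e v) ≡ M u v) → ∀ u v → μ (e k) B (e u) (e v) ≡ M′ u v
  μ-mutates e inj {k} m lab u v with e k ≟ e u | e k ≟ e v
  ... | yes p | _     rewrite inj p = trans (cong -_ (lab u v)) (sym (Mutates.left m v))
  ... | no _  | yes p rewrite inj p = trans (cong -_ (lab u v)) (sym (Mutates.right m u))
  ... | no p  | no q  = trans (cong₂ _+_ (lab u v) (cong₂ τ (lab u k) (lab k v)))
                          (sym (Mutates.away m u v (p ∘ cong e) (q ∘ cong e)))

  -- 3-cycles and isomorphisms

  module _ {V : Set} (M : Weights V) where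

    record Cycle (u v w : V) : Set where
      constructor cycle
      field
        uv : Pos (M u v)
        vw : Pos (M v w)
        wu : Pos (M w u)

    Hit : V → Set
    Hit z = ∀ {u v w} → Cycle u v w → z ≡ u ⊎ z ≡ v ⊎ z ≡ w

    Free : V → Set
    Free z = ∀ v w → ¬ Cycle z v w

    OnCycle : V → Set
    OnCycle z = ∃₂ λ v w → Cycle z v w

    -- The set of vertices lying on all 3-cycles is preserved by isomorphisms. For a book it
    -- consists of `s` and `t`, which the direction of the spine tells apart.
    record Book (s t : V) : Set where
      field
        spine : Pos (M s t)
        hit-s : Hit s
        hit-t : Hit t
        only  : ∀ {z} → Hit z → z ≡ s ⊎ z ≡ t

    record Hub (z : V) : Set where
      field
        hit  : Hit z
        only : ∀ {w} → Hit w → w ≡ z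

  record Iso {V W : Set} (M : Weights V) (M′ : Weights W) : Set where
    field
      to       : V → W
      from     : W → V
      to-from  : ∀ w → to (from w) ≡ w
      from-to  : ∀ v → from (to v) ≡ v
      preserves : ∀ u v → M′ (to u) (to v) ≡ M u v

    to-injective : ∀ {u v} → to u ≡ to v → u ≡ v
    to-injective {u} {v} eq = trans (sym (from-to u)) (trans (cong from eq) (from-to v))

    preserves-from : ∀ u v → M (from u) (from v) ≡ M′ u v
    preserves-from u v = trans (sym (preserves (from u) (from v))) (cong₂ M′ (to-from u) (to-from v))

    weight : ∀ {u v u′ v′} → to u ≡ u′ → to v ≡ v′ → M′ u′ v′ ≡ M u v
    weight refl refl = preserves _ _

  Iso-sym : ∀ {V W} {M : Weights V} {M′ : Weights W} → Iso M M′ → Iso M′ M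
  Iso-sym φ = record
    { to = from ; from = to ; to-from = from-to ; from-to = to-from ; preserves = preserves-from }
    where open Iso φ

  module _ {V W : Set} {M : Weights V} {M′ : Weights W} (φ : Iso M M′) where
    open Iso φ

    to-cycle : ∀ {u v w} → Cycle M u v w → Cycle M′ (to u) (to v) (to w)
    to-cycle {u} {v} {w} (cycle p q r) = cycle (move u v p) (move v w q) (move w u r)
      where
      move : ∀ u v → Pos (M u v) → Pos (M′ (to u) (to v))
      move u v = subst Pos (sym (preserves u v))

    from-cycle : ∀ {u v w} → Cycle M′ u v w → Cycle M (from u) (from v) (from w)
    from-cycle {u} {v} {w} (cycle p q r) = cycle (move u v p) (move v w q) (move w u r)
      where
      move : ∀ u v → Pos (M′ u v) → Pos (M (from u) (from v))
      move u v = subst Pos (sym (preserves-from u v))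

    to-hit : ∀ {z} → Hit M z → Hit M′ (to z)
    to-hit hit c = Sum.map back (Sum.map back back) (hit (from-cycle c))
      where
      back : ∀ {z w} → z ≡ from w → to z ≡ w
      back {w = w} refl = to-from w

    free⊥onCycle : ∀ {z} → Free M z → (∀ w → OnCycle M′ w) → ⊥
    free⊥onCycle {z} fr all with all (to z)
    ... | v , w , c = fr (from v) (from w) (subst (λ u → Cycle M u (from v) (from w)) (from-to z) (from-cycle c))

    -- Both ends go to ends of the other spine. If they had the same image, the spine would be a
    -- loop; if they were exchanged, it would be reversed.
    book-book : ∀ {s t s′ t′} → M s s ≡ 0ℤ → Skew M′ → Book M s t → Book M′ s′ t′ → to s ≡ s′ × to t ≡ t′
    book-book {s} {t} loop sk b b′ with Book.only b′ (to-hit (Book.hit-s b)) | Book.only b′ (to-hit (Book.hit-t b))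
    ... | inj₁ p | inj₂ q = p , q
    ... | inj₁ p | inj₁ q = ⊥-elim (<-irrefl refl (subst Pos (trans (cong (M s) (to-injective (trans q (sym p)))) loop) (Book.spine b)))
    ... | inj₂ p | inj₂ q = ⊥-elim (<-irrefl refl (subst Pos (trans (cong (M s) (to-injective (trans q (sym p)))) loop) (Book.spine b)))
    ... | inj₂ p | inj₁ q = ⊥-elim (<-asym (Book.spine b′)
            (subst Neg (sym (trans (sk _ _) (cong -_ (weight p q)))) (neg-mono-< (Book.spine b))))

    book⊥hub : ∀ {s t z} → M s s ≡ 0ℤ → Book M s t → Hub M′ z → ⊥
    book⊥hub {s} loop b h = <-irrefl refl (subst Pos (trans (cong (M s) t≡s) loop) (Book.spine b))
      where t≡s = to-injective (trans (Hub.only h (to-hit (Book.hit-t b))) (sym (Hub.only h (to-hit (Book.hit-s b)))))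

    hub-hub : ∀ {z z′} → Hub M z → Hub M′ z′ → to z ≡ z′
    hub-hub h h′ = Hub.only h′ (to-hit (Hub.hit h))

  module _ {N : ℕ} (S : Params N) (sk : Skew (Params.r S)) where

    private
      M  = K S
      M⁻ = K (reversed S)

    K⁻ : ∀ u v → M⁻ u v ≡ M (swap₁₂ v) (swap₁₂ u)
    K⁻ u v = begin
      M⁻ u v                                         ≡⟨ cong₂ M⁻ (sym (swap₁₂-involutive u)) (sym (swap₁₂-involutive v)) ⟩
      M⁻ (swap₁₂ (swap₁₂ u)) (swap₁₂ (swap₁₂ v))     ≡⟨ K-reversed S (swap₁₂ u) (swap₁₂ v) ⟩
      - M (swap₁₂ u) (swap₁₂ v)                      ≡⟨ sym (K-skew S sk (swap₁₂ v) (swap₁₂ u)) ⟩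
      M (swap₁₂ v) (swap₁₂ u)                        ∎
      where open ≡-Reasoning

    reverse-cycle : ∀ u v w → Cycle M⁻ u v w → Cycle M (swap₁₂ u) (swap₁₂ w) (swap₁₂ v)
    reverse-cycle u v w (cycle p q r) = cycle (subst Pos (K⁻ w u) r) (subst Pos (K⁻ v w) q) (subst Pos (K⁻ u v) p)

    reverse-cycle⁻ : ∀ u v w → Cycle M u v w → Cycle M⁻ (swap₁₂ u) (swap₁₂ w) (swap₁₂ v)
    reverse-cycle⁻ u v w (cycle p q r) = cycle (unK w u r) (unK v w q) (unK u v p)
      where
      unK : ∀ u v → Pos (M u v) → Pos (M⁻ (swap₁₂ v) (swap₁₂ u))
      unK u v = subst Pos (sym (trans (K⁻ (swap₁₂ v) (swap₁₂ u)) (cong₂ M (swap₁₂-involutive u) (swap₁₂-involutive v))))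

    private
      unswap : ∀ {u v : Vtx N} → u ≡ swap₁₂ v → swap₁₂ u ≡ v
      unswap {v = v} refl = swap₁₂-involutive v
      rot : ∀ {A B C : Set} → A ⊎ B ⊎ C → A ⊎ C ⊎ B
      rot (inj₁ p)        = inj₁ p
      rot (inj₂ (inj₁ p)) = inj₂ (inj₂ p)
      rot (inj₂ (inj₂ p)) = inj₂ (inj₁ p)

    hit-reversed : ∀ {z} → Hit M z → Hit M⁻ (swap₁₂ z)
    hit-reversed hit {u} {v} {w} c = Sum.map unswap (Sum.map unswap unswap) (rot (hit (reverse-cycle u v w c)))

    hit-reversed⁻ : ∀ {z} → Hit M⁻ z → Hit M (swap₁₂ z)
    hit-reversed⁻ hit {u} {v} {w} c = Sum.map unswap (Sum.map unswap unswap) (rot (hit (reverse-cycle⁻ u v w c)))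

    onCycle-reversed : (∀ z → OnCycle M z) → ∀ z → OnCycle M⁻ z
    onCycle-reversed all z with all (swap₁₂ z)
    ... | v , w , c = swap₁₂ w , swap₁₂ v , subst (λ u → Cycle M⁻ u (swap₁₂ w) (swap₁₂ v)) (swap₁₂-involutive z) (reverse-cycle⁻ (swap₁₂ z) v w c)

    reswap : ∀ {u v : Vtx N} → swap₁₂ u ≡ v → u ≡ swap₁₂ v
    reswap {u} refl = sym (swap₁₂-involutive u)

    book-reversed : ∀ {s t} → Book M s t → Book M⁻ (swap₁₂ t) (swap₁₂ s)
    book-reversed {s} {t} b = record
      { spine = subst Pos (sym (trans (K⁻ (swap₁₂ t) (swap₁₂ s)) (cong₂ M (swap₁₂-involutive s) (swap₁₂-involutive t)))) spine
      ; hit-s = hit-reversed hit-t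
      ; hit-t = hit-reversed hit-s
      ; only  = λ hit → Sum.swap (Sum.map reswap reswap (only (hit-reversed⁻ hit)))
      } where open Book b

    hub-reversed : ∀ {z} → Hub M z → Hub M⁻ (swap₁₂ z)
    hub-reversed h = record
      { hit  = hit-reversed hit
      ; only = λ hit → reswap (only (hit-reversed⁻ hit))
      } where open Hub h

  Apart : ∀ {N} → Params N → Params N → Set
  Apart S S′ = ¬ Iso (K S) (K S′) × ¬ Iso (K S) (K (reversed S′))

  -- For the opposite quiver, conjugating the isomorphism with `swap₁₂` moves the reversal from one
  -- side to the other.
  Apart-sym : ∀ {N} {S S′ : Params N} → Apart S S′ → Apart S′ S
  Apart-sym {S = S} {S′} (apart , apart⁻) = apart ∘ Iso-sym , λ φ → apart⁻ (back φ)
    where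
    back : Iso (K S′) (K (reversed S)) → Iso (K S) (K (reversed S′))
    back φ = Iso-sym (record
      { to = swap₁₂ ∘ to ∘ swap₁₂
      ; from = swap₁₂ ∘ from ∘ swap₁₂
      ; to-from = λ w → trans (cong (swap₁₂ ∘ to) (swap₁₂-involutive (from (swap₁₂ w)))) (trans (cong swap₁₂ (to-from (swap₁₂ w))) (swap₁₂-involutive w))
      ; from-to = λ w → trans (cong (swap₁₂ ∘ from) (swap₁₂-involutive (to (swap₁₂ w)))) (trans (cong swap₁₂ (from-to (swap₁₂ w))) (swap₁₂-involutive w))
      ; preserves = λ u v → begin
          K S (swap₁₂ (to (swap₁₂ u))) (swap₁₂ (to (swap₁₂ v)))                   ≡⟨ neg-swap (to (swap₁₂ u)) (to (swap₁₂ v)) ⟩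
          - K (reversed S) (to (swap₁₂ u)) (to (swap₁₂ v))                        ≡⟨ cong -_ (preserves (swap₁₂ u) (swap₁₂ v)) ⟩
          - K S′ (swap₁₂ u) (swap₁₂ v)                                            ≡⟨ sym (K-reversed S′ (swap₁₂ u) (swap₁₂ v)) ⟩
          K (reversed S′) (swap₁₂ (swap₁₂ u)) (swap₁₂ (swap₁₂ v))                 ≡⟨ cong₂ (K (reversed S′)) (swap₁₂-involutive u) (swap₁₂-involutive v) ⟩
          K (reversed S′) u v                                                     ∎
      })
      where
      open Iso φ
      open ≡-Reasoning
      neg-swap : ∀ u v → K S (swap₁₂ u) (swap₁₂ v) ≡ - K (reversed S) u v
      neg-swap u v = begin
        K S (swap₁₂ u) (swap₁₂ v)                                     ≡⟨ sym (neg-involutive _) ⟩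
        - - K S (swap₁₂ u) (swap₁₂ v)                                 ≡⟨ cong -_ (sym (K-reversed S (swap₁₂ u) (swap₁₂ v))) ⟩
        - K (reversed S) (swap₁₂ (swap₁₂ u)) (swap₁₂ (swap₁₂ v))      ≡⟨ cong₂ (λ s t → - K (reversed S) s t) (swap₁₂-involutive u) (swap₁₂-involutive v) ⟩
        - K (reversed S) u v                                          ∎

  -- Sign patterns

  data Kind : Set where
    kP kQ kX : Kind
    kI       : Bool → Kind

  -- The signs of the entries of a weight matrix when the vertices I i fall into
  -- two classes, of which only the used ones occur; true stands for a positive entry.
  record Pattern : Set where
    field
      sx sy    : Bool
      sf sg sh : Bool → Bool
      sr       : Bool → Bool → Bool
      used     : Bool → Bool

  directed : Pattern → Kind → Kind → Bool
  directed σ kP     kP     = false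
  directed σ kP     kQ     = true
  directed σ kP     kX     = not (Pattern.sx σ)
  directed σ kP     (kI b) = not (Pattern.sf σ b)
  directed σ kQ     kP     = false
  directed σ kQ     kQ     = false
  directed σ kQ     kX     = Pattern.sy σ
  directed σ kQ     (kI b) = Pattern.sg σ b
  directed σ kX     kP     = Pattern.sx σ
  directed σ kX     kQ     = not (Pattern.sy σ)
  directed σ kX     kX     = false
  directed σ kX     (kI b) = Pattern.sh σ b
  directed σ (kI b) kP     = Pattern.sf σ b
  directed σ (kI b) kQ     = not (Pattern.sg σ b)
  directed σ (kI b) kX     = not (Pattern.sh σ b)
  directed σ (kI b) (kI c) = Pattern.sr σ b c

  present : Pattern → Kind → Bool
  present σ (kI b) = Pattern.used σ b
  present σ _      = true

  arrow : Pattern → Kind → Kind → Bool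
  arrow σ u v = present σ u ∧ present σ v ∧ directed σ u v

  Sign : Bool → ℤ → Set
  Sign true  = Pos
  Sign false = Neg

  Acyclic : ∀ {V} → Weights V → Set
  Acyclic M = ∀ {u v w} → ¬ Cycle M u v w

  -- Between the vertices `I i` the pattern only bounds the arrows from above. This is enough,
  -- because patterns serve to show that all 3-cycles meet or avoid a vertex; that a 3-cycle exists
  -- is always shown by exhibiting it.
  record HasPattern {N} (S : Params N) (c : Fin N → Bool) (σ : Pattern) : Set where
    open Params S
    open Pattern σ
    field
      0<a     : Pos a
      sign-x  : Sign sx x
      sign-y  : Sign sy y
      sign-f  : ∀ i → Sign (sf (c i)) (f i)
      sign-g  : ∀ i → Sign (sg (c i)) (g i)
      sign-h  : ∀ i → Sign (sh (c i)) (h i)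
      sign-r  : ∀ i j → Pos (r i j) → T (sr (c i) (c j))
      acyclic : Acyclic r
      in-use  : ∀ i → T (used (c i))

  kind : ∀ {N} → (Fin N → Bool) → Vtx N → Kind
  kind c P     = kP
  kind c Q     = kQ
  kind c X     = kX
  kind c (I i) = kI (c i)

  pos-sign : ∀ {b z} → Sign b z → Pos z → T b
  pos-sign {true}  _ _ = tt
  pos-sign {false} n p = <-asym n p

  neg-pos : ∀ {z} → Pos (- z) → Neg z
  neg-pos {z} p = subst Neg (neg-involutive z) (neg-mono-< p)

  neg-sign : ∀ {b z} → Sign b z → Pos (- z) → T (not b)
  neg-sign {true}  {z} p q = <-asym p (neg-pos q)
  neg-sign {false} _ _ = tt

  directed-sound : ∀ {N} {S : Params N} {c σ} → HasPattern S c σ → ∀ u v → Pos (K S u v) → T (directed σ (kind c u) (kind c v))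
  directed-sound H P     P     p = <-irrefl refl p
  directed-sound H P     Q     p = tt
  directed-sound H P     X     p = neg-sign (HasPattern.sign-x H) p
  directed-sound H P     (I i) p = neg-sign (HasPattern.sign-f H i) p
  directed-sound H Q     P     p = <-asym (HasPattern.0<a H) (neg-pos p)
  directed-sound H Q     Q     p = <-irrefl refl p
  directed-sound H Q     X     p = pos-sign (HasPattern.sign-y H) p
  directed-sound H Q     (I i) p = pos-sign (HasPattern.sign-g H i) p
  directed-sound H X     P     p = pos-sign (HasPattern.sign-x H) p
  directed-sound H X     Q     p = neg-sign (HasPattern.sign-y H) p
  directed-sound H X     X     p = <-irrefl refl p
  directed-sound H X     (I i) p = pos-sign (HasPattern.sign-h H i) p
  directed-sound H (I i) P     p = pos-sign (HasPattern.sign-f H i) p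
  directed-sound H (I i) Q     p = neg-sign (HasPattern.sign-g H i) p
  directed-sound H (I i) X     p = neg-sign (HasPattern.sign-h H i) p
  directed-sound H (I i) (I j) p = HasPattern.sign-r H i j p

  ∧-intro : ∀ {b c} → T b → T c → T (b ∧ c)
  ∧-intro {true} _ t = t

  present-sound : ∀ {N} {S : Params N} {c σ} → HasPattern S c σ → ∀ u → T (present σ (kind c u))
  present-sound H P     = tt
  present-sound H Q     = tt
  present-sound H X     = tt
  present-sound H (I i) = HasPattern.in-use H i

  arrow-sound : ∀ {N} {S : Params N} {c σ} → HasPattern S c σ → ∀ u v → Pos (K S u v) → T (arrow σ (kind c u) (kind c v))
  arrow-sound H u v p = ∧-intro (present-sound H u) (∧-intro (present-sound H v) (directed-sound H u v p))

  same : Kind → Kind → Bool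
  same kP         kP         = true
  same kQ         kQ         = true
  same kX         kX         = true
  same (kI true)  (kI true)  = true
  same (kI false) (kI false) = true
  same _          _          = false

  isI : Kind → Bool
  isI (kI _) = true
  isI _      = false

  everyKind : (Kind → Bool) → Bool
  everyKind φ = φ kP ∧ φ kQ ∧ φ kX ∧ φ (kI true) ∧ φ (kI false)

  ∧-elim : ∀ {b c} → T (b ∧ c) → T b × T c
  ∧-elim {true} t = tt , t

  everyKind-sound : ∀ φ → T (everyKind φ) → ∀ k → T (φ k)
  everyKind-sound φ t kP         = proj₁ (∧-elim t)
  everyKind-sound φ t kQ         = proj₁ (∧-elim (proj₂ (∧-elim {φ kP} t)))
  everyKind-sound φ t kX         = proj₁ (∧-elim (proj₂ (∧-elim {φ kQ} (proj₂ (∧-elim {φ kP} t)))))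
  everyKind-sound φ t (kI true)  = proj₁ (∧-elim (proj₂ (∧-elim {φ kX} (proj₂ (∧-elim {φ kQ} (proj₂ (∧-elim {φ kP} t)))))))
  everyKind-sound φ t (kI false) = proj₂ (∧-elim {φ (kI true)} (proj₂ (∧-elim {φ kX} (proj₂ (∧-elim {φ kQ} (proj₂ (∧-elim {φ kP} t)))))))

  infixr 4 _⇒ᵇ_
  _⇒ᵇ_ : Bool → Bool → Bool
  true  ⇒ᵇ b = b
  false ⇒ᵇ b = true

  ⇒ᵇ-elim : ∀ {b c} → T (b ⇒ᵇ c) → T b → T c
  ⇒ᵇ-elim {true} t _ = t

  ∨-elim : ∀ {b c} → T (b ∨ c) → T b ⊎ T c
  ∨-elim {true}  t = inj₁ tt
  ∨-elim {false} t = inj₂ t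

  cycleᵇ : Pattern → Kind → Kind → Kind → Bool
  cycleᵇ σ u v w = arrow σ u v ∧ arrow σ v w ∧ arrow σ w u

  allI : Kind → Kind → Kind → Bool
  allI u v w = isI u ∧ isI v ∧ isI w

  -- Properties of all 3-cycles are checked on the finitely many triples of kinds; 3-cycles inside
  -- the I i are exempt, since there are none.
  onCycleᵇ : Pattern → (Kind → Kind → Kind → Bool) → Kind → Kind → Kind → Bool
  onCycleᵇ σ φ u v w = cycleᵇ σ u v w ⇒ᵇ (allI u v w ∨ φ u v w)

  everyCycle : Pattern → (Kind → Kind → Kind → Bool) → Kind → Bool
  everyCycle σ φ u = everyKind λ v → everyKind (onCycleᵇ σ φ u v)

  hitᵇ : Pattern → Kind → Bool
  hitᵇ σ z = everyKind (everyCycle σ (λ u v w → same z u ∨ same z v ∨ same z w))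

  freeᵇ : Pattern → Kind → Bool
  freeᵇ σ z = everyCycle σ (λ _ _ _ → false) z

  everyCycle-sound : ∀ σ φ u v w → T (everyCycle σ φ u) → T (cycleᵇ σ u v w) → T (allI u v w ∨ φ u v w)
  everyCycle-sound σ φ u v w t = ⇒ᵇ-elim {cycleᵇ σ u v w}
    (everyKind-sound (onCycleᵇ σ φ u v) (everyKind-sound (λ v → everyKind (onCycleᵇ σ φ u v)) t v) w)

  -- A pattern sees kinds, not vertices: finding the kind of `z` on a 3-cycle yields `z` itself only
  -- if nothing else is of that kind. This holds for `P`, `Q`, `X`, and for `I zero` when n = 4.
  Solitary : ∀ {N} → (Fin N → Bool) → Vtx N → Set
  Solitary c z = ∀ u → T (same (kind c z) (kind c u)) → z ≡ u

  solitary-P : ∀ {N} {c : Fin N → Bool} → Solitary c P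
  solitary-P P _ = refl

  solitary-Q : ∀ {N} {c : Fin N → Bool} → Solitary c Q
  solitary-Q Q _ = refl

  solitary-X : ∀ {N} {c : Fin N → Bool} → Solitary c X
  solitary-X X _ = refl

  solitary-I : ∀ {c : Fin 1 → Bool} → Solitary c (I zero)
  solitary-I {c} (I zero) _ = refl
  solitary-I {c} P t with c zero
  solitary-I {c} P () | true
  solitary-I {c} P () | false
  solitary-I {c} Q t with c zero
  solitary-I {c} Q () | true
  solitary-I {c} Q () | false
  solitary-I {c} X t with c zero
  solitary-I {c} X () | true
  solitary-I {c} X () | false

  module _ {N} {S : Params N} {c σ} (H : HasPattern S c σ) where

    private
      no-allI : ∀ u v w → Cycle (K S) u v w → ¬ T (allI (kind c u) (kind c v) (kind c w))
      no-allI (I i) (I j) (I k) (cycle p q r) _ = HasPattern.acyclic H (cycle p q r)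
      no-allI P _ _ _ ()
      no-allI Q _ _ _ ()
      no-allI X _ _ _ ()
      no-allI (I _) P _ _ ()
      no-allI (I _) Q _ _ ()
      no-allI (I _) X _ _ ()
      no-allI (I _) (I _) P _ ()
      no-allI (I _) (I _) Q _ ()
      no-allI (I _) (I _) X _ ()

      cycle-sound : ∀ u v w → Cycle (K S) u v w → T (cycleᵇ σ (kind c u) (kind c v) (kind c w))
      cycle-sound u v w (cycle p q r) =
        ∧-intro (arrow-sound H u v p) (∧-intro (arrow-sound H v w q) (arrow-sound H w u r))

      cycle-elim : ∀ φ u v w → T (everyCycle σ φ (kind c u)) → Cycle (K S) u v w → T (φ (kind c u) (kind c v) (kind c w))
      cycle-elim φ u v w t cyc
        with ∨-elim {allI (kind c u) (kind c v) (kind c w)}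
               (everyCycle-sound σ φ (kind c u) (kind c v) (kind c w) t (cycle-sound u v w cyc))
      ... | inj₁ s = ⊥-elim (no-allI u v w cyc s)
      ... | inj₂ s = s

    hit-by-pattern : ∀ {z} → Solitary c z → T (hitᵇ σ (kind c z)) → Hit (K S) z
    hit-by-pattern {z} sol t {u} {v} {w} cyc =
      Sum.map (sol u) (Sum.map (sol v) (sol w) ∘ ∨-elim {same k (kind c v)})
        (∨-elim {same k (kind c u)} (cycle-elim φ u v w (everyKind-sound (everyCycle σ φ) t (kind c u)) cyc))
      where
      k = kind c z
      φ : Kind → Kind → Kind → Bool
      φ u v w = same k u ∨ same k v ∨ same k w

    free-by-pattern : ∀ z → T (freeᵇ σ (kind c z)) → Free (K S) z
    free-by-pattern z t v w = cycle-elim (λ _ _ _ → false) z v w t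

  apart-free : ∀ {N} {S S′ : Params N} → Skew (Params.r S′) → ∀ z → Free (K S) z → (∀ w → OnCycle (K S′) w) → Apart S S′
  apart-free {S′ = S′} sk z fr all =
    (λ φ → free⊥onCycle φ fr all) , (λ φ → free⊥onCycle φ fr (onCycle-reversed S′ sk all))

  K-loop : ∀ {N} (S : Params N) → Skew (Params.r S) → ∀ u → K S u u ≡ 0ℤ
  K-loop S sk = skew-diag {M = K S} (K-skew S sk)

  reversed-skew : ∀ {N} (S : Params N) → Skew (Params.r S) → Skew (Params.r (reversed S))
  reversed-skew S sk i j = cong -_ (sk i j)

  apart-book-hub : ∀ {N} {S S′ : Params N} → Skew (Params.r S) → Skew (Params.r S′) → ∀ {s t z} →
                   Book (K S) s t → Hub (K S′) z → Apart S S′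
  apart-book-hub {S = S} {S′} sk sk′ {s} b h =
    (λ φ → book⊥hub φ (K-loop S sk s) b h) , (λ φ → book⊥hub φ (K-loop S sk s) b (hub-reversed S′ sk′ h))

  module _ {N} {S S′ : Params N} (sk : Skew (Params.r S)) (sk′ : Skew (Params.r S′)) {s t s′ t′}
           (b : Book (K S) s t) (b′ : Book (K S′) s′ t′) where

    spine-to : (φ : Iso (K S) (K S′)) → Iso.to φ s ≡ s′ × Iso.to φ t ≡ t′
    spine-to φ = book-book φ (K-loop S sk s) (K-skew S′ sk′) b b′

    spine-to⁻ : (φ : Iso (K S) (K (reversed S′))) → Iso.to φ s ≡ swap₁₂ t′ × Iso.to φ t ≡ swap₁₂ s′
    spine-to⁻ φ = book-book φ (K-loop S sk s) (K-skew (reversed S′) (reversed-skew S′ sk′)) b (book-reversed S′ sk′ b′)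

    spine-weight : (φ : Iso (K S) (K S′)) → K S s t ≡ K S′ s′ t′
    spine-weight φ = sym (Iso.weight φ (proj₁ (spine-to φ)) (proj₂ (spine-to φ)))

    spine-weight⁻ : (φ : Iso (K S) (K (reversed S′))) → K S s t ≡ K S′ s′ t′
    spine-weight⁻ φ = trans (sym (Iso.weight φ (proj₁ (spine-to⁻ φ)) (proj₂ (spine-to⁻ φ))))
      (trans (K⁻ S′ sk′ (swap₁₂ t′) (swap₁₂ s′)) (cong₂ (K S′) (swap₁₂-involutive s′) (swap₁₂-involutive t′)))

    apart-spine : K S s t ≢ K S′ s′ t′ → Apart S S′
    apart-spine ne = ne ∘ spine-weight , ne ∘ spine-weight⁻

  -- All `I i` belong to the class `true`. Arrows between them are allowed in both directions, since
  -- 3-cycles inside this set are excluded by acyclicity of `r`.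
  uniform : (sx sy sf sg sh : Bool) → Pattern
  uniform sx sy sf sg sh = record
    { sx = sx ; sy = sy ; sf = const sf ; sg = const sg ; sh = const sh ; sr = λ _ _ → true ; used = λ b → b }

  rotate : ∀ {V} {M : Weights V} {u v w} → Cycle M u v w → Cycle M v w u
  rotate (cycle p q r) = cycle q r p

  record Cover {V} (M : Weights V) (u v w : V) : Set where
    constructor cover
    field cyc : Cycle M u v w

    on₁ : OnCycle M u
    on₁ = v , w , cyc
    on₂ : OnCycle M v
    on₂ = w , u , rotate cyc
    on₃ : OnCycle M w
    on₃ = u , v , rotate (rotate cyc)

  -- An integer factor `u` of at least 1 cannot shrink `v`, and the other two summands are positive.
  -- This and its two variants provide the bounds for `top` and for the last value of `h`.
  <-+-*ˡ : ∀ {c u v w z} → Pos c → Pos u → Pos v → Neg w → Pos z → v < c + (u * v - w * z)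
  <-+-*ˡ {c} {u} {v} {w} {z} 0<c 0<u 0<v w<0 0<z =
    pos-≡⇒< (+-pos-nonneg (+-pos 0<c (*-pos (neg-mono-< w<0) 0<z)) (*-nonneg-pos (i≤j⇒0≤j-i (i<j⇒suc[i]≤j 0<u)) 0<v)) (eq c u v w z)
    where
    eq : ∀ c u v w z → (c + (- w * z)) + (u - 1ℤ) * v ≡ (c + (u * v - w * z)) - v
    eq = solve-∀

  <-+-*ʳ : ∀ {c u v w z} → Pos c → Pos u → Pos v → Neg w → Pos z → - w < c + (u * v - w * z)
  <-+-*ʳ {c} {u} {v} {w} {z} 0<c 0<u 0<v w<0 0<z =
    pos-≡⇒< (+-pos-nonneg (+-pos 0<c (*-pos 0<u 0<v)) (*-nonneg-pos (i≤j⇒0≤j-i (i<j⇒suc[i]≤j 0<z)) (neg-mono-< w<0))) (eq c u v w z)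
    where
    eq : ∀ c u v w z → (c + u * v) + (z - 1ℤ) * - w ≡ (c + (u * v - w * z)) - - w
    eq = solve-∀

  <-+-* : ∀ {c u v} → Pos c → Pos u → Pos v → u < c + u * v
  <-+-* {c} {u} {v} 0<c 0<u 0<v = pos-≡⇒< (+-pos-nonneg 0<c (*-nonneg-pos (i≤j⇒0≤j-i (i<j⇒suc[i]≤j 0<v)) 0<u)) (eq c u v)
    where
    eq : ∀ c u v → c + (v - 1ℤ) * u ≡ (c + u * v) - u
    eq = solve-∀

  -- The quivers met along the mutation sequence

  -- In the paper's notation n = q + 4 and 2k = L = L′ + 2; the data are read off R̃ and Q as
  -- a = b₁₂(R̃), e₀ i = -b₁ᵢ(R̃), e₁ i = b₂ᵢ(R̃), d₀ = -b₂ₙ(Q), d₁ = b₁ₙ(Q), c i = bᵢₙ(Q).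
  record Setting (q L′ : ℕ) : Set where
    field
      a d₀ d₁ : ℤ
      e₀ e₁ c : Fin (suc q) → ℤ
      r       : Fin (suc q) → Fin (suc q) → ℤ
      2≤a     : + 2 ≤ a
      d₀<0    : Neg d₀
      0<d₁    : Pos d₁
      e₀<0    : ∀ i → Neg (e₀ i)
      0<e₁    : ∀ i → Pos (e₁ i)
      0<c     : ∀ i → Pos (c i)
      r-skew  : Skew r
      r-order : ∀ {i j} → toℕ j ℕ.< toℕ i → 0ℤ ≤ r i j

    N L : ℕ
    N = suc q
    L = suc (suc L′)

    d : ℕ → ℤ
    d = lin a d₀ d₁

    e : Fin N → ℕ → ℤ
    e i = lin a (e₀ i) (e₁ i)

    -- The number of arrows between `I i` and n throughout the descent: both mutations at the turn
    -- add a product to the original `c i`.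
    top : Fin N → ℤ
    top i = c i + (e₁ i * d L - e₀ i * d (suc L′))

    module Growᵈ = Growth {a} {d₀} {d₁} 2≤a d₀<0 0<d₁
    module Growᵉ (i : Fin N) = Growth {a} {e₀ i} {e₁ i} 2≤a (e₀<0 i) (0<e₁ i)

    r-descends : ∀ i j → Pos (r i j) → toℕ j ℕ.< toℕ i
    r-descends i j p with ℕ.<-cmp (toℕ i) (toℕ j)
    ... | tri> _ _ j<i = j<i
    ... | tri< i<j _ _ = ⊥-elim (<⇒≱ p (subst (_≤ 0ℤ) (sym (r-skew i j)) (neg-mono-≤ (r-order i<j))))
    ... | tri≈ _ i≡j _ = ⊥-elim (<-irrefl (sym (trans (cong (r i) (sym (toℕ-injective i≡j))) (skew-diag {M = r} r-skew i))) p)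

    r-acyc : Acyclic r
    r-acyc (cycle p q s) = ℕ.<-irrefl refl (ℕ.<-trans (r-descends _ _ s) (ℕ.<-trans (r-descends _ _ q) (r-descends _ _ p)))

    0<a : Pos a
    0<a = <-≤-trans (+<+ ℕ.z<s) 2≤a

    0<d : ∀ n → Pos (d (suc n))
    0<d = Growᵈ.lin-pos

    0<e : ∀ i n → Pos (e i (suc n))
    0<e i = Growᵉ.lin-pos i

    -- The turn builds the value from the start of `e i` and the end of `d`; the last mutation takes
    -- it apart from the end of `e i` and the start of `d`.
    top-dual : ∀ i → top i ≡ c i + (e i L * d₁ - e i (suc L′) * d₀)
    top-dual i = cong (_+_ (c i)) (trans (lin-wronskian a d₀ d₁ (e₀ i) (e₁ i) (suc L′) 0)
      (cong (λ n → e i (suc n) * d₁ - e i n * d₀) (ℕ.+-identityʳ (suc L′))))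

    d<top : ∀ i → d L < top i
    d<top i = <-+-*ˡ (0<c i) (0<e₁ i) (0<d (suc L′)) (e₀<0 i) (0<d L′)

    -e₀<top : ∀ i → - e₀ i < top i
    -e₀<top i = <-+-*ʳ (0<c i) (0<e₁ i) (0<d (suc L′)) (e₀<0 i) (0<d L′)

    e<top : ∀ i → e i L < top i
    e<top i = subst (e i L <_) (sym (trans (top-dual i) (eq (c i) (e i L) d₁ (e i (suc L′)) d₀)))
                (<-+-*ˡ (0<c i) 0<d₁ (0<e i (suc L′)) d₀<0 (0<e i L′))
      where
      eq : ∀ c u v w z → c + (u * v - w * z) ≡ c + (v * u - z * w)
      eq = solve-∀

    a<d : ∀ n → a < d (suc (suc n))
    a<d = Growᵈ.a<lin

    a<e : ∀ i n → a < e i (suc (suc n))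
    a<e i = Growᵉ.a<lin i

    a<top : ∀ i → a < top i
    a<top i = <-trans (a<d L′) (d<top i)

    e<end : ∀ i → e i L < c i + e i L * d₁
    e<end i = <-+-* (0<c i) (0<e i (suc L′)) 0<d₁

    0<top : ∀ i → Pos (top i)
    0<top i = <-trans 0<a (a<top i)

    -- The first alternation on {1,2} runs through state c s t with s + t = L, the second one, but
    -- for its first and last quivers, through state down s t with s + t = L′.
    state : (Fin N → ℤ) → ℕ → ℕ → Params N
    state h s t = record
      { a = a ; x = d (suc s) ; y = d s ; f = λ i → e i t ; g = λ i → e i (suc t) ; h = h ; r = r }

    start : Params N
    start = record
      { a = a ; x = - d₁ ; y = - d₀ ; f = λ i → e i L ; g = λ i → e i (suc L) ; h = λ i → - c i ; r = r }

    middle : ℕ → Params N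
    middle m = flipped m (state c L 0)

    -- Not a `state`: the sinks leave `- e₀ i` and `- e₁ i` behind, and each of the next two
    -- mutations sends the pair `f`, `g` to `g`, `- f`. Only after the second one are `e₀ i` and
    -- `e₁ i` back in place.
    turn : Params N
    turn = record
      { a = a ; x = d L ; y = d (suc L′) ; f = λ i → - e₁ i ; g = e₀ ; h = λ i → - (c i + e₁ i * d L) ; r = r }

    down : Fin N → ℤ
    down i = - top i

    -- As `d₀` is negative, the mutation leading here only negates on the side of `d`, while the
    -- `e i` climb once more.
    finish : Params N
    finish = record
      { a = a ; x = d₀ ; y = - d₁ ; f = λ i → e i (suc L′) ; g = λ i → e i L ; h = λ i → - (c i + e i L * d₁) ; r = r }

    -neg : ∀ {z} → Pos z → Neg (- z)
    -neg = neg-mono-<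

    -pos : ∀ {z} → Neg z → Pos (- z)
    -pos = neg-mono-<

    pattern-of : ∀ {S : Params N} {sx sy sf sg sh} → Params.a S ≡ a → Params.r S ≡ r → Sign sx (Params.x S) → Sign sy (Params.y S) →
                 (∀ i → Sign sf (Params.f S i)) → (∀ i → Sign sg (Params.g S i)) → (∀ i → Sign sh (Params.h S i)) →
                 HasPattern S (const true) (uniform sx sy sf sg sh)
    pattern-of refl refl sx sy sf sg sh = record
      { 0<a = 0<a ; sign-x = sx ; sign-y = sy ; sign-f = sf ; sign-g = sg ; sign-h = sh
      ; sign-r = λ _ _ _ → tt ; acyclic = r-acyc ; in-use = λ _ → tt }

    start-pattern : HasPattern start (const true) (uniform false true true true false)
    start-pattern = pattern-of refl refl (-neg 0<d₁) (-pos d₀<0) (λ i → 0<e i (suc L′)) (λ i → 0<e i L) (λ i → -neg (0<c i))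

    opening-pattern : HasPattern (state c 0 L) (const true) (uniform true false true true true)
    opening-pattern = pattern-of refl refl 0<d₁ d₀<0 (λ i → 0<e i (suc L′)) (λ i → 0<e i L) 0<c

    generic-pattern : ∀ {h b} s t → (∀ i → Sign b (h i)) → HasPattern (state h (suc s) (suc t)) (const true) (uniform true true true true b)
    generic-pattern s t sh = pattern-of refl refl (0<d (suc s)) (0<d s) (λ i → 0<e i t) (λ i → 0<e i (suc t)) sh

    turn-pattern : HasPattern turn (const true) (uniform true true false false false)
    turn-pattern = pattern-of refl refl (0<d (suc L′)) (0<d L′) (λ i → -neg (0<e₁ i)) e₀<0
      (λ i → -neg (+-pos (0<c i) (*-pos (0<e₁ i) (0<d (suc L′)))))

    turn₂-pattern : ∀ s → HasPattern (state down (suc s) 0) (const true) (uniform true true false true false)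
    turn₂-pattern s = pattern-of refl refl (0<d (suc s)) (0<d s) e₀<0 0<e₁ (λ i → -neg (0<top i))

    short-pattern : HasPattern (state down 0 0) (const true) (uniform true false false true false)
    short-pattern = pattern-of refl refl 0<d₁ d₀<0 e₀<0 0<e₁ (λ i → -neg (0<top i))

    closing-pattern : ∀ t → HasPattern (state down 0 (suc t)) (const true) (uniform true false true true false)
    closing-pattern t = pattern-of refl refl 0<d₁ d₀<0 (λ i → 0<e i t) (λ i → 0<e i (suc t)) (λ i → -neg (0<top i))

    finish-pattern : HasPattern finish (const true) (uniform false false true true false)
    finish-pattern = pattern-of refl refl d₀<0 (-neg 0<d₁) (λ i → 0<e i L′) (λ i → 0<e i (suc L′))
      (λ i → -neg (+-pos (0<c i) (*-pos (0<e i (suc L′)) 0<d₁)))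

  -- Books and hubs among the quivers of the sequence

  module _ {V : Set} {z u v w w′ : V} where

    common₂ : w ≢ w′ → z ≡ u ⊎ z ≡ v ⊎ z ≡ w → z ≡ u ⊎ z ≡ v ⊎ z ≡ w′ → z ≡ u ⊎ z ≡ v
    common₂ ne (inj₁ p)        _               = inj₁ p
    common₂ ne (inj₂ (inj₁ p)) _               = inj₂ p
    common₂ ne _               (inj₁ p)        = inj₁ p
    common₂ ne _               (inj₂ (inj₁ p)) = inj₂ p
    common₂ ne (inj₂ (inj₂ p)) (inj₂ (inj₂ q)) = contradiction (trans (sym p) q) ne

  module _ {V : Set} {z u v w v′ w′ : V} where

    common₁ : v ≢ v′ → v ≢ w′ → w ≢ v′ → w ≢ w′ → z ≡ u ⊎ z ≡ v ⊎ z ≡ w → z ≡ u ⊎ z ≡ v′ ⊎ z ≡ w′ → z ≡ u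
    common₁ _ _ _ _  (inj₁ p)        _               = p
    common₁ _ _ _ _  _               (inj₁ p)        = p
    common₁ n _ _ _  (inj₂ (inj₁ p)) (inj₂ (inj₁ q)) = contradiction (trans (sym p) q) n
    common₁ _ n _ _  (inj₂ (inj₁ p)) (inj₂ (inj₂ q)) = contradiction (trans (sym p) q) n
    common₁ _ _ n _  (inj₂ (inj₂ p)) (inj₂ (inj₁ q)) = contradiction (trans (sym p) q) n
    common₁ _ _ _ n  (inj₂ (inj₂ p)) (inj₂ (inj₂ q)) = contradiction (trans (sym p) q) n

  -- Two 3-cycles through one arrow with different third vertices have no further vertex in common.
  book-by-pages : ∀ {V} {M : Weights V} {s t u v} → u ≢ v → Hit M s → Hit M t → Cycle M s t u → Cycle M s t v → Book M s t
  book-by-pages ne hit-s hit-t cyc cyc′ = record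
    { spine = Cycle.uv cyc ; hit-s = hit-s ; hit-t = hit-t ; only = λ hit → common₂ ne (hit cyc) (hit cyc′) }

  sign-unique : ∀ {b b′ z} → Sign b z → Sign b′ z → b ≡ b′
  sign-unique {true}  {true}  _ _ = refl
  sign-unique {true}  {false} p n = ⊥-elim (<-asym n p)
  sign-unique {false} {true}  n p = ⊥-elim (<-asym n p)
  sign-unique {false} {false} _ _ = refl

  not-both : ∀ b {z w} → Pos z → Pos w → Sign b z → Sign (not b) w → ⊥
  not-both true  _  pw _  nw = <-asym pw nw
  not-both false pz _  nz _  = <-asym pz nz

  pos≢neg : ∀ {z z′} → Pos z → Neg z′ → z ≢ z′
  pos≢neg p n refl = <-asym p n

  ≡⇒≯ : ∀ {z z′ : ℤ} → z ≡ z′ → ¬ z < z′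
  ≡⇒≯ refl = <-irrefl refl

  module Books {q L′ : ℕ} (D : Setting q L′) where
    open Setting D

    generic-book : ∀ {h b} s t → (∀ i → Sign b (h i)) → Book (K (state h (suc s) (suc t))) P Q
    generic-book {h} {b} s t sh = book-by-pages {u = X} {I zero} (λ ())
      (hit-by-pattern H solitary-P (check-P b)) (hit-by-pattern H solitary-Q (check-Q b))
      (cycle 0<a (0<d s) (0<d (suc s))) (cycle 0<a (0<e zero (suc t)) (0<e zero t))
      where
      H = generic-pattern {h} {b} s t sh
      check-P : ∀ b → T (hitᵇ (uniform true true true true b) kP)
      check-P true  = tt
      check-P false = tt
      check-Q : ∀ b → T (hitᵇ (uniform true true true true b) kQ)
      check-Q true  = tt
      check-Q false = tt

    0<--top : ∀ i → Pos (- down i)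
    0<--top i = subst Pos (sym (neg-involutive (top i))) (0<top i)

    XPI-turn : ∀ i → Cycle (K turn) X P (I i)
    XPI-turn i = cycle (0<d (suc L′)) (subst Pos (sym (neg-involutive (e₁ i))) (0<e₁ i))
      (subst Pos (sym (neg-involutive _)) (+-pos (0<c i) (*-pos (0<e₁ i) (0<d (suc L′)))))

    turn-book : Book (K turn) X P
    turn-book = book-by-pages {u = Q} {I zero} (λ ())
      (hit-by-pattern turn-pattern solitary-X tt) (hit-by-pattern turn-pattern solitary-P tt)
      (cycle (0<d (suc L′)) 0<a (0<d L′)) (XPI-turn zero)

    XPI-turn₂ : ∀ s i → Cycle (K (state down (suc s) 0)) X P (I i)
    XPI-turn₂ s i = cycle (0<d (suc s)) (-pos (e₀<0 i)) (0<--top i)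

    turn₂-book : ∀ s → Book (K (state down (suc s) 0)) X P
    turn₂-book s = book-by-pages {u = Q} {I zero} (λ ())
      (hit-by-pattern (turn₂-pattern s) solitary-X tt) (hit-by-pattern (turn₂-pattern s) solitary-P tt)
      (cycle (0<d (suc s)) 0<a (0<d s)) (XPI-turn₂ s zero)

    XPI-short : ∀ i → Cycle (K (state down 0 0)) X P (I i)
    XPI-short i = cycle 0<d₁ (-pos (e₀<0 i)) (0<--top i)

    XQI-short : ∀ i → Cycle (K (state down 0 0)) X Q (I i)
    XQI-short i = cycle (-pos d₀<0) (0<e₁ i) (0<--top i)

    QIP-closing : ∀ t i → Cycle (K (state down 0 (suc t))) Q (I i) P
    QIP-closing t i = cycle (0<e i (suc t)) (0<e i t) 0<a

    QIX-closing : ∀ t i → Cycle (K (state down 0 (suc t))) Q (I i) X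
    QIX-closing t i = cycle (0<e i (suc t)) (0<--top i) (-pos d₀<0)

    QIP-finish : ∀ i → Cycle (K finish) Q (I i) P
    QIP-finish i = cycle (0<e i (suc L′)) (0<e i L′) 0<a

    QIX-finish : ∀ i → Cycle (K finish) Q (I i) X
    QIX-finish i = cycle (0<e i (suc L′))
      (subst Pos (sym (neg-involutive _)) (+-pos (0<c i) (*-pos (0<e i (suc L′)) 0<d₁)))
      (subst Pos (sym (neg-involutive d₁)) 0<d₁)

  -- For n = 4 the 3-cycles through the hub all contain the single `I zero` as well, so the arrow
  -- between the two becomes a spine.
  module SmallBooks {L′ : ℕ} (D : Setting 0 L′) where
    open Setting D
    open Books D

    short-book : Book (K (state down 0 0)) (I zero) X
    short-book = book-by-pages {u = P} {Q} (λ ())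
      (hit-by-pattern short-pattern (solitary-I {const true}) tt) (hit-by-pattern short-pattern solitary-X tt)
      (rotate (rotate (XPI-short zero)))
      (rotate (rotate (XQI-short zero)))

    closing-book : ∀ t → Book (K (state down 0 (suc t))) Q (I zero)
    closing-book t = book-by-pages {u = P} {X} (λ ())
      (hit-by-pattern (closing-pattern t) solitary-Q tt) (hit-by-pattern (closing-pattern t) (solitary-I {const true}) tt)
      (QIP-closing t zero) (QIX-closing t zero)

    finish-book : Book (K finish) Q (I zero)
    finish-book = book-by-pages {u = P} {X} (λ ())
      (hit-by-pattern finish-pattern solitary-Q tt) (hit-by-pattern finish-pattern (solitary-I {const true}) tt)
      (QIP-finish zero) (QIX-finish zero)

  -- There are two families of 3-cycles through the hub; members of different families that use
  -- different vertices `I i` meet only in the hub.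
  module LargeHubs {q L′ : ℕ} (D : Setting (suc q) L′) where
    open Setting D
    open Books D

    private
      0≢1 : I {N} zero ≢ I (suc zero)
      0≢1 ()

    short-hub : Hub (K (state down 0 0)) X
    short-hub = record
      { hit  = hit-by-pattern short-pattern solitary-X tt
      ; only = λ hit → common₁ (λ ()) (λ ()) (λ ()) 0≢1 (hit (XPI-short zero)) (hit (XQI-short (suc zero))) }

    closing-hub : ∀ t → Hub (K (state down 0 (suc t))) Q
    closing-hub t = record
      { hit  = hit-by-pattern (closing-pattern t) solitary-Q tt
      ; only = λ hit → common₁ 0≢1 (λ ()) (λ ()) (λ ()) (hit (QIP-closing t zero)) (hit (QIX-closing t (suc zero))) }

    finish-hub : Hub (K finish) Q
    finish-hub = record
      { hit  = hit-by-pattern finish-pattern solitary-Q tt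
      ; only = λ hit → common₁ 0≢1 (λ ()) (λ ()) (λ ()) (hit (QIP-finish zero)) (hit (QIX-finish (suc zero))) }

  -- Stages all of whose vertices lie on 3-cycles

  module _ {V W : Set} {M : Weights V} {M′ : Weights W} (φ : Iso M M′) where
    open Iso φ

    distinct : ∀ {u v w} → to u ≡ w → to v ≡ w → u ≢ v → ⊥
    distinct p q u≢v = u≢v (to-injective (trans p (sym q)))

    -- On four vertices the matched spines leave two on each side, and the direction of the arrow
    -- between them settles which goes where.
    pages : ∀ {s t u v s′ t′ u′ v′} → Skew M′ → (∀ w → w ≡ s′ ⊎ w ≡ t′ ⊎ w ≡ u′ ⊎ w ≡ v′) →
            to s ≡ s′ → to t ≡ t′ → u ≢ s → u ≢ t → v ≢ s → v ≢ t → u ≢ v →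
            Pos (M u v) → Pos (M′ u′ v′) → to u ≡ u′ × to v ≡ v′
    pages {u = u} {v} sk four ps pt us ut vs vt uv p p′ with four (to u) | four (to v)
    ... | inj₁ e               | _                    = ⊥-elim (distinct e ps us)
    ... | inj₂ (inj₁ e)        | _                    = ⊥-elim (distinct e pt ut)
    ... | _                    | inj₁ e               = ⊥-elim (distinct e ps vs)
    ... | _                    | inj₂ (inj₁ e)        = ⊥-elim (distinct e pt vt)
    ... | inj₂ (inj₂ (inj₁ e)) | inj₂ (inj₂ (inj₁ f)) = ⊥-elim (distinct e f uv)
    ... | inj₂ (inj₂ (inj₂ e)) | inj₂ (inj₂ (inj₂ f)) = ⊥-elim (distinct e f uv)
    ... | inj₂ (inj₂ (inj₁ e)) | inj₂ (inj₂ (inj₂ f)) = e , f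
    ... | inj₂ (inj₂ (inj₂ e)) | inj₂ (inj₂ (inj₁ f)) =
      ⊥-elim (<-asym p′ (subst Neg (sym (trans (sk _ _) (cong -_ (weight e f)))) (neg-mono-< p)))

  I-injective : ∀ {N} {i j : Fin N} → I i ≡ I j → i ≡ j
  I-injective refl = refl

  module Late {q L′ : ℕ} (D : Setting q L′) where
    open Setting D
    open Books D

    -- Each alternative forbids a reversal that exchanges n with some `I j`: two vertices `I i`
    -- cannot both go to n, and otherwise consecutive terms of `d` and `e j` would agree.
    OutOfPhase : Set
    OutOfPhase = (∃₂ λ (i j : Fin N) → i ≢ j) ⊎ (∀ j → d₁ ≢ e₁ j)

    generic-onCycle : ∀ {h} s t z → OnCycle (K (state h (suc s) (suc t))) z
    generic-onCycle {h} s t = λ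
      { P → Cover.on₁ PQX ; Q → Cover.on₂ PQX ; X → Cover.on₃ PQX
      ; (I i) → Cover.on₃ (cover {u = P} {Q} (cycle 0<a (0<e i (suc t)) (0<e i t))) }
      where
      PQX : Cover (K (state h (suc s) (suc t))) P Q X
      PQX = cover (cycle 0<a (0<d s) (0<d (suc s)))

    turn-onCycle : ∀ z → OnCycle (K turn) z
    turn-onCycle = λ
      { P → Cover.on₂ XPQ ; Q → Cover.on₃ XPQ ; X → Cover.on₁ XPQ
      ; (I i) → Cover.on₃ (cover (XPI-turn i)) }
      where
      XPQ : Cover (K turn) X P Q
      XPQ = cover (cycle (0<d (suc L′)) 0<a (0<d L′))

    turn₂-onCycle : ∀ s z → OnCycle (K (state down (suc s) 0)) z
    turn₂-onCycle s = λ
      { P → Cover.on₂ XPQ ; Q → Cover.on₃ XPQ ; X → Cover.on₁ XPQ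
      ; (I i) → Cover.on₃ (cover (XPI-turn₂ s i)) }
      where
      XPQ : Cover (K (state down (suc s) 0)) X P Q
      XPQ = cover (cycle (0<d (suc s)) 0<a (0<d s))

    short-onCycle : ∀ z → OnCycle (K (state down 0 0)) z
    short-onCycle P     = Cover.on₂ (cover (XPI-short zero))
    short-onCycle Q     = Cover.on₂ (cover (XQI-short zero))
    short-onCycle X     = Cover.on₁ (cover (XPI-short zero))
    short-onCycle (I i) = Cover.on₃ (cover (XPI-short i))

    closing-onCycle : ∀ t z → OnCycle (K (state down 0 (suc t))) z
    closing-onCycle t P     = Cover.on₃ (cover (QIP-closing t zero))
    closing-onCycle t Q     = Cover.on₁ (cover (QIP-closing t zero))
    closing-onCycle t X     = Cover.on₃ (cover (QIX-closing t zero))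
    closing-onCycle t (I i) = Cover.on₂ (cover (QIP-closing t i))

    finish-onCycle : ∀ z → OnCycle (K finish) z
    finish-onCycle P     = Cover.on₃ (cover (QIP-finish zero))
    finish-onCycle Q     = Cover.on₁ (cover (QIP-finish zero))
    finish-onCycle X     = Cover.on₃ (cover (QIX-finish zero))
    finish-onCycle (I i) = Cover.on₂ (cover (QIP-finish i))

    -- In a generic stage the page X of the book is told from the pages I i by the order
    -- of its two weights, and reversal of the arrows exchanges the two kinds of pages.
    generic-apart : OutOfPhase → ∀ {h h′ b b′} s t s′ t′ →
                    (∀ i → Sign b (h i)) → (∀ i → Sign b′ (h′ i)) → (b ≡ b′ → s ≢ s′) →
                    Apart (state h (suc s) (suc t)) (state h′ (suc s′) (suc t′))
    generic-apart phase {h} {h′} {b} {b′} s t s′ t′ sh sh′ apart = forward , backward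
      where
      S S′ : Params N
      S  = state h (suc s) (suc t)
      S′ = state h′ (suc s′) (suc t′)
      book  = generic-book {b = b} s t sh
      book′ = generic-book {b = b′} s′ t′ sh′

      forward : ¬ Iso (K S) (K S′)
      forward φ = page (to X) refl
        where
        open Iso φ
        hP = proj₁ (spine-to {S = S} {S′} r-skew r-skew book book′ φ)
        hQ = proj₂ (spine-to {S = S} {S′} r-skew r-skew book book′ φ)
        other : ∀ u → to X ≡ X → to (I zero) ≡ u → ⊥
        other P     _  hI = distinct φ hI hP λ ()
        other Q     _  hI = distinct φ hI hQ λ ()
        other X     hX hI = distinct φ hI hX λ ()
        -- The sign of the arrows between n and the `I i` tells the rise from the descent; the
        -- weights at `X` then give the position.
        other (I j) hX hI = apart (sign-unique (sh zero) (subst (Sign b′) (weight hX hI) (sh′ j)))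
                              (sym (ℕ.suc-injective (Growᵈ.lin-injective {suc s′} {suc s} (weight hQ hX))))
        page : ∀ u → to X ≡ u → ⊥
        page P     hX = distinct φ hX hP λ ()
        page Q     hX = distinct φ hX hQ λ ()
        page X     hX = other (to (I zero)) hX refl
        page (I j) hX = ≡⇒≯ (sym (weight hQ hX))
          (<-trans (Growᵈ.lin-step (suc s)) (subst (_< e j (suc (suc t′))) (weight hX hP) (Growᵉ.lin-step j (suc t′))))

      backward : ¬ Iso (K S) (K (reversed S′))
      backward φ = page (to X) refl
        where
        open Iso φ
        hP = proj₁ (spine-to⁻ {S = S} {S′} r-skew r-skew book book′ φ)
        hQ = proj₂ (spine-to⁻ {S = S} {S′} r-skew r-skew book book′ φ)
        other : ∀ i u → to (I i) ≡ u → u ≡ X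
        other i P     hI = ⊥-elim (distinct φ hI hP λ ())
        other i Q     hI = ⊥-elim (distinct φ hI hQ λ ())
        other i X     hI = refl
        other i (I j) hI = ⊥-elim (≡⇒≯ (weight hQ hI)
          (<-trans (Growᵉ.lin-step j (suc t′)) (subst (_< e i (suc (suc t))) (sym (weight hI hP)) (Growᵉ.lin-step i (suc t)))))
        pages-collide : ∀ j → to X ≡ I j → d₁ ≢ e₁ j → ⊥
        pages-collide j hX ne = ne (lin-phase 2≤a d₀<0 0<d₁ (e₀<0 j) (0<e₁ j) (suc s) (suc t′) (sym (weight hQ hX)) (sym (weight hX hP)))
        page : ∀ u → to X ≡ u → ⊥
        page P     hX = distinct φ hX hP λ ()
        page Q     hX = distinct φ hX hQ λ ()
        page X     hX = ≡⇒≯ (weight hX hP) (<-trans (Growᵈ.lin-step (suc s′)) (subst (_< d (suc (suc s))) (sym (weight hQ hX)) (Growᵈ.lin-step (suc s))))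
        page (I j) hX = [ (λ (i , i′ , i≢i′) → distinct φ (other i (to (I i)) refl) (other i′ (to (I i′)) refl) (i≢i′ ∘ I-injective))
                        , (λ ne → pages-collide j hX (ne j)) ]′ phase

  module LateSmall {L′ : ℕ} (D : Setting 0 L′) where
    open Setting D
    open Books D
    open SmallBooks D

    private
      QIPX : ∀ (w : Vtx 1) → w ≡ Q ⊎ w ≡ I zero ⊎ w ≡ P ⊎ w ≡ X
      QIPX P        = inj₂ (inj₂ (inj₁ refl))
      QIPX Q        = inj₁ refl
      QIPX X        = inj₂ (inj₂ (inj₂ refl))
      QIPX (I zero) = inj₂ (inj₁ refl)

      IPQX : ∀ (w : Vtx 1) → w ≡ I zero ⊎ w ≡ P ⊎ w ≡ Q ⊎ w ≡ X
      IPQX P        = inj₂ (inj₁ refl)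
      IPQX Q        = inj₂ (inj₂ (inj₁ refl))
      IPQX X        = inj₂ (inj₂ (inj₂ refl))
      IPQX (I zero) = inj₁ refl

      flip₃₄ : ∀ {s t u v : Vtx 1} → (∀ w → w ≡ s ⊎ w ≡ t ⊎ w ≡ u ⊎ w ≡ v) → ∀ w → w ≡ s ⊎ w ≡ t ⊎ w ≡ v ⊎ w ≡ u
      flip₃₄ four w = Sum.map₂ (Sum.map₂ Sum.swap) (four w)

    module _ {S S′ : Params 1} (sk : Skew (Params.r S)) (sk′ : Skew (Params.r S′)) where

      pages-to : ∀ {s t s′ t′ u v u′ v′} → Book (K S) s t → Book (K S′) s′ t′ → (∀ w → w ≡ s′ ⊎ w ≡ t′ ⊎ w ≡ u′ ⊎ w ≡ v′) →
                 u ≢ s → u ≢ t → v ≢ s → v ≢ t → u ≢ v → Pos (K S u v) → Pos (K S′ u′ v′) → (φ : Iso (K S) (K S′)) →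
                 (Iso.to φ s ≡ s′ × Iso.to φ t ≡ t′) × (Iso.to φ u ≡ u′ × Iso.to φ v ≡ v′)
      pages-to b b′ four us ut vs vt uv p p′ φ = st , pages φ (K-skew S′ sk′) four (proj₁ st) (proj₂ st) us ut vs vt uv p p′
        where st = spine-to {S = S} {S′} sk sk′ b b′ φ

    -- Here and in the next three lemmas one spine weighs a term of `d` and the other a term of
    -- `e zero`. These may agree, so arrows off the spine are compared.
    turn-closing : ∀ t → suc t ≡ L′ → Apart turn (state down 0 (suc t))
    turn-closing t refl = forward , backward
      where
      S′ = state down 0 (suc t)
      forward : ¬ Iso (K turn) (K S′)
      forward φ =
        let (hX , hP) , (hI , hQ) = pages-to r-skew r-skew {u = I zero} {Q} turn-book (closing-book t) (flip₃₄ QIPX)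
                                (λ ()) (λ ()) (λ ()) (λ ()) (λ ()) (-pos (e₀<0 zero)) 0<d₁ φ
        in ≡⇒≯ (Iso.weight φ hQ hX) (a<d t)
      backward : ¬ Iso (K turn) (K (reversed S′))
      backward φ =
        let (hX , hP) , (hI , hQ) = pages-to r-skew (reversed-skew S′ r-skew) {u = I zero} {Q} turn-book (book-reversed S′ r-skew (closing-book t)) IPQX
                                (λ ()) (λ ()) (λ ()) (λ ()) (λ ()) (-pos (e₀<0 zero)) 0<d₁ φ
        in ≡⇒≯ (sym (trans (sym (neg-involutive (top zero))) (Iso.weight φ hQ hX)))
                                      (<-trans (Growᵈ.lin-step (suc L′)) (d<top zero))

    -- Under reversal `d₁` and `e₁ zero` themselves are the weights of corresponding arrows, so the
    -- inequality applies without going back along the recurrence.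
    turn-finish : (∀ j → d₁ ≢ e₁ j) → Apart turn finish
    turn-finish phase = forward , backward
      where
      forward : ¬ Iso (K turn) (K finish)
      forward φ =
        let (hX , hP) , (hI , hQ) = pages-to r-skew r-skew {u = I zero} {Q} turn-book finish-book QIPX
                                (λ ()) (λ ()) (λ ()) (λ ()) (λ ()) (-pos (e₀<0 zero)) (-pos d₀<0) φ
        in ≡⇒≯ (sym (trans (sym (neg-involutive _)) (Iso.weight φ hP hQ))) (<-trans (a<e zero L′) (e<end zero))
      backward : ¬ Iso (K turn) (K (reversed finish))
      backward φ =
        let (hX , hP) , (hI , hQ) = pages-to r-skew (reversed-skew finish r-skew) {u = I zero} {Q} turn-book (book-reversed finish r-skew finish-book) (flip₃₄ IPQX)
                                (λ ()) (λ ()) (λ ()) (λ ()) (λ ()) (-pos (e₀<0 zero)) (-pos d₀<0) φ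
        in phase zero (neg-injective (Iso.weight φ hI hP))

    turn₂-closing : ∀ s → suc s ≡ L′ → (∀ j → d₁ ≢ e₁ j) → Apart (state down (suc s) 0) (state down 0 (suc s))
    turn₂-closing s refl phase = forward , backward
      where
      S S′ : Params 1
      S  = state down (suc s) 0
      S′ = state down 0 (suc s)
      forward : ¬ Iso (K S) (K S′)
      forward φ =
        let (hX , hP) , (hQ , hI) = pages-to r-skew r-skew {u = Q} {I zero} (turn₂-book s) (closing-book s) (flip₃₄ QIPX)
                                (λ ()) (λ ()) (λ ()) (λ ()) (λ ()) (0<e₁ zero) 0<d₁ φ
        in ≡⇒≯ (sym (trans (sym (neg-involutive (top zero))) (Iso.weight φ hP hQ))) (a<top zero)
      backward : ¬ Iso (K S) (K (reversed S′))
      backward φ =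
        let (hX , hP) , (hQ , hI) = pages-to r-skew (reversed-skew S′ r-skew) {u = Q} {I zero} (turn₂-book s) (book-reversed S′ r-skew (closing-book s)) IPQX
                                (λ ()) (λ ()) (λ ()) (λ ()) (λ ()) (0<e₁ zero) 0<d₁ φ
        in phase zero (Iso.weight φ hQ hI)

    turn₂-finish : ∀ s → suc s ≡ L′ → Apart (state down (suc s) 0) finish
    turn₂-finish s refl = forward , backward
      where
      S : Params 1
      S = state down (suc s) 0
      forward : ¬ Iso (K S) (K finish)
      forward φ =
        let (hX , hP) , (hQ , hI) = pages-to r-skew r-skew {u = Q} {I zero} (turn₂-book s) finish-book QIPX
                                (λ ()) (λ ()) (λ ()) (λ ()) (λ ()) (0<e₁ zero) (-pos d₀<0) φ
        in ≡⇒≯ (sym (Iso.weight φ hP hQ)) (a<e zero s)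
      backward : ¬ Iso (K S) (K (reversed finish))
      backward φ =
        let (hX , hP) , (hQ , hI) = pages-to r-skew (reversed-skew finish r-skew) {u = Q} {I zero} (turn₂-book s) (book-reversed finish r-skew finish-book) (flip₃₄ IPQX)
                                (λ ()) (λ ()) (λ ()) (λ ()) (λ ()) (0<e₁ zero) (-pos d₀<0) φ
        in ≡⇒≯ (sym (trans (sym (neg-involutive _)) (Iso.weight φ hQ hX)))
            (<-trans (Growᵈ.lin-step (suc s)) (subst (_< c zero + e zero L * d₁)
              (sym (spine-weight⁻ {S = S} {finish} r-skew r-skew (turn₂-book s) finish-book φ)) (e<end zero)))

  module LateLarge {q L′ : ℕ} (D : Setting q L′) where
    open Setting D
    open Books D

    -- An isomorphism fixes `Q` and permutes the sources `P`, `X` of its incoming arrows. The arrow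
    -- between these two has opposite directions in the two quivers, so they are exchanged, and some
    -- `j` would satisfy `top zero = e j (suc L′)` and `e zero (suc L′) = e j L`, against
    -- monotonicity and `e<top`. Under reversal the arrow P → Q of weight `a` has no image, since
    -- all arrows into the other hub are heavier.
    closing-finish : ∀ t → suc t ≡ L′ → Hub (K (state down 0 (suc t))) Q → Hub (K finish) Q → Apart (state down 0 (suc t)) finish
    closing-finish t refl hub hub′ = forward , backward
      where
      S = state down 0 (suc t)
      forward : ¬ Iso (K S) (K finish)
      forward φ = exchange (to X) (to P) refl refl
        where
        open Iso φ
        hQ = hub-hub φ hub hub′
        inner : ∀ u → to X ≡ P → to P ≡ X → to (I zero) ≡ u → ⊥
        inner P     hX hP hI = distinct φ hI hX λ ()
        inner Q     hX hP hI = distinct φ hI hQ λ ()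
        inner X     hX hP hI = distinct φ hI hP λ ()
        inner (I j) hX hP hI = ≡⇒≯ (sym (weight hQ hI))
          (<-trans (Growᵉ.lin-step zero (suc L′)) (<-trans (e<top zero)
            (subst (_< e j L) (trans (weight hI hX) (neg-involutive (top zero))) (Growᵉ.lin-step j (suc L′)))))
        exchange : ∀ u v → to X ≡ u → to P ≡ v → ⊥
        exchange Q     _     hX hP = distinct φ hX hQ λ ()
        exchange _     Q     hX hP = distinct φ hP hQ λ ()
        exchange (I j) _     hX hP = pos≢neg (-pos d₀<0) (-neg (0<e j (suc L′))) (sym (weight hX hQ))
        exchange _     (I j) hX hP = pos≢neg 0<a (-neg (0<e j (suc L′))) (sym (weight hP hQ))
        exchange P     P     hX hP = distinct φ hX hP λ ()
        exchange X     X     hX hP = distinct φ hX hP λ ()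
        exchange X     P     hX hP = pos≢neg 0<d₁ d₀<0 (sym (weight hX hP))
        exchange P     X     hX hP = inner (to (I zero)) hX hP refl
      backward : ¬ Iso (K S) (K (reversed finish))
      backward φ = image (to P) refl
        where
        open Iso φ
        hQ = hub-hub φ hub (hub-reversed finish r-skew hub′)
        image : ∀ u → to P ≡ u → ⊥
        image P     hP = distinct φ hP hQ λ ()
        image Q     hP = pos≢neg 0<a (-neg 0<a) (sym (weight hP hQ))
        image X     hP = pos≢neg 0<a (-neg 0<d₁) (sym (weight hP hQ))
        image (I j) hP = ≡⇒≯ (sym (weight hP hQ)) (a<e j L′)

    -- Without reversal, the `top zero` arrows from `I zero` into the hub outweigh every arrow into
    -- the other hub. With it, the targets `P` and `Q` of the hub are matched by the arrow between
    -- them, which forces `top zero = e j L < c j + e j L * d₁ = - e₀ zero < top zero`.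
    short-finish : L′ ≡ 0 → Hub (K (state down 0 0)) X → Hub (K finish) Q → Apart (state down 0 0) finish
    short-finish refl hub hub′ = forward , backward
      where
      S = state down 0 0
      forward : ¬ Iso (K S) (K finish)
      forward φ = image (to (I zero)) refl
        where
        open Iso φ
        hX = hub-hub φ hub hub′
        image : ∀ u → to (I zero) ≡ u → ⊥
        image P     hI = ≡⇒≯ (trans (weight hI hX) (neg-involutive (top zero))) (a<top zero)
        image Q     hI = distinct φ hI hX λ ()
        image X     hI = ≡⇒≯ (trans (sym (neg-involutive d₁)) (trans (weight hI hX) (neg-involutive (top zero))))
                           (<-trans (Growᵈ.lin-step 1) (d<top zero))
        image (I j) hI = pos≢neg (0<--top zero) (-neg (0<e j 1)) (sym (weight hI hX))
      backward : ¬ Iso (K S) (K (reversed finish))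
      backward φ = exchange (to P) (to Q) refl refl
        where
        open Iso φ
        hX = hub-hub φ hub (hub-reversed finish r-skew hub′)
        inner : ∀ u → to P ≡ X → to Q ≡ Q → to (I zero) ≡ u → ⊥
        inner P     hP hQ hI = distinct φ hI hX λ ()
        inner Q     hP hQ hI = distinct φ hI hQ λ ()
        inner X     hP hQ hI = distinct φ hI hP λ ()
        inner (I j) hP hQ hI = ≡⇒≯ (sym (trans (sym (neg-involutive _)) (weight hP hI)))
          (<-trans (-e₀<top zero) (subst (_< c j + e j L * d₁) (trans (weight hI hX) (neg-involutive (top zero))) (e<end j)))
        exchange : ∀ u v → to P ≡ u → to Q ≡ v → ⊥
        exchange P     _     hP hQ = distinct φ hP hX λ ()
        exchange _     P     hP hQ = distinct φ hQ hX λ ()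
        exchange (I j) _     hP hQ = pos≢neg 0<d₁ (-neg (0<e j 1)) (sym (weight hX hP))
        exchange _     (I j) hP hQ = pos≢neg (-pos d₀<0) (-neg (0<e j 1)) (sym (weight hX hQ))
        exchange Q     Q     hP hQ = distinct φ hP hQ λ ()
        exchange X     X     hP hQ = distinct φ hP hQ λ ()
        exchange Q     X     hP hQ = pos≢neg 0<a d₀<0 (sym (weight hP hQ))
        exchange X     Q     hP hQ = inner (to (I zero)) hP hQ refl

  -- Covers n = 4 and n ≥ 5 at once: a book is apart from any book of another spine weight and from
  -- anything with a hub.
  SpineOrHub : ∀ {N} → Params N → ℤ → Set
  SpineOrHub S w = (∃₂ λ s t → Book (K S) s t × K S s t ≡ w) ⊎ ∃ (Hub (K S))

  apart-book : ∀ {N} {S S′ : Params N} → Skew (Params.r S) → Skew (Params.r S′) → ∀ {s t w} →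
               Book (K S) s t → SpineOrHub S′ w → K S s t ≢ w → Apart S S′
  apart-book {S = S} {S′} sk sk′ b (inj₁ (s′ , t′ , b′ , refl)) ne = apart-spine {S = S} {S′} sk sk′ b b′ ne
  apart-book {S = S} {S′} sk sk′ b (inj₂ (z , h))               _  = apart-book-hub {S = S} {S′} sk sk′ b h

  Fin1-OutOfPhase : ∀ {L′} (D : Setting 0 L′) → Late.OutOfPhase D → ∀ j → Setting.d₁ D ≢ Setting.e₁ D j
  Fin1-OutOfPhase D (inj₁ (zero , zero , ne)) = contradiction refl ne
  Fin1-OutOfPhase D (inj₂ ne)                 = ne

  short-tail : ∀ {q L′} (D : Setting q L′) → let open Setting D in SpineOrHub (state down 0 0) (top zero)
  short-tail {zero}  D = inj₁ (I zero , X , SmallBooks.short-book D , neg-involutive (Setting.top D zero))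
  short-tail {suc q} D = inj₂ (X , LargeHubs.short-hub D)

  closing-tail : ∀ {q L′} (D : Setting q L′) t → let open Setting D in SpineOrHub (state down 0 (suc t)) (e zero (suc (suc t)))
  closing-tail {zero}  D t = inj₁ (Q , I zero , SmallBooks.closing-book D t , refl)
  closing-tail {suc q} D t = inj₂ (Q , LargeHubs.closing-hub D t)

  finish-tail : ∀ {q L′} (D : Setting q L′) → let open Setting D in SpineOrHub finish (e zero L)
  finish-tail {zero}  D = inj₁ (Q , I zero , SmallBooks.finish-book D , refl)
  finish-tail {suc q} D = inj₂ (Q , LargeHubs.finish-hub D)

  module _ where
    open Setting

    turn-closing : ∀ {q L′} (D : Setting q L′) → ∀ t → suc t ≡ L′ → Apart (turn D) (state D (down D) 0 (suc t))
    turn-closing {zero}  D t eq = LateSmall.turn-closing D t eq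
    turn-closing {suc q} D t eq = apart-book-hub {S = turn D} {state D (down D) 0 (suc t)}
      (r-skew D) (r-skew D) (Books.turn-book D) (LargeHubs.closing-hub D t)

    turn-finish : ∀ {q L′} (D : Setting q L′) → Late.OutOfPhase D → Apart (turn D) (finish D)
    turn-finish {zero}  D phase = LateSmall.turn-finish D (Fin1-OutOfPhase D phase)
    turn-finish {suc q} D phase = apart-book-hub {S = turn D} {finish D}
      (r-skew D) (r-skew D) (Books.turn-book D) (LargeHubs.finish-hub D)

    turn₂-closing : ∀ {q L′} (D : Setting q L′) → Late.OutOfPhase D → ∀ s → suc s ≡ L′ →
                    Apart (state D (down D) (suc s) 0) (state D (down D) 0 (suc s))
    turn₂-closing {zero}  D phase s eq = LateSmall.turn₂-closing D s eq (Fin1-OutOfPhase D phase)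
    turn₂-closing {suc q} D phase s eq = apart-book-hub {S = state D (down D) (suc s) 0} {state D (down D) 0 (suc s)}
      (r-skew D) (r-skew D) (Books.turn₂-book D s) (LargeHubs.closing-hub D s)

    turn₂-finish : ∀ {q L′} (D : Setting q L′) → ∀ s → suc s ≡ L′ → Apart (state D (down D) (suc s) 0) (finish D)
    turn₂-finish {zero}  D s eq = LateSmall.turn₂-finish D s eq
    turn₂-finish {suc q} D s eq = apart-book-hub {S = state D (down D) (suc s) 0} {finish D}
      (r-skew D) (r-skew D) (Books.turn₂-book D s) (LargeHubs.finish-hub D)

    closing-finish : ∀ {q L′} (D : Setting q L′) → ∀ t → suc t ≡ L′ → Apart (state D (down D) 0 (suc t)) (finish D)
    closing-finish {zero}  D t refl = apart-book {S = state D (down D) 0 (suc t)} {finish D} (r-skew D) (r-skew D)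
      (SmallBooks.closing-book D t) (finish-tail D) (<⇒≢ (Setting.Growᵉ.lin-step D zero (suc (suc t))))
    closing-finish {suc q} D t eq = LateLarge.closing-finish D t eq (LargeHubs.closing-hub D t) (LargeHubs.finish-hub D)

    short-finish : ∀ {q L′} (D : Setting q L′) → L′ ≡ 0 → Apart (state D (down D) 0 0) (finish D)
    short-finish {zero}  D eq = apart-book {S = state D (down D) 0 0} {finish D} (r-skew D) (r-skew D)
      (SmallBooks.short-book D) (finish-tail D) (λ p → <⇒≢ (e<top D zero) (trans (sym p) (neg-involutive (top D zero))))
    short-finish {suc q} D eq = LateLarge.short-finish D eq (LargeHubs.short-hub D) (LargeHubs.finish-hub D)

  -- The descent leads from `state down L′ 0` to `state down 0 L′`. For k = 1 these coincide, and
  -- `short` stands for both.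
  data Turning (L′ : ℕ) : Set where
    turning  : Turning L′
    turning₂ : ∀ s → suc s ≡ L′ → Turning L′
    short    : L′ ≡ 0 → Turning L′
    closing  : ∀ t → suc t ≡ L′ → Turning L′
    finished : Turning L′

  data LateStage (L′ : ℕ) : Set where
    rising  : ∀ s t → suc s ℕ.+ suc t ≡ suc (suc L′) → LateStage L′
    falling : ∀ s t → suc s ℕ.+ suc t ≡ L′ → LateStage L′
    special : Turning L′ → LateStage L′

  module LateStages {q L′ : ℕ} (D : Setting q L′) (phase : Late.OutOfPhase D) where
    open Setting D
    open Books D
    open Late D

    special-params : Turning L′ → Params N
    special-params turning        = turn
    special-params (turning₂ s _) = state down (suc s) 0
    special-params (short _)      = state down 0 0
    special-params (closing t _)  = state down 0 (suc t)
    special-params finished       = finish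

    late : LateStage L′ → Params N
    late (rising s t _)  = state c (suc s) (suc t)
    late (falling s t _) = state down (suc s) (suc t)
    late (special x)     = special-params x

    special-time : Turning L′ → ℕ
    special-time turning        = 0
    special-time (turning₂ s _) = 1
    special-time (short _)      = 1
    special-time (closing t _)  = 2 ℕ.+ t
    special-time finished       = 2 ℕ.+ L′

    -- The number of mutations performed before the stage is reached.
    time : LateStage L′ → ℕ
    time (rising s t _)  = 2 ℕ.+ s
    time (falling s t _) = 2 ℕ.+ (L ℕ.+ N ℕ.+ (2 ℕ.+ t))
    time (special x)     = 2 ℕ.+ (L ℕ.+ N ℕ.+ special-time x)

    special-skew : ∀ x → Skew (Params.r (special-params x))
    special-skew turning        = r-skew
    special-skew (turning₂ _ _) = r-skew
    special-skew (short _)      = r-skew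
    special-skew (closing _ _)  = r-skew
    special-skew finished       = r-skew

    late-skew : ∀ x → Skew (Params.r (late x))
    late-skew (rising _ _ _)  = r-skew
    late-skew (falling _ _ _) = r-skew
    late-skew (special x)     = special-skew x

    late-onCycle : ∀ x z → OnCycle (K (late x)) z
    late-onCycle (rising s t _)           = generic-onCycle s t
    late-onCycle (falling s t _)          = generic-onCycle s t
    late-onCycle (special turning)        = turn-onCycle
    late-onCycle (special (turning₂ s _)) = turn₂-onCycle s
    late-onCycle (special (short _))      = short-onCycle
    late-onCycle (special (closing t _))  = closing-onCycle t
    late-onCycle (special finished)       = finish-onCycle

    down<0 : ∀ i → Neg (down i)
    down<0 i = -neg (0<top i)

    generic-special : ∀ {h b} s t → (∀ i → Sign b (h i)) → ∀ x → Apart (state h (suc s) (suc t)) (special-params x)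
    generic-special {h} {b} s t sh = apart
      where
      S = state h (suc s) (suc t)
      book : Book (K S) P Q
      book = generic-book {b = b} s t sh
      by-tail : ∀ {w} x → SpineOrHub (special-params x) w → a < w → Apart S (special-params x)
      by-tail x tail a< = apart-book {S = S} {special-params x} r-skew (special-skew x) book tail (<⇒≢ a<)
      apart : ∀ x → Apart S (special-params x)
      apart turning         = by-tail turning (inj₁ (X , P , turn-book , refl)) (a<d L′)
      apart (turning₂ s eq) = by-tail (turning₂ s eq) (inj₁ (X , P , turn₂-book s , refl)) (a<d s)
      apart (short eq)      = by-tail (short eq) (short-tail D) (a<top zero)
      apart (closing t eq)  = by-tail (closing t eq) (closing-tail D t) (a<e zero t)
      apart finished        = by-tail finished (finish-tail D) (a<e zero L′)

    turn-turn₂ : ∀ s → suc s ≡ L′ → Apart turn (state down (suc s) 0)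
    turn-turn₂ s refl = apart-spine {S = turn} {state down (suc s) 0} r-skew r-skew turn-book (turn₂-book s)
      (λ eq → <⇒≢ (Growᵈ.lin-step (suc L′)) (sym eq))

    turn-short : Apart turn (state down 0 0)
    turn-short = apart-book {S = turn} {state down 0 0} r-skew r-skew turn-book (short-tail D) (<⇒≢ (d<top zero))

    Apart-special : Turning L′ → Turning L′ → Set
    Apart-special x y = Apart (special-params x) (special-params y)

    special-sym : ∀ x y → Apart-special x y → Apart-special y x
    special-sym x y = Apart-sym {S = special-params x} {special-params y}

    special-apart : ∀ x y → special-time x ≢ special-time y → Apart-special x y
    special-apart turning          turning           ne = contradiction refl ne
    special-apart turning          (turning₂ s eq)   _  = turn-turn₂ s eq
    special-apart turning          (short eq)        _  = turn-short
    special-apart turning          (closing t eq)    _  = turn-closing D t eq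
    special-apart turning          finished          _  = turn-finish D phase
    special-apart (turning₂ _ _)   (turning₂ _ _)    ne = contradiction refl ne
    special-apart (turning₂ _ _)   (short _)         ne = contradiction refl ne
    special-apart (turning₂ s refl) (closing s refl) _  = turn₂-closing D phase s refl
    special-apart (turning₂ s eq)  finished          _  = turn₂-finish D s eq
    special-apart (short _)        (short _)         ne = contradiction refl ne
    special-apart (short refl)     (closing _ ())    _
    special-apart (short eq)       finished          _  = short-finish D eq
    special-apart (closing t refl) (closing t refl)  ne = contradiction refl ne
    special-apart (closing t eq)   finished          _  = closing-finish D t eq
    special-apart finished         finished          ne = contradiction refl ne
    special-apart x@(turning₂ s eq) y@turning        _  = special-sym y x (turn-turn₂ s eq)
    special-apart x@(short eq)     y@turning         _  = special-sym y x turn-short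
    special-apart x@(closing t eq) y@turning         _  = special-sym y x (turn-closing D t eq)
    special-apart x@finished       y@turning         _  = special-sym y x (turn-finish D phase)
    special-apart (short _)        (turning₂ _ _)    ne = contradiction refl ne
    special-apart x@(closing s refl) y@(turning₂ s refl) _ = special-sym y x (turn₂-closing D phase s refl)
    special-apart x@finished       y@(turning₂ s eq) _  = special-sym y x (turn₂-finish D s eq)
    special-apart x@finished       y@(short eq)      _  = special-sym y x (short-finish D eq)
    special-apart x@finished       y@(closing t eq)  _  = special-sym y x (closing-finish D t eq)

    same-falling : ∀ {s t s′ t′} → suc s ℕ.+ suc t ≡ L′ → suc s′ ℕ.+ suc t′ ≡ L′ → s ≡ s′ → t ≡ t′
    same-falling {s} {t} {_} {t′} eq eq′ refl = ℕ.suc-injective (ℕ.+-cancelˡ-≡ (suc s) (suc t) (suc t′) (trans eq (sym eq′)))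

    late-apart : ∀ x y → time x ≢ time y → Apart (late x) (late y)
    late-apart (rising s t _) (rising s′ t′ _) ne =
      generic-apart phase {b = true} {true} s t s′ t′ 0<c 0<c (λ _ → ne ∘ cong (2 ℕ.+_))
    late-apart (rising s t _) (falling s′ t′ _) ne =
      generic-apart phase {b = true} {false} s t s′ t′ 0<c down<0 (λ ())
    late-apart (falling s t _) (rising s′ t′ _) ne =
      generic-apart phase {b = false} {true} s t s′ t′ down<0 0<c (λ ())
    late-apart (falling s t eq) (falling s′ t′ eq′) ne =
      generic-apart phase {b = false} {false} s t s′ t′ down<0 down<0
        (λ _ s≡s′ → ne (cong (λ t → 2 ℕ.+ (L ℕ.+ N ℕ.+ (2 ℕ.+ t))) (same-falling eq eq′ s≡s′)))
    late-apart (rising s t _)  (special y)     _  = generic-special {b = true} s t 0<c y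
    late-apart (falling s t _) (special y)     _  = generic-special {b = false} s t down<0 y
    late-apart (special x)     (rising s t _)  _  =
      Apart-sym {S = state c (suc s) (suc t)} {special-params x} (generic-special {b = true} s t 0<c x)
    late-apart (special x)     (falling s t _) _  =
      Apart-sym {S = state down (suc s) (suc t)} {special-params x} (generic-special {b = false} s t down<0 x)
    late-apart (special x)     (special y)     ne =
      special-apart x y (ne ∘ cong (λ t → 2 ℕ.+ (L ℕ.+ N ℕ.+ t)))

  module _ {N} {S S′ : Params N} (φ : Iso (K S) (K S′)) where
    open Iso φ

    -- Replaces `book-book` where only one vertex completes a 3-cycle with `P` and `Q`, since that
    -- vertex then lies on all 3-cycles too. The arrow P → Q of the target is the image of an arrow
    -- of the given 3-cycle, and only the lightest of the three has weight `a`.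
    fixes-spine : Params.a S′ ≡ Params.a S → Pos (Params.a S) → ∀ {w} → Params.a S < K S Q w → Params.a S < K S w P →
                  Hit (K S′) P → Hit (K S′) Q → to P ≡ P × to Q ≡ Q
    fixes-spine a≡ 0<a {w} a<Qw a<wP hit-P hit-Q =
      cases (hit-P (to-cycle φ (cycle 0<a 0<Qw 0<wP))) (hit-Q (to-cycle φ (cycle 0<a 0<Qw 0<wP)))
      where
      0<Qw = <-trans 0<a a<Qw
      0<wP = <-trans 0<a a<wP
      heavy : ∀ {u v} → to u ≡ P → to v ≡ Q → Params.a S < K S u v → ⊥
      heavy p q a< = ≡⇒≯ (trans (sym a≡) (weight p q)) a<
      back : ∀ {u v} → to u ≡ Q → to v ≡ P → Pos (K S u v) → ⊥
      back p q pos = <-asym (subst Pos (sym (weight p q)) pos) (neg-mono-< (subst Pos (sym a≡) 0<a))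
      cases : P ≡ to P ⊎ P ≡ to Q ⊎ P ≡ to w → Q ≡ to P ⊎ Q ≡ to Q ⊎ Q ≡ to w → to P ≡ P × to Q ≡ Q
      cases (inj₁ p)        (inj₂ (inj₁ q)) = sym p , sym q
      cases (inj₁ p)        (inj₁ q)        = contradiction (trans p (sym q)) λ ()
      cases (inj₁ p)        (inj₂ (inj₂ q)) = ⊥-elim (back (sym q) (sym p) 0<wP)
      cases (inj₂ (inj₁ p)) (inj₁ q)        = ⊥-elim (back (sym q) (sym p) 0<a)
      cases (inj₂ (inj₁ p)) (inj₂ (inj₁ q)) = contradiction (trans p (sym q)) λ ()
      cases (inj₂ (inj₁ p)) (inj₂ (inj₂ q)) = ⊥-elim (heavy (sym p) (sym q) a<Qw)
      cases (inj₂ (inj₂ p)) (inj₁ q)        = ⊥-elim (heavy (sym p) (sym q) a<wP)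
      cases (inj₂ (inj₂ p)) (inj₂ (inj₁ q)) = ⊥-elim (back (sym q) (sym p) 0<Qw)
      cases (inj₂ (inj₂ p)) (inj₂ (inj₂ q)) = contradiction (trans p (sym q)) λ ()

  below-true : ∀ {N} m (i : Fin N) → below m i ≡ true → toℕ i ℕ.< m
  below-true m i eq = ℕ.<ᵇ⇒< (toℕ i) m (subst T (sym eq) tt)

  below-false : ∀ {N} m (i : Fin N) → below m i ≡ false → ¬ toℕ i ℕ.< m
  below-false m i eq p = contradiction (trans (sym (dec-true (toℕ i ℕ.<? m) p)) eq) λ ()

  -- Pigeonhole principle: `f` injects the `m` indices below `m` into the indices below `m′`.
  below-count : ∀ {N} {m m′} → m ℕ.≤ N → (f : Fin N → Fin N) → (∀ {i j} → f i ≡ f j → i ≡ j) →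
                (∀ i → below m i ≡ below m′ (f i)) → m ℕ.≤ m′
  below-count {N} {m} {m′} m≤N f inj same = injective⇒≤ {f = g} g-injective
    where
    lift : Fin m → Fin N
    lift i = inject≤ i m≤N
    small : ∀ i → toℕ (f (lift i)) ℕ.< m′
    small i = below-true m′ (f (lift i)) (trans (sym (same (lift i)))
      (dec-true (toℕ (lift i) ℕ.<? m) (subst (ℕ._< m) (sym (toℕ-inject≤ i m≤N)) (toℕ<n i))))
    g : Fin m → Fin m′
    g i = fromℕ< (small i)
    g-injective : ∀ {i j} → g i ≡ g j → i ≡ j
    g-injective {i} {j} eq = toℕ-injective (begin
      toℕ i        ≡⟨ sym (toℕ-inject≤ i m≤N) ⟩
      toℕ (lift i) ≡⟨ cong toℕ (inj (toℕ-injective (fromℕ<-injective _ _ (small i) (small j) eq))) ⟩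
      toℕ (lift j) ≡⟨ toℕ-inject≤ j m≤N ⟩
      toℕ j        ∎)
      where open ≡-Reasoning

  -- Stages with a vertex on no 3-cycle

  data EarlyStage (N : ℕ) : Set where
    initial opened : EarlyStage N
    mid            : ∀ m → m ℕ.≤ N → EarlyStage N

  module Early {q L′ : ℕ} (D : Setting q L′) (phase : Late.OutOfPhase D) where
    open Setting D

    -- The class `true` holds the vertices already mutated. Arrows between the classes lead only
    -- from mutated to unmutated vertices, whence `b ∨ not c`.
    middle-pattern : Pattern
    middle-pattern = record
      { sx = true ; sy = true ; sf = id ; sg = not ; sh = not ; sr = λ b c → b ∨ not c ; used = λ _ → true }

    negIf-sign⁻ : ∀ b {z} → Neg z → Sign b (negIf b z)
    negIf-sign⁻ true  = -pos
    negIf-sign⁻ false n = n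

    negIf-sign⁺ : ∀ b {z} → Pos z → Sign (not b) (negIf b z)
    negIf-sign⁺ true  = -neg
    negIf-sign⁺ false p = p

    middle-r : ℕ → Fin N → Fin N → ℤ
    middle-r m = Params.r (middle m)

    middle-skew : ∀ m → Skew (middle-r m)
    middle-skew m = flipped-skew m (state c L 0) r-skew

    middle-arrow : ∀ m i j → Pos (middle-r m i j) → T (below m i ∨ not (below m j))
    middle-arrow m i j p with below m i in bi | below m j in bj
    ... | true  | _     = tt
    ... | false | false = tt
    ... | false | true  = below-false m i bi (ℕ.<-trans (r-descends j i (subst Pos (sym (r-skew j i)) p)) (below-true m j bj))

    middle-descends : ∀ m i j → Pos (middle-r m i j) → below m i ≡ below m j → toℕ j ℕ.< toℕ i
    middle-descends m i j p eq with below m i | below m j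
    middle-descends m i j p refl | true  | .true  = r-descends i j (subst Pos (neg-involutive (r i j)) p)
    middle-descends m i j p refl | false | .false = r-descends i j p

    -- `T (b ∨ not c)` says that `c` implies `b`. A 3-cycle among the `I i` would thus stay in one
    -- class, where indices decrease along arrows.
    weakly-cyclic : ∀ b c d → T (b ∨ not c) → T (c ∨ not d) → T (d ∨ not b) → b ≡ c × c ≡ d × d ≡ b
    weakly-cyclic true  true  true  _ _ _ = refl , refl , refl
    weakly-cyclic false false false _ _ _ = refl , refl , refl
    weakly-cyclic true  true  false _ _ ()
    weakly-cyclic true  false true  _ ()
    weakly-cyclic true  false false _ _ ()
    weakly-cyclic false true  _     ()
    weakly-cyclic false false true  _ ()

    middle-acyclic : ∀ m → Acyclic (middle-r m)
    middle-acyclic m {i} {j} {k} (cycle p q s) =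
      let bij , bjk , bki = weakly-cyclic (below m i) (below m j) (below m k)
                              (middle-arrow m i j p) (middle-arrow m j k q) (middle-arrow m k i s)
      in ℕ.<-irrefl refl (ℕ.<-trans (middle-descends m k i s bki)
           (ℕ.<-trans (middle-descends m j k q bjk) (middle-descends m i j p bij)))

    middle-has-pattern : ∀ m → HasPattern (middle m) (below m) middle-pattern
    middle-has-pattern m = record
      { 0<a = 0<a ; sign-x = 0<d L ; sign-y = 0<d (suc L′)
      ; sign-f = λ i → negIf-sign⁻ (below m i) (e₀<0 i)
      ; sign-g = λ i → negIf-sign⁺ (below m i) (0<e₁ i)
      ; sign-h = λ i → negIf-sign⁺ (below m i) (0<c i)
      ; sign-r = middle-arrow m ; acyclic = middle-acyclic m ; in-use = λ _ → tt }

    early : EarlyStage N → Params N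
    early initial   = start
    early opened    = state c 0 L
    early (mid m _) = middle m

    early-time : EarlyStage N → ℕ
    early-time initial   = 0
    early-time opened    = 1
    early-time (mid m _) = 1 ℕ.+ (L ℕ.+ m)

    -- The vertex n is a sink in `start` and a source after its mutation. Later the mutated `I i`
    -- only send arrows to `P`, `Q`, `X` and the unmutated ones only receive them, so no 3-cycle
    -- uses any `I i`.
    early-free : ∀ x → ∃ (Free (K (early x)))
    early-free initial   = X , free-by-pattern start-pattern X tt
    early-free opened    = X , free-by-pattern opening-pattern X tt
    early-free (mid m _) = I zero , free-by-pattern (middle-has-pattern m) (I zero) (check (below {N} m zero))
      where
      check : ∀ b → T (freeᵇ middle-pattern (kI b))
      check true  = tt
      check false = tt

    early-skew : ∀ x → Skew (Params.r (early x))
    early-skew initial   = r-skew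
    early-skew opened    = r-skew
    early-skew (mid m _) = middle-skew m

    early-a : ∀ x → Params.a (early x) ≡ a
    early-a initial   = refl
    early-a opened    = refl
    early-a (mid m _) = refl

    hits : ∀ x → Hit (K (early x)) P × Hit (K (early x)) Q
    hits initial   = hit-by-pattern start-pattern solitary-P tt , hit-by-pattern start-pattern solitary-Q tt
    hits opened    = hit-by-pattern opening-pattern solitary-P tt , hit-by-pattern opening-pattern solitary-Q tt
    hits (mid m _) = hit-by-pattern (middle-has-pattern m) solitary-P tt , hit-by-pattern (middle-has-pattern m) solitary-Q tt

    module _ (x y : EarlyStage N) where

      fixes : ∀ {w} → a < K (early x) Q w → a < K (early x) w P → (φ : Iso (K (early x)) (K (early y))) →
              Iso.to φ P ≡ P × Iso.to φ Q ≡ Q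
      fixes {w} p q φ = fixes-spine {S = early x} {early y} φ (trans (early-a y) (sym (early-a x))) (subst Pos (sym (early-a x)) 0<a)
        {w} (subst (_< K (early x) Q w) (sym (early-a x)) p) (subst (_< K (early x) w P) (sym (early-a x)) q) (proj₁ (hits y)) (proj₂ (hits y))

      fixes⁻ : ∀ {w} → a < K (early x) Q w → a < K (early x) w P → (φ : Iso (K (early x)) (K (reversed (early y)))) →
               Iso.to φ P ≡ P × Iso.to φ Q ≡ Q
      fixes⁻ {w} p q φ = fixes-spine {S = early x} {reversed (early y)} φ (trans (early-a y) (sym (early-a x))) (subst Pos (sym (early-a x)) 0<a)
        {w} (subst (_< K (early x) Q w) (sym (early-a x)) p) (subst (_< K (early x) w P) (sym (early-a x)) q)
        (hit-reversed (early y) (early-skew y) (proj₂ (hits y))) (hit-reversed (early y) (early-skew y) (proj₁ (hits y)))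

    initial-opened : Apart start (state c 0 L)
    initial-opened = forward , backward
      where
      forward : ¬ Iso (K start) (K (state c 0 L))
      forward φ = page (to X) refl
        where
        open Iso φ
        hP = proj₁ (fixes initial opened {I zero} (a<e zero (suc L′)) (a<e zero L′) φ)
        hQ = proj₂ (fixes initial opened {I zero} (a<e zero (suc L′)) (a<e zero L′) φ)
        page : ∀ u → to X ≡ u → ⊥
        page P     h = distinct φ h hP λ ()
        page Q     h = distinct φ h hQ λ ()
        page X     h = pos≢neg 0<d₁ (-neg 0<d₁) (weight h hP)
        page (I j) h = pos≢neg (0<e j (suc L′)) (-neg 0<d₁) (weight h hP)
      backward : ¬ Iso (K start) (K (reversed (state c 0 L)))
      backward φ = page (to (I zero)) refl
        where
        open Iso φ
        hP = proj₁ (fixes⁻ initial opened {I zero} (a<e zero (suc L′)) (a<e zero L′) φ)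
        hQ = proj₂ (fixes⁻ initial opened {I zero} (a<e zero (suc L′)) (a<e zero L′) φ)
        page : ∀ u → to (I zero) ≡ u → ⊥
        page P     h = distinct φ h hP λ ()
        page Q     h = distinct φ h hQ λ ()
        page X     h = pos≢neg (0<e zero (suc L′)) d₀<0 (sym (weight h hP))
        page (I j) h = ≡⇒≯ (sym (weight h hP)) (<-trans (Growᵉ.lin-step zero L) (subst (_< e j (suc L)) (weight hQ h) (Growᵉ.lin-step j L)))

    -- `X` completes a 3-cycle with `P` and `Q` in `middle m`, but not at the other stage, so it
    -- would have to go to some `I j`. The order of the two weights there forbids this; under
    -- reversal `phase` does.
    middle-end : ∀ m (m≤N : m ℕ.≤ N) x → Neg (Params.x (early x)) ⊎ Neg (Params.y (early x)) →
                 (∀ i → Params.f (early x) i ≡ e i L) → (∀ i → Params.g (early x) i ≡ e i (suc L)) → Apart (middle m) (early x)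
    middle-end m m≤N x sign f≡ g≡ = forward , backward
      where
      S′ = early x
      forward : ¬ Iso (K (middle m)) (K S′)
      forward φ = page (to X) refl
        where
        open Iso φ
        hP = proj₁ (fixes (mid m m≤N) x {X} (a<d L′) (a<d (suc L′)) φ)
        hQ = proj₂ (fixes (mid m m≤N) x {X} (a<d L′) (a<d (suc L′)) φ)
        page : ∀ u → to X ≡ u → ⊥
        page P     h = distinct φ h hP λ ()
        page Q     h = distinct φ h hQ λ ()
        page X     h = [ (λ n → pos≢neg (0<d L) n (sym (weight h hP))) , (λ n → pos≢neg (0<d (suc L′)) n (sym (weight hQ h))) ]′ sign
        page (I j) h = ≡⇒≯ (sym (trans (sym (g≡ j)) (weight hQ h)))
          (<-trans (Growᵈ.lin-step L) (subst (_< e j (suc L)) (trans (sym (f≡ j)) (weight h hP)) (Growᵉ.lin-step j L)))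
      backward : ¬ Iso (K (middle m)) (K (reversed S′))
      backward φ = page (to X) refl
        where
        open Iso φ
        hP = proj₁ (fixes⁻ (mid m m≤N) x {X} (a<d L′) (a<d (suc L′)) φ)
        hQ = proj₂ (fixes⁻ (mid m m≤N) x {X} (a<d L′) (a<d (suc L′)) φ)
        other : ∀ i u → to (I i) ≡ u → u ≡ X
        other i P     h = ⊥-elim (distinct φ h hP λ ())
        other i Q     h = ⊥-elim (distinct φ h hQ λ ())
        other i X     h = refl
        other i (I j) h = ⊥-elim (not-both (below m i)
          (subst Pos (trans (sym (g≡ j)) (weight h hP)) (0<e j L))
          (subst Pos (trans (sym (f≡ j)) (weight hQ h)) (0<e j (suc L′)))
          (HasPattern.sign-f (middle-has-pattern m) i) (HasPattern.sign-g (middle-has-pattern m) i))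
        page : ∀ u → to X ≡ u → ⊥
        page P     h = distinct φ h hP λ ()
        page Q     h = distinct φ h hQ λ ()
        page X     h = [ (λ n → pos≢neg (0<d (suc L′)) n (sym (weight hQ h))) , (λ n → pos≢neg (0<d L) n (sym (weight h hP))) ]′ sign
        page (I j) h = [ (λ (i , i′ , i≢i′) → distinct φ (other i (to (I i)) refl) (other i′ (to (I i′)) refl) (i≢i′ ∘ I-injective))
                       , (λ ne → ne j (lin-phase 2≤a d₀<0 0<d₁ (e₀<0 j) (0<e₁ j) L L
                            (trans (sym (weight hQ h)) (f≡ j)) (trans (sym (weight h hP)) (g≡ j)))) ]′ phase

    -- `P`, `Q` and `X` are fixed, so the `I i` are permuted, and the direction of the arrow to `P`
    -- shows which of them have been mutated. Counting these gives the bound.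
    middle-iso : ∀ m m′ → m ℕ.≤ N → m′ ℕ.≤ N → Iso (K (middle m)) (K (middle m′)) → m ℕ.≤ m′
    middle-iso m m′ m≤N m′≤N φ = below-count m≤N (proj₁ ∘ image) image-injective same-class
      where
      open Iso φ
      hP = proj₁ (fixes (mid m m≤N) (mid m′ m′≤N) {X} (a<d L′) (a<d (suc L′)) φ)
      hQ = proj₂ (fixes (mid m m≤N) (mid m′ m′≤N) {X} (a<d L′) (a<d (suc L′)) φ)
      page : ∀ u → to X ≡ u → u ≡ X
      page P     h = ⊥-elim (distinct φ h hP λ ())
      page Q     h = ⊥-elim (distinct φ h hQ λ ())
      page X     h = refl
      page (I j) h = ⊥-elim (not-both (below m′ j) (subst Pos (sym (weight h hP)) (0<d L)) (subst Pos (sym (weight hQ h)) (0<d (suc L′)))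
        (HasPattern.sign-f (middle-has-pattern m′) j) (HasPattern.sign-g (middle-has-pattern m′) j))
      hX = page (to X) refl
      other : ∀ i u → to (I i) ≡ u → ∃ λ j → u ≡ I j
      other i P     h = ⊥-elim (distinct φ h hP λ ())
      other i Q     h = ⊥-elim (distinct φ h hQ λ ())
      other i X     h = ⊥-elim (distinct φ h hX λ ())
      other i (I j) h = j , refl
      image : ∀ i → ∃ λ j → to (I i) ≡ I j
      image i = other i (to (I i)) refl
      image-injective : ∀ {i j} → proj₁ (image i) ≡ proj₁ (image j) → i ≡ j
      image-injective {i} {j} eq = I-injective (to-injective (trans (proj₂ (image i)) (trans (cong I eq) (sym (proj₂ (image j))))))
      same-class : ∀ i → below m i ≡ below m′ (proj₁ (image i))
      same-class i = sign-unique (HasPattern.sign-f (middle-has-pattern m) i)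
        (subst (Sign (below m′ (proj₁ (image i)))) (weight (proj₂ (image i)) hP) (HasPattern.sign-f (middle-has-pattern m′) (proj₁ (image i))))

    middle-apart : ∀ m m′ → m ℕ.≤ N → m′ ℕ.≤ N → m ≢ m′ → Apart (middle m) (middle m′)
    middle-apart m m′ m≤N m′≤N ne = (λ φ → ne (ℕ.≤-antisym (middle-iso m m′ m≤N m′≤N φ) (middle-iso m′ m m′≤N m≤N (Iso-sym φ)))) , backward
      where
      backward : ¬ Iso (K (middle m)) (K (reversed (middle m′)))
      backward φ = page (to X) refl
        where
        open Iso φ
        hP = proj₁ (fixes⁻ (mid m m≤N) (mid m′ m′≤N) {X} (a<d L′) (a<d (suc L′)) φ)
        hQ = proj₂ (fixes⁻ (mid m m≤N) (mid m′ m′≤N) {X} (a<d L′) (a<d (suc L′)) φ)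
        page : ∀ u → to X ≡ u → ⊥
        page P     h = distinct φ h hP λ ()
        page Q     h = distinct φ h hQ λ ()
        page X     h = ≡⇒≯ (sym (weight hQ h)) (Growᵈ.lin-step L)
        page (I j) h = not-both (below m′ j) (subst Pos (sym (weight hQ h)) (0<d (suc L′))) (subst Pos (sym (weight h hP)) (0<d L))
          (HasPattern.sign-f (middle-has-pattern m′) j) (HasPattern.sign-g (middle-has-pattern m′) j)

    early-apart : ∀ x y → early-time x ≢ early-time y → Apart (early x) (early y)
    early-apart initial     initial       ne = contradiction refl ne
    early-apart initial     opened        _  = initial-opened
    early-apart opened      initial       _  = Apart-sym {S = start} {state c 0 L} initial-opened
    early-apart opened      opened        ne = contradiction refl ne
    early-apart (mid m m≤N) initial       _  = middle-end m m≤N initial (inj₁ (-neg 0<d₁)) (λ _ → refl) (λ _ → refl)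
    early-apart (mid m m≤N) opened        _  = middle-end m m≤N opened (inj₂ d₀<0) (λ _ → refl) (λ _ → refl)
    early-apart initial     (mid m m≤N)   _  = Apart-sym {S = middle m} {start} (middle-end m m≤N initial (inj₁ (-neg 0<d₁)) (λ _ → refl) (λ _ → refl))
    early-apart opened      (mid m m≤N)   _  = Apart-sym {S = middle m} {state c 0 L} (middle-end m m≤N opened (inj₂ d₀<0) (λ _ → refl) (λ _ → refl))
    early-apart (mid m m≤N) (mid m′ m′≤N) ne = middle-apart m m′ m≤N m′≤N (ne ∘ cong (λ m → 1 ℕ.+ (L ℕ.+ m)))

  module Stages {q L′ : ℕ} (D : Setting q L′) (phase : Late.OutOfPhase D) where
    open Setting D
    open Early D phase
    open LateStages D phase

    Stage : Set
    Stage = EarlyStage N ⊎ LateStage L′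

    params : Stage → Params N
    params = [ early , late ]′

    stage-time : Stage → ℕ
    stage-time = [ early-time , time ]′

    early-late : ∀ x y → Apart (early x) (late y)
    early-late x y = apart-free {S = early x} {late y} (late-skew y) (proj₁ (early-free x)) (proj₂ (early-free x)) (late-onCycle y)

    stages-apart : ∀ x y → stage-time x ≢ stage-time y → Apart (params x) (params y)
    stages-apart (inj₁ x) (inj₁ y) ne = early-apart x y ne
    stages-apart (inj₁ x) (inj₂ y) _  = early-late x y
    stages-apart (inj₂ x) (inj₁ y) _  = Apart-sym {S = early y} {late x} (early-late y x)
    stages-apart (inj₂ x) (inj₂ y) ne = late-apart x y ne

  -- Following the mutation sequence

  -- Counts single terms rather than pairs, so that the sequence can be followed through odd
  -- positions.
  alternate : ∀ {A : Set} → ℕ → A → A → List A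
  alternate zero    u v = []
  alternate (suc n) u v = u ∷ alternate n v u

  alt≡alternate : ∀ {A : Set} k (u v : A) → alt k u v ≡ alternate (k ℕ.* 2) u v
  alt≡alternate zero    u v = refl
  alt≡alternate (suc k) u v = cong (λ l → u ∷ v ∷ l) (alt≡alternate k u v)

  length-alternate : ∀ {A : Set} n (u v : A) → length (alternate n u v) ≡ n
  length-alternate zero    u v = refl
  length-alternate (suc n) u v = cong suc (length-alternate n v u)

  tabulate-∷ʳ : ∀ {A : Set} {n} (f : Fin (suc n) → A) → tabulate f ≡ tabulate (f ∘ inject₁) ∷ʳ f (fromℕ n)
  tabulate-∷ʳ {n = zero}  f = refl
  tabulate-∷ʳ {n = suc n} f = cong (f zero ∷_) (tabulate-∷ʳ (f ∘ suc))

  opposite-inject₁ : ∀ {n} (i : Fin n) → opposite (inject₁ i) ≡ suc (opposite i)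
  opposite-inject₁ {suc n} zero    = refl
  opposite-inject₁ {suc n} (suc i) = cong inject₁ (opposite-inject₁ i)

  opposite-fromℕ : ∀ n → opposite (fromℕ n) ≡ zero
  opposite-fromℕ zero    = refl
  opposite-fromℕ (suc n) = cong inject₁ (opposite-fromℕ n)

  reverse-tabulate : ∀ {A : Set} {n} (f : Fin n → A) → reverse (tabulate f) ≡ tabulate (f ∘ opposite)
  reverse-tabulate {n = zero}  f = refl
  reverse-tabulate {n = suc n} f = begin
    reverse (f zero ∷ tabulate (f ∘ suc))                         ≡⟨ unfold-reverse (f zero) (tabulate (f ∘ suc)) ⟩
    reverse (tabulate (f ∘ suc)) ∷ʳ f zero                        ≡⟨ cong (_∷ʳ f zero) (reverse-tabulate (f ∘ suc)) ⟩
    tabulate (f ∘ suc ∘ opposite) ∷ʳ f zero                       ≡⟨ cong₂ _∷ʳ_ (tabulate-cong (λ i → cong f (sym (opposite-inject₁ i)))) (cong f (sym (opposite-fromℕ n))) ⟩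
    tabulate (f ∘ opposite ∘ inject₁) ∷ʳ f (opposite (fromℕ n))   ≡⟨ sym (tabulate-∷ʳ (f ∘ opposite)) ⟩
    tabulate (f ∘ opposite)                                       ∎
    where open ≡-Reasoning

  take-++-≤ : ∀ {A : Set} m (xs {ys} : List A) → m ℕ.≤ length xs → take m (xs ++ ys) ≡ take m xs
  take-++-≤ zero    xs       _           = refl
  take-++-≤ (suc m) (x ∷ xs) (ℕ.s≤s m≤n) = cong (x ∷_) (take-++-≤ m xs m≤n)

  μs-take-++ : ∀ {n} (xs {ys} : List (Fin n)) m {B} → μs (take (length xs ℕ.+ m) (xs ++ ys)) B ≡ μs (take m ys) (μs xs B)
  μs-take-++ []       m = refl
  μs-take-++ (x ∷ xs) m = μs-take-++ xs m

  Labels : ∀ {n} {V : Set} → (V → Fin n) → Mat n → Weights V → Set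
  Labels e B M = ∀ u v → B (e u) (e v) ≡ M u v

  module _ {V : Set} (p q : V) (sw : V → V) (sw-inv : ∀ u → sw (sw u) ≡ u) (sw-p : sw p ≡ q) (sw-q : sw q ≡ p) where

    after : ∀ {n} → ℕ → (V → Fin n) → V → Fin n
    after zero    e = e
    after (suc m) e = after m (e ∘ sw)

    after-even : ∀ {n} k (e : V → Fin n) u → after (k ℕ.* 2) e u ≡ e u
    after-even zero    e u = refl
    after-even (suc k) e u = trans (after-even k (e ∘ sw ∘ sw) u) (cong e (sw-inv u))

    -- The labelling is composed with `sw` after each mutation, so the vertex mutated is always
    -- called `q` although the indices in the list alternate.
    Labels-alternate : ∀ (M : ℕ → Weights V) m n → m ℕ.≤ n →
                       (∀ t → t ℕ.< m → Mutates q (M t) (λ u v → M (suc t) (sw u) (sw v))) →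
                       ∀ {l} {B : Mat l} (e : V → Fin l) → (∀ {u v} → e u ≡ e v → u ≡ v) →
                       Labels e B (M 0) → Labels (after m e) (μs (take m (alternate n (e q) (e p))) B) (M m)
    Labels-alternate M zero    n       _           _    e inj lab = lab
    Labels-alternate M (suc m) (suc n) (ℕ.s≤s m≤n) step {B = B} e inj lab =
      subst₂ (λ s t → Labels (after m (e ∘ sw)) (μs (take m (alternate n s t)) (μ (e q) B)) (M (suc m)))
        (cong e sw-q) (cong e sw-p)
        (Labels-alternate (M ∘ suc) m n m≤n (λ t t<m → step (suc t) (ℕ.s≤s t<m)) (e ∘ sw) inj′ lab′)
      where
      inj′ : ∀ {u v} → e (sw u) ≡ e (sw v) → u ≡ v
      inj′ {u} {v} eq = trans (sym (sw-inv u)) (trans (cong sw (inj eq)) (sw-inv v))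
      lab′ : Labels (e ∘ sw) (μ (e q) B) (M 1)
      lab′ u v = trans (μ-mutates {B = B} e inj (step 0 (ℕ.s≤s ℕ.z≤n)) lab (sw u) (sw v))
                   (cong₂ (M 1) (sw-inv u) (sw-inv v))

  record Enumeration (n : ℕ) (V : Set) : Set where
    field
      index       : V → Fin n
      vertex      : Fin n → V
      index-vertex : ∀ i → index (vertex i) ≡ i
      vertex-index : ∀ v → vertex (index v) ≡ v

    index-injective : ∀ {u v} → index u ≡ index v → u ≡ v
    index-injective {u} {v} eq = trans (sym (vertex-index u)) (trans (cong vertex eq) (vertex-index v))

  swapped : ∀ {n N} → Enumeration n (Vtx N) → Enumeration n (Vtx N)
  swapped E = record
    { index  = index ∘ swap₁₂
    ; vertex = swap₁₂ ∘ vertex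
    ; index-vertex = λ i → trans (cong index (swap₁₂-involutive (vertex i))) (index-vertex i)
    ; vertex-index = λ v → trans (cong swap₁₂ (vertex-index (swap₁₂ v))) (swap₁₂-involutive v)
    } where open Enumeration E

  swapped^ : ∀ {n N} → ℕ → Enumeration n (Vtx N) → Enumeration n (Vtx N)
  swapped^ zero    E = E
  swapped^ (suc m) E = swapped^ m (swapped E)

  -- Isomorphism does not see labels, so the enumeration may be any; this forgets how often `P` and
  -- `Q` have exchanged names.
  Realises : ∀ {n N} → Mat n → Params N → Set
  Realises {n} {N} B S = Σ (Enumeration n (Vtx N)) λ E → Labels (Enumeration.index E) B (K S)

  vertexIndex : ∀ {p} → Vtx (suc p) → Fin (4 ℕ.+ p)
  vertexIndex P         = zero
  vertexIndex Q         = suc zero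
  vertexIndex {p} X     = fromℕ (3 ℕ.+ p)
  vertexIndex (I i)     = inject₁ (suc (suc (opposite i)))

  indexVertex : ∀ {p} → Fin (4 ℕ.+ p) → Vtx (suc p)
  indexVertex zero          = P
  indexVertex (suc zero)    = Q
  indexVertex (suc (suc i)) with view i
  ... | ‵fromℕ     = X
  ... | ‵inject₁ j = I (opposite j)

  enumeration : ∀ p → Enumeration (4 ℕ.+ p) (Vtx (suc p))
  enumeration p = record { index = vertexIndex ; vertex = indexVertex ; index-vertex = iv ; vertex-index = vi }
    where
    iv : ∀ i → vertexIndex (indexVertex i) ≡ i
    iv zero          = refl
    iv (suc zero)    = refl
    iv (suc (suc i)) with view i
    ... | ‵fromℕ     = refl
    ... | ‵inject₁ j = cong (λ j → suc (suc (inject₁ j))) (opposite-involutive j)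
    vi : ∀ v → indexVertex {p} (vertexIndex v) ≡ v
    vi P     = refl
    vi Q     = refl
    vi X     rewrite view-fromℕ (suc p) = refl
    vi (I i) rewrite view-inject₁ (opposite i) = cong I (opposite-involutive i)

  module Steps {q L′ : ℕ} (D : Setting q L′) where
    open Setting D

    0≤a : 0ℤ ≤ a
    0≤a = <⇒≤ 0<a

    -- The recurrence reads the same in both directions, so the single rule at `Q` lowers the index
    -- in `d` while it raises the index in the `e i`.
    lin-back : ∀ v w → w ≡ - (a * v - w) + a * v
    lin-back v w = eq a v w
      where
      eq : ∀ a v w → w ≡ - (a * v - w) + a * v
      eq = solve-∀

    lin-forth : ∀ v w → a * v - w ≡ - w + a * v
    lin-forth v w = +-comm (a * v) (- w)

    rising-step : ∀ s t → StepP (state c s (suc t)) (state c (suc s) t)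
    rising-step s t = record
      { a-eq = refl ; x-eq = refl ; y-eq = refl
      ; f-eq = λ i → eq a (e i (suc t)) (e i t)
      ; g-eq = λ _ → refl ; h-eq = λ _ → refl ; r-eq = λ _ _ → refl
      ; 0≤a = 0≤a ; 0≤x = <⇒≤ (0<d s) ; 0≤f = λ i → <⇒≤ (0<e i t) }
      where
      eq : ∀ a v w → w ≡ a * v - (a * v - w)
      eq = solve-∀

    turning-step : StepQ (middle N) turn
    turning-step = record
      { a-eq = refl ; x-eq = refl
      ; y-eq = trans (lin-back (d L) (d (suc L′))) (cong (_+_ (- d (suc L))) (sym (τ⁺⁺ 0≤a (<⇒≤ (0<d (suc L′))))))
      ; f-eq = λ i → sym (all-below i (e₁ i))
      ; g-eq = λ i → trans (eq-g (e₀ i)) (cong₂ (λ u v → - u + v) (sym (all-below i (e₀ i)))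
                 (sym (trans (cong (τ a) (all-below i (e₁ i))) (τ⁺⁻ 0≤a (neg-mono-≤ (<⇒≤ (0<e₁ i)))))))
      ; h-eq = λ i → trans (eq-h (c i) (e₁ i) (d L)) (cong₂ _+_ (sym (all-below i (c i)))
                 (sym (trans (cong (τ (- d L)) (all-below i (e₁ i)))
                             (τ⁻⁻ (neg-mono-≤ (<⇒≤ (0<d (suc L′)))) (neg-mono-≤ (<⇒≤ (0<e₁ i)))))))
      ; r-eq = λ i j → sym (trans (all-below i _) (trans (cong -_ (all-below j (r i j))) (neg-involutive (r i j))))
      ; g-sign = inj₂ λ i → subst (_≤ 0ℤ) (sym (all-below i (e₁ i))) (neg-mono-≤ (<⇒≤ (0<e₁ i))) }
      where
      all-below : ∀ i z → negIf (below N i) z ≡ - z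
      all-below i z = cong (λ b → negIf b z) (dec-true (toℕ i ℕ.<? N) (toℕ<n i))
      eq-g : ∀ z → z ≡ - - z + 0ℤ
      eq-g = solve-∀
      eq-h : ∀ c u v → - (c + u * v) ≡ - c + - (- v * - u)
      eq-h = solve-∀

    turning₂-step : StepQ turn (state down L′ 0)
    turning₂-step = record
      { a-eq = refl ; x-eq = refl
      ; y-eq = trans (lin-back (d (suc L′)) (d L′)) (cong (_+_ (- d L)) (sym (τ⁺⁺ 0≤a (<⇒≤ (0<d L′)))))
      ; f-eq = λ _ → refl
      ; g-eq = λ i → trans (eq-g (e₁ i)) (cong (_+_ (- - e₁ i)) (sym (τ⁺⁻ 0≤a (<⇒≤ (e₀<0 i)))))
      ; h-eq = λ i → trans (eq-h (c i) (e₁ i) (d L) (e₀ i) (d (suc L′)))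
                 (cong (_+_ (- (c i + e₁ i * d L))) (sym (τ⁻⁻ (neg-mono-≤ (<⇒≤ (0<d L′))) (<⇒≤ (e₀<0 i)))))
      ; r-eq = λ _ _ → refl
      ; g-sign = inj₂ λ i → <⇒≤ (e₀<0 i) }
      where
      eq-g : ∀ z → z ≡ - - z + 0ℤ
      eq-g = solve-∀
      eq-h : ∀ c u v w z → - (c + (u * v - w * z)) ≡ - (c + u * v) + - (- z * w)
      eq-h = solve-∀

    falling-step : ∀ s t → StepQ (state down (suc s) t) (state down s (suc t))
    falling-step s t = record
      { a-eq = refl ; x-eq = refl
      ; y-eq = trans (lin-back (d (suc s)) (d s)) (cong (_+_ (- d (suc (suc s)))) (sym (τ⁺⁺ 0≤a (<⇒≤ (0<d s)))))
      ; f-eq = λ _ → refl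
      ; g-eq = λ i → trans (lin-forth (e i (suc t)) (e i t)) (cong (_+_ (- e i t)) (sym (τ⁺⁺ 0≤a (<⇒≤ (0<e i t)))))
      ; h-eq = λ i → +0-by refl (τ⁻⁺ (neg-mono-≤ (<⇒≤ (0<d s))) (<⇒≤ (0<e i t)))
      ; r-eq = λ _ _ → refl
      ; g-sign = inj₁ λ i → <⇒≤ (0<e i t) }

    final-step : StepQ (state down 0 L′) finish
    final-step = record
      { a-eq = refl ; x-eq = refl
      ; y-eq = +0-by refl (τ⁺⁻ 0≤a (<⇒≤ d₀<0))
      ; f-eq = λ _ → refl
      ; g-eq = λ i → trans (lin-forth (e i (suc L′)) (e i L′)) (cong (_+_ (- e i L′)) (sym (τ⁺⁺ 0≤a (<⇒≤ (0<e i L′)))))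
      -- `y = d₀` is negative now, so paths X → Q → I i appear; `top-dual` exhibits the term of
      -- `top i` that they cancel.
      ; h-eq = λ i → trans (eq-h (c i) (e i L) d₁ (e i (suc L′)) d₀) (cong₂ _+_ (cong -_ (sym (top-dual i)))
                 (sym (τ⁺⁺ (neg-mono-≤ (<⇒≤ d₀<0)) (<⇒≤ (0<e i L′)))))
      ; r-eq = λ _ _ → refl
      ; g-sign = inj₁ λ i → <⇒≤ (0<e i L′) }
      where
      eq-h : ∀ c u v w z → - (c + u * v) ≡ - (c + (u * v - w * z)) + - z * w
      eq-h = solve-∀

    opening-step : Mutates X (K start) (K (state c 0 L))
    opening-step = record { left = left ; right = right ; away = away }
      where
      into : ∀ u → 0ℤ ≤ K start u X
      into P     = ≤-trans (<⇒≤ 0<d₁) (≤-reflexive (sym (neg-involutive d₁)))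
      into Q     = <⇒≤ (-pos d₀<0)
      into X     = ≤-refl
      into (I i) = ≤-trans (<⇒≤ (0<c i)) (≤-reflexive (sym (neg-involutive (c i))))
      skew : Skew (K start)
      skew = K-skew start r-skew
      skew′ : Skew (K (state c 0 L))
      skew′ = K-skew (state c 0 L) r-skew
      left : ∀ v → K (state c 0 L) X v ≡ - K start X v
      left P     = sym (neg-involutive d₁)
      left Q     = cong -_ (sym (neg-involutive d₀))
      left X     = refl
      left (I i) = sym (neg-involutive (c i))
      right : ∀ u → K (state c 0 L) u X ≡ - K start u X
      right u = trans (skew′ u X) (cong -_ (trans (left u) (sym (skew u X))))
      kept : ∀ u v → X ≢ u → X ≢ v → K (state c 0 L) u v ≡ K start u v
      kept X     v     ne _ = contradiction refl ne
      kept u     X     _ ne = contradiction refl ne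
      kept P     P     _ _ = refl
      kept P     Q     _ _ = refl
      kept P     (I i) _ _ = refl
      kept Q     P     _ _ = refl
      kept Q     Q     _ _ = refl
      kept Q     (I i) _ _ = refl
      kept (I i) P     _ _ = refl
      kept (I i) Q     _ _ = refl
      kept (I i) (I j) _ _ = refl
      away : ∀ u v → X ≢ u → X ≢ v → K (state c 0 L) u v ≡ K start u v + τ (K start u X) (K start X v)
      away u v p q = +0-by (kept u v p q) (τ⁺⁻ (into u) (subst (_≤ 0ℤ) (sym (skew X v)) (neg-mono-≤ (into v))))

    rising-stage : ℕ → Params N
    rising-stage s = state c s (L ℕ.∸ s)

    rising-mutates : ∀ s → s ℕ.< L → Mutates P (K (rising-stage s)) (λ u v → K (rising-stage (suc s)) (swap₁₂ u) (swap₁₂ v))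
    rising-mutates s s<L = subst (λ t → Mutates P (K (state c s t)) (λ u v → K (rising-stage (suc s)) (swap₁₂ u) (swap₁₂ v)))
      (sym (ℕ.+-∸-assoc 1 s<L)) (mutates-P r-skew r-skew (rising-step s (L ℕ.∸ suc s)))

    -- The mutation after `s` has run out is the one leading to `finish`; for still larger `m` the
    -- value is a mere default.
    descent : ℕ → ℕ → ℕ → Params N
    descent s       t zero    = state down s t
    descent (suc s) t (suc m) = descent s (suc t) m
    descent zero    t (suc m) = finish

    descent-skew : ∀ s t m → Skew (Params.r (descent s t m))
    descent-skew s       t zero    = r-skew
    descent-skew (suc s) t (suc m) = descent-skew s (suc t) m
    descent-skew zero    t (suc m) = r-skew

    descent-step : ∀ s t m → s ℕ.+ t ≡ L′ → m ℕ.≤ s → StepQ (descent s t m) (descent s t (suc m))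
    descent-step zero    t zero    refl _           = final-step
    descent-step (suc s) t zero    eq   _           = falling-step s t
    descent-step (suc s) t (suc m) eq   (ℕ.s≤s m≤s) = descent-step s (suc t) m (trans (ℕ.+-suc s t) eq) m≤s

    descent-state : ∀ s t m → descent (m ℕ.+ s) t m ≡ state down s (m ℕ.+ t)
    descent-state s t zero    = refl
    descent-state s t (suc m) = trans (descent-state s (suc t) m) (cong (state down s) (ℕ.+-suc m t))

    descent-end : ∀ s t → descent s t (suc s) ≡ finish
    descent-end zero    t = refl
    descent-end (suc s) t = descent-end s (suc t)

    falling-stage : ℕ → Params N
    falling-stage zero          = middle N
    falling-stage (suc zero)    = turn
    falling-stage (suc (suc m)) = descent L′ 0 m

    falling-mutates : ∀ m → m ℕ.≤ L → Mutates Q (K (falling-stage m)) (λ u v → K (falling-stage (suc m)) (swap₁₂ u) (swap₁₂ v))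
    falling-mutates zero          _                   = mutates-Q (flipped-skew N (state c L 0) r-skew) r-skew turning-step
    falling-mutates (suc zero)    _                   = mutates-Q r-skew r-skew turning₂-step
    falling-mutates (suc (suc m)) (ℕ.s≤s (ℕ.s≤s m≤L′)) =
      mutates-Q (descent-skew L′ 0 m) (descent-skew L′ 0 (suc m)) (descent-step L′ 0 m (ℕ.+-identityʳ L′) m≤L′)

    middle-mutates : ∀ i → Mutates (I i) (K (middle (toℕ i))) (K (middle (suc (toℕ i))))
    middle-mutates = mutates-I {S = state c L 0} r-skew (λ i → <⇒≤ (e₀<0 i)) (λ i → <⇒≤ (0<e₁ i)) (λ i → <⇒≤ (0<c i)) r-order

  -- From matrices to parameters, and the stage reached at each time

  module _ {n N} {B C : Mat n} {S S′ : Params N} where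

    realised-iso : Realises B S → Realises C S′ → Isomorphic B C → Iso (K S) (K S′)
    realised-iso (E , lab) (E′ , lab′) (σ , σ-iso) = record
      { to      = λ v → E′.vertex (σ ⟨$⟩ʳ E.index v)
      ; from    = λ w → E.vertex (σ ⟨$⟩ˡ E′.index w)
      ; to-from = λ w → trans (cong (λ i → E′.vertex (σ ⟨$⟩ʳ i)) (E.index-vertex _)) (trans (cong E′.vertex (inverseʳ σ)) (E′.vertex-index w))
      ; from-to = λ v → trans (cong (λ i → E.vertex (σ ⟨$⟩ˡ i)) (E′.index-vertex _)) (trans (cong E.vertex (inverseˡ σ)) (E.vertex-index v))
      ; preserves = λ u v → begin
          K S′ (E′.vertex (σ ⟨$⟩ʳ E.index u)) (E′.vertex (σ ⟨$⟩ʳ E.index v))                       ≡⟨ sym (lab′ _ _) ⟩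
          C (E′.index (E′.vertex (σ ⟨$⟩ʳ E.index u))) (E′.index (E′.vertex (σ ⟨$⟩ʳ E.index v)))    ≡⟨ cong₂ C (E′.index-vertex _) (E′.index-vertex _) ⟩
          C (σ ⟨$⟩ʳ E.index u) (σ ⟨$⟩ʳ E.index v)                                                  ≡⟨ σ-iso _ _ ⟩
          B (E.index u) (E.index v)                                                                ≡⟨ lab u v ⟩
          K S u v                                                                                  ∎
      }
      where
      open ≡-Reasoning
      module E = Enumeration E
      module E′ = Enumeration E′

  realised-opp : ∀ {n N} {B : Mat n} {S : Params N} → Realises B S → Realises (opp B) (reversed S)
  realised-opp {B = B} {S} (E , lab) = swapped E , λ u v → begin
    - B (index (swap₁₂ u)) (index (swap₁₂ v))                     ≡⟨ cong -_ (lab (swap₁₂ u) (swap₁₂ v)) ⟩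
    - K S (swap₁₂ u) (swap₁₂ v)                                   ≡⟨ sym (K-reversed S (swap₁₂ u) (swap₁₂ v)) ⟩
    K (reversed S) (swap₁₂ (swap₁₂ u)) (swap₁₂ (swap₁₂ v))        ≡⟨ cong₂ (K (reversed S)) (swap₁₂-involutive u) (swap₁₂-involutive v) ⟩
    K (reversed S) u v                                            ∎
    where
    open ≡-Reasoning
    open Enumeration E

  realised-apart : ∀ {n N} {B C : Mat n} {S S′ : Params N} → Realises B S → Realises C S′ → Apart S S′ →
                   ¬ Isomorphic B C × ¬ Isomorphic B (opp C)
  realised-apart {B = B} {C} {S} {S′} b c (apart , apart⁻) =
    apart ∘ realised-iso {B = B} {C} b c , apart⁻ ∘ realised-iso {B = B} {opp C} b (realised-opp {B = C} {S′} c)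

  split : ∀ n ℓ → ℓ ℕ.≤ n ⊎ ∃ λ m → ℓ ≡ n ℕ.+ suc m
  split n ℓ with ℓ ℕ.≤? n
  ... | yes ℓ≤n = inj₁ ℓ≤n
  ... | no ℓ≰n  = inj₂ (ℓ ℕ.∸ suc n , trans (sym (ℕ.m+[n∸m]≡n (ℕ.≰⇒> ℓ≰n))) (sym (ℕ.+-suc n (ℓ ℕ.∸ suc n))))

  module Trace {p k′ : ℕ} (D : Setting p (k′ ℕ.* 2)) (Q₀ : Mat (4 ℕ.+ p)) (lab₀ : Labels (vertexIndex {p}) Q₀ (K (Setting.start D))) where
    open Setting D
    open Steps D

    k : ℕ
    k = suc k′

    E : Enumeration (4 ℕ.+ p) (Vtx N)
    E = enumeration p

    ι : Vtx N → Fin (4 ℕ.+ p)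
    ι = vertexIndex

    walkP : ℕ → (Vtx N → Fin (4 ℕ.+ p)) → Vtx N → Fin (4 ℕ.+ p)
    walkP = after Q P swap₁₂ swap₁₂-involutive refl refl

    walkQ : ℕ → (Vtx N → Fin (4 ℕ.+ p)) → Vtx N → Fin (4 ℕ.+ p)
    walkQ = after P Q swap₁₂ swap₁₂-involutive refl refl

    walkP-index : ∀ m E → Enumeration.index (swapped^ m E) ≡ walkP m (Enumeration.index E)
    walkP-index zero    E = refl
    walkP-index (suc m) E = walkP-index m (swapped E)

    walkQ-index : ∀ m E → Enumeration.index (swapped^ m E) ≡ walkQ m (Enumeration.index E)
    walkQ-index zero    E = refl
    walkQ-index (suc m) E = walkQ-index m (swapped E)

    first : List (Fin (4 ℕ.+ p))
    first = alternate L (ι P) (ι Q)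

    second : List (Fin (4 ℕ.+ p))
    second = tabulate (ι ∘ I)

    -- The sweep n-1, ..., 2, 1 ends with 2, 1, which joins the alternation that follows it: hence
    -- `L + 2` terms.
    third : List (Fin (4 ℕ.+ p))
    third = alternate (suc (suc L)) (ι Q) (ι P)

    jseq-split : jseq p k ≡ ι X ∷ first ++ second ++ third
    jseq-split = cong₂ (λ xs ys → ι X ∷ xs ++ ys) (alt≡alternate k (ι P) (ι Q)) (begin
      map inject₁ (reverse (allFin (3 ℕ.+ p))) ++ alt k (ι Q) (ι P)
        ≡⟨ cong₂ (λ xs ys → map inject₁ xs ++ ys) reverse-allFin (alt≡alternate k (ι Q) (ι P)) ⟩
      map inject₁ (tabulate (λ i → suc (suc (opposite i))) ++ suc zero ∷ zero ∷ []) ++ alternate L (ι Q) (ι P)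
        ≡⟨ cong (_++ alternate L (ι Q) (ι P)) (map-++ inject₁ (tabulate (λ i → suc (suc (opposite i)))) (suc zero ∷ zero ∷ [])) ⟩
      (map inject₁ (tabulate (λ i → suc (suc (opposite i)))) ++ ι Q ∷ ι P ∷ []) ++ alternate L (ι Q) (ι P)
        ≡⟨ cong (λ xs → (xs ++ ι Q ∷ ι P ∷ []) ++ alternate L (ι Q) (ι P)) (map-tabulate (λ i → suc (suc (opposite i))) inject₁) ⟩
      (second ++ ι Q ∷ ι P ∷ []) ++ alternate L (ι Q) (ι P)
        ≡⟨ ++-assoc second (ι Q ∷ ι P ∷ []) (alternate L (ι Q) (ι P)) ⟩
      second ++ third ∎)
      where
      open ≡-Reasoning
      reverse-allFin : reverse (allFin (3 ℕ.+ p)) ≡ tabulate (λ i → suc (suc (opposite i))) ++ suc zero ∷ zero ∷ []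
      rest : List (Fin (3 ℕ.+ p))
      rest = tabulate (λ (i : Fin (suc p)) → suc (suc i))
      tail : List (Fin (3 ℕ.+ p))
      tail = tabulate (λ (i : Fin (suc p)) → suc (suc (opposite i)))
      reverse-allFin = begin
        reverse (zero ∷ suc zero ∷ rest) ≡⟨ unfold-reverse zero (suc zero ∷ rest) ⟩
        reverse (suc zero ∷ rest) ∷ʳ zero   ≡⟨ cong (_∷ʳ zero) (unfold-reverse (suc zero) rest) ⟩
        (reverse rest ∷ʳ suc zero) ∷ʳ zero    ≡⟨ cong (λ xs → (xs ∷ʳ suc zero) ∷ʳ zero) (reverse-tabulate (λ (i : Fin (suc p)) → suc (suc i))) ⟩
        (tail ∷ʳ suc zero) ∷ʳ zero              ≡⟨ ++-assoc tail (suc zero ∷ []) (zero ∷ []) ⟩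
        tail ++ suc zero ∷ zero ∷ []            ∎

    injective : ∀ {u v} → ι u ≡ ι v → u ≡ v
    injective = Enumeration.index-injective E

    Q₁ Q₂ Q₃ : Mat (4 ℕ.+ p)
    Q₁ = μ (ι X) Q₀
    Q₂ = μs first Q₁
    Q₃ = μs second Q₂

    lab₁ : Labels ι Q₁ (K (state c 0 L))
    lab₁ = μ-mutates {B = Q₀} ι injective opening-step lab₀

    rising-label : ∀ s → s ℕ.≤ L → Labels (walkP s ι) (μs (take s first) Q₁) (K (rising-stage s))
    rising-label s s≤L = Labels-alternate Q P swap₁₂ swap₁₂-involutive refl refl (K ∘ rising-stage) s L s≤L
      (λ t t<s → rising-mutates t (ℕ.<-≤-trans t<s s≤L)) {B = Q₁} ι injective lab₁

    take-first : take L first ≡ first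
    take-first = take-all L first (ℕ.≤-reflexive (length-alternate L (ι P) (ι Q)))

    lab₂ : Labels ι Q₂ (K (state c L 0))
    lab₂ u v = begin
      Q₂ (ι u) (ι v)                                   ≡⟨ cong (λ xs → μs xs Q₁ (ι u) (ι v)) (sym take-first) ⟩
      μs (take L first) Q₁ (ι u) (ι v)                 ≡⟨ cong₂ (μs (take L first) Q₁) (sym (even u)) (sym (even v)) ⟩
      μs (take L first) Q₁ (walkP L ι u) (walkP L ι v)       ≡⟨ rising-label L ℕ.≤-refl u v ⟩
      K (rising-stage L) u v                           ≡⟨ cong (λ t → K (state c L t) u v) (ℕ.n∸n≡0 L) ⟩
      K (state c L 0) u v                              ∎
      where
      open ≡-Reasoning
      even : ∀ u → walkP L ι u ≡ ι u
      even = after-even Q P swap₁₂ swap₁₂-involutive refl refl k ι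

    middle-label : ∀ m → m ℕ.≤ N → Labels ι (μs (take m second) Q₂) (K (middle m))
    middle-label zero    _   = lab₂
    middle-label (suc m) m<N u v = begin
      μs (take (suc m) second) Q₂ (ι u) (ι v)              ≡⟨ cong (λ xs → μs xs Q₂ (ι u) (ι v)) snoc ⟩
      μs (take m second ∷ʳ ι (I i)) Q₂ (ι u) (ι v)         ≡⟨ cong (λ B → B (ι u) (ι v)) (foldl-∷ʳ (λ C k → μ k C) Q₂ (ι (I i)) (take m second)) ⟩
      μ (ι (I i)) (μs (take m second) Q₂) (ι u) (ι v)      ≡⟨ μ-mutates {B = μs (take m second) Q₂} ι injective mutates (middle-label m (ℕ.<⇒≤ m<N)) u v ⟩
      K (middle (suc m)) u v                               ∎
      where
      open ≡-Reasoning
      i : Fin N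
      i = fromℕ< m<N
      i≡m : toℕ i ≡ m
      i≡m = toℕ-fromℕ< m<N
      mutates : Mutates (I i) (K (middle m)) (K (middle (suc m)))
      mutates = subst (λ m → Mutates (I i) (K (middle m)) (K (middle (suc m)))) i≡m (middle-mutates i)
      snoc : take (suc m) second ≡ take m second ∷ʳ ι (I i)
      snoc = subst (λ m → take (suc m) second ≡ take m second ∷ʳ ι (I i)) i≡m (take-suc-tabulate (ι ∘ I) i)

    lab₃ : Labels ι Q₃ (K (middle N))
    lab₃ = subst (λ xs → Labels ι (μs xs Q₂) (K (middle N))) (take-all N second (ℕ.≤-reflexive (length-tabulate (ι ∘ I))))
             (middle-label N ℕ.≤-refl)

    -- The bound omits the last term of `third`, the mutation that would close the walk.
    falling-label : ∀ m → m ℕ.≤ suc L → Labels (walkQ m ι) (μs (take m third) Q₃) (K (falling-stage m))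
    falling-label m m≤ = Labels-alternate P Q swap₁₂ swap₁₂-involutive refl refl (K ∘ falling-stage) m (suc (suc L)) (ℕ.m≤n⇒m≤1+n m≤)
      (λ t t<m → falling-mutates t (ℕ.s≤s⁻¹ (ℕ.<-≤-trans t<m m≤))) {B = Q₃} ι injective lab₃

    realises-walkP : ∀ m {B S} → Labels (walkP m ι) B (K S) → Realises B S
    realises-walkP m {B} {S} lab = swapped^ m E , subst (λ e → Labels e B (K S)) (sym (walkP-index m E)) lab

    realises-walkQ : ∀ m {B S} → Labels (walkQ m ι) B (K S) → Realises B S
    realises-walkQ m {B} {S} lab = swapped^ m E , subst (λ e → Labels e B (K S)) (sym (walkQ-index m E)) lab

    Qat-first : ∀ m → m ℕ.≤ L → Qat p k Q₀ (suc m) ≡ μs (take m first) Q₁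
    Qat-first m m≤L = trans (cong (λ xs → μs (take (suc m) xs) Q₀) jseq-split)
      (cong (λ xs → μs xs Q₁) (take-++-≤ m first (subst (m ℕ.≤_) (sym (length-alternate L (ι P) (ι Q))) m≤L)))

    Qat-rest : ∀ m → Qat p k Q₀ (suc (L ℕ.+ m)) ≡ μs (take m (second ++ third)) Q₂
    Qat-rest m = trans (cong (λ xs → μs (take (suc (L ℕ.+ m)) xs) Q₀) jseq-split)
      (trans (cong (λ l → μs (take (l ℕ.+ m) (first ++ second ++ third)) Q₁) (sym (length-alternate L (ι P) (ι Q))))
        (μs-take-++ first m))

    Qat-second : ∀ m → m ℕ.≤ N → Qat p k Q₀ (suc (L ℕ.+ m)) ≡ μs (take m second) Q₂
    Qat-second m m≤N = trans (Qat-rest m)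
      (cong (λ xs → μs xs Q₂) (take-++-≤ m second (subst (m ℕ.≤_) (sym (length-tabulate (ι ∘ I))) m≤N)))

    Qat-third : ∀ m → Qat p k Q₀ (suc (L ℕ.+ (N ℕ.+ m))) ≡ μs (take m third) Q₃
    Qat-third m = trans (Qat-rest (N ℕ.+ m))
      (trans (cong (λ l → μs (take (l ℕ.+ m) (second ++ third)) Q₂) (sym (length-tabulate (ι ∘ I))))
        (μs-take-++ second m))

    -- This is the quiver `R` of the statement. For n = 4 its entry from 2 to 3 is `e₁ zero`, which
    -- turns the hypothesis into an inequality between `d₁` and `e₁`.
    Qat-turning-label : Labels ι (Qat p k Q₀ (suc L)) (K (state c L 0))
    Qat-turning-label = subst (λ B → Labels ι B (K (state c L 0)))
      (sym (trans (Qat-first L ℕ.≤-refl) (cong (λ xs → μs xs Q₁) take-first))) lab₂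

    module _ (phase : Late.OutOfPhase D) where
      open Stages D phase

      At : ℕ → Params N → Set
      At ℓ S = ∃ λ x → stage-time x ≡ ℓ × params x ≡ S

      rising-at : ∀ s t → s ℕ.+ t ≡ L → At (suc s) (state c s t)
      rising-at zero    t       refl = inj₁ opened , refl , refl
      -- The end of the rise counts as the sink stage with no vertex mutated yet: `flipped 0`
      -- changes nothing.
      rising-at (suc s) zero    eq   = inj₁ (mid 0 ℕ.z≤n) , time≡ , cong (λ l → state c l 0) (sym s≡L)
        where
        s≡L : suc s ≡ L
        s≡L = trans (sym (ℕ.+-identityʳ (suc s))) eq
        time≡ : suc (L ℕ.+ 0) ≡ suc (suc s)
        time≡ = cong suc (trans (ℕ.+-identityʳ L) (sym s≡L))
      rising-at (suc s) (suc t) eq   = inj₂ (rising s t eq) , refl , refl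

      third-time : ℕ → ℕ
      third-time u = suc (suc (L ℕ.+ N ℕ.+ u))

      descent-at : ∀ s t → s ℕ.+ t ≡ k′ ℕ.* 2 → At (third-time (suc t)) (state down s t)
      descent-at zero    zero    eq = inj₂ (special (short (sym eq))) , refl , refl
      descent-at (suc s) zero    eq = inj₂ (special (turning₂ s (trans (sym (ℕ.+-identityʳ (suc s))) eq))) , refl , refl
      descent-at zero    (suc t) eq = inj₂ (special (closing t eq)) , refl , refl
      descent-at (suc s) (suc t) eq = inj₂ (falling s t eq) , refl , refl

      falling-at : ∀ u → u ℕ.≤ L → At (third-time u) (falling-stage (suc u))
      falling-at zero    _ = inj₂ (special turning) , refl , refl
      falling-at (suc v) (ℕ.s≤s v≤) with split (k′ ℕ.* 2) v
      ... | inj₁ v≤L′ = subst (At (third-time (suc v))) (sym stage≡) (descent-at (k′ ℕ.* 2 ℕ.∸ v) v (ℕ.m∸n+n≡m v≤L′))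
        where
        s = k′ ℕ.* 2 ℕ.∸ v
        stage≡ : descent (k′ ℕ.* 2) 0 v ≡ state down s v
        stage≡ = trans (cong (λ l → descent l 0 v) (sym (ℕ.m+[n∸m]≡n v≤L′)))
                   (trans (descent-state s 0 v) (cong (state down s) (ℕ.+-identityʳ v)))
      ... | inj₂ (zero , eq) = inj₂ (special finished) , cong (λ v → third-time (suc v)) (sym v≡) ,
              sym (trans (cong (descent (k′ ℕ.* 2) 0) v≡) (descent-end (k′ ℕ.* 2) 0))
        where
        v≡ : v ≡ suc (k′ ℕ.* 2)
        v≡ = trans eq (ℕ.+-comm (k′ ℕ.* 2) 1)
      ... | inj₂ (suc m , refl) = contradiction v≤ (ℕ.<⇒≱ (subst (suc (suc (k′ ℕ.* 2)) ℕ.≤_) (sym (eq (k′ ℕ.* 2) m)) (ℕ.m≤m+n _ m)))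
        where
        eq : ∀ l m → l ℕ.+ suc (suc m) ≡ suc (suc l) ℕ.+ m
        eq l m = trans (ℕ.+-suc l (suc m)) (cong suc (ℕ.+-suc l m))

      Stage-at : ℕ → Set
      Stage-at ℓ = ∃ λ x → stage-time x ≡ ℓ × Realises (Qat p k Q₀ ℓ) (params x)

      stage-at-from : ∀ {ℓ S} → At ℓ S → Realises (Qat p k Q₀ ℓ) S → Stage-at ℓ
      stage-at-from (x , time≡ , refl) real = x , time≡ , real

      stage-at : ∀ ℓ → ℓ ℕ.≤ 4 ℕ.+ p ℕ.+ 4 ℕ.* k ℕ.∸ 1 → Stage-at ℓ
      stage-at zero    _ = inj₁ initial , refl , E , lab₀
      stage-at (suc ℓ) ℓ≤ with split L ℓ
      ... | inj₁ ℓ≤L = stage-at-from (rising-at ℓ (L ℕ.∸ ℓ) (ℕ.m+[n∸m]≡n ℓ≤L))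
              (subst (λ B → Realises B (rising-stage ℓ)) (sym (Qat-first ℓ ℓ≤L)) (realises-walkP ℓ {μs (take ℓ first) Q₁} {rising-stage ℓ} (rising-label ℓ ℓ≤L)))
      ... | inj₂ (m , refl) with split N (suc m)
      ... | inj₁ m<N = inj₁ (mid (suc m) m<N) , refl , E ,
              subst (λ B → Labels ι B (K (middle (suc m)))) (sym (Qat-second (suc m) m<N)) (middle-label (suc m) m<N)
      ... | inj₂ (u , eq) = subst Stage-at time≡ (stage-at-from (falling-at u u≤L)
              (subst (λ B → Realises B (falling-stage (suc u))) Qat≡ (realises-walkQ (suc u) {μs (take (suc u) third) Q₃} {falling-stage (suc u)} (falling-label (suc u) (ℕ.s≤s u≤L)))))
        where
        shift : ∀ (l n u : ℕ) → ℕ.suc (l ℕ.+ (n ℕ.+ ℕ.suc u)) ≡ ℕ.suc (ℕ.suc (l ℕ.+ n ℕ.+ u))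
        shift l n u = cong ℕ.suc (trans (sym (ℕ.+-assoc l n (suc u))) (ℕ.+-suc (l ℕ.+ n) u))
        time≡ : third-time u ≡ suc (L ℕ.+ suc m)
        time≡ = trans (sym (shift L N u)) (cong (λ w → ℕ.suc (L ℕ.+ w)) (sym eq))
        Qat≡ : μs (take (suc u) third) Q₃ ≡ Qat p k Q₀ (third-time u)
        Qat≡ = trans (sym (Qat-third (suc u))) (cong (Qat p k Q₀) (shift L N u))
        -- The largest time `n + 4k - 1` equals `third-time L`, the time of `finish`.
        total : ∀ p l → 3 ℕ.+ p ℕ.+ 4 ℕ.* suc l ≡ suc (suc (suc (suc (l ℕ.* 2)) ℕ.+ suc p ℕ.+ suc (suc (l ℕ.* 2))))
        total = solve 2 (λ p l → con 3 :+ p :+ con 4 :* (con 1 :+ l) :=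
                                 con 2 :+ (con 2 :+ l :* con 2 :+ (con 1 :+ p) :+ (con 2 :+ l :* con 2))) refl
        bound : L ℕ.+ N ℕ.+ u ℕ.≤ L ℕ.+ N ℕ.+ L
        bound = ℕ.s≤s⁻¹ (ℕ.s≤s⁻¹ (subst₂ ℕ._≤_ (sym time≡) (total p k′) ℓ≤))
        u≤L : u ℕ.≤ L
        u≤L = ℕ.+-cancelˡ-≤ (L ℕ.+ N) u L bound

  -- Reading the data off the hypotheses

  data Core (N : ℕ) : Set where
    P Q : Core N
    I   : Fin N → Core N

  inc : ∀ {N} → Core N → Vtx N
  inc P     = P
  inc Q     = Q
  inc (I i) = I i

  inc-injective : ∀ {N} {u v : Core N} → inc u ≡ inc v → u ≡ v
  inc-injective {u = P}   {P}   refl = refl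
  inc-injective {u = Q}   {Q}   refl = refl
  inc-injective {u = I i} {I j} refl = refl

  swapCore : ∀ {N} → Core N → Core N
  swapCore P     = Q
  swapCore Q     = P
  swapCore (I i) = I i

  swapCore-involutive : ∀ {N} (u : Core N) → swapCore (swapCore u) ≡ u
  swapCore-involutive P     = refl
  swapCore-involutive Q     = refl
  swapCore-involutive (I i) = refl

  inc-swap : ∀ {N} (u : Core N) → inc (swapCore u) ≡ swap₁₂ (inc u)
  inc-swap P     = refl
  inc-swap Q     = refl
  inc-swap (I i) = refl

  coreIndex : ∀ {p} → Core (suc p) → Fin (3 ℕ.+ p)
  coreIndex P     = zero
  coreIndex Q     = suc zero
  coreIndex (I i) = suc (suc (opposite i))

  opposite-injective : ∀ {n} {i j : Fin n} → opposite i ≡ opposite j → i ≡ j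
  opposite-injective {i = i} {j} eq = trans (sym (opposite-involutive i)) (trans (cong opposite eq) (opposite-involutive j))

  opposite-mono : ∀ {n} {i j : Fin n} → toℕ j ℕ.< toℕ i → toℕ (opposite i) ℕ.< toℕ (opposite j)
  opposite-mono {n} {i} {j} j<i = subst₂ ℕ._<_ (sym (opposite-prop i)) (sym (opposite-prop j)) (ℕ.∸-monoʳ-< (ℕ.s≤s j<i) (toℕ<n i))

  coreIndex-injective : ∀ {p} {u v : Core (suc p)} → coreIndex u ≡ coreIndex v → u ≡ v
  coreIndex-injective {u = P}   {P}   _  = refl
  coreIndex-injective {u = Q}   {Q}   _  = refl
  coreIndex-injective {u = I i} {I j} eq = cong I (opposite-injective (suc-injective (suc-injective eq)))

  vertexIndex-inc : ∀ {p} (u : Core (suc p)) → vertexIndex (inc u) ≡ inject₁ (coreIndex u)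
  vertexIndex-inc P     = refl
  vertexIndex-inc Q     = refl
  vertexIndex-inc (I i) = refl

  module Setup {p k′ : ℕ} (R̃ : Mat (3 ℕ.+ p)) (R̃-skew : SkewSymmetric R̃) (2≤R̃ : ∀ i j → i Fin.< j → + 2 ≤ R̃ i j)
               (Q₀ : Mat (4 ℕ.+ p)) (Q₀-skew : SkewSymmetric Q₀) (restricted : restrict Q₀ ≡ μs (seqR̃ p (suc k′)) R̃)
               (2≤Q₀ : ∀ i → + 2 ≤ Q₀ (inject₁ i) (vn {p})) where

    0<R̃ : ∀ i j → i Fin.< j → Pos (R̃ i j)
    0<R̃ i j i<j = <-≤-trans (+<+ ℕ.z<s) (2≤R̃ i j i<j)

    0<Q₀ : ∀ i → Pos (Q₀ (inject₁ i) (vn {p}))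
    0<Q₀ i = <-≤-trans (+<+ ℕ.z<s) (2≤Q₀ i)

    D : Setting p (k′ ℕ.* 2)
    D = record
      { a       = R̃ zero (suc zero)
      ; d₀      = - Q₀ (suc zero) vn
      ; d₁      = Q₀ zero vn
      ; e₀      = λ i → - R̃ zero (coreIndex (I i))
      ; e₁      = λ i → R̃ (suc zero) (coreIndex (I i))
      ; c       = λ i → Q₀ (inject₁ (coreIndex (I i))) vn
      ; r       = λ i j → R̃ (coreIndex (I i)) (coreIndex (I j))
      ; 2≤a     = 2≤R̃ zero (suc zero) (ℕ.s≤s ℕ.z≤n)
      ; d₀<0    = neg-mono-< (0<Q₀ (suc zero))
      ; 0<d₁    = 0<Q₀ zero
      ; e₀<0    = λ i → neg-mono-< (0<R̃ zero (coreIndex (I i)) (ℕ.s≤s ℕ.z≤n))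
      ; 0<e₁    = λ i → 0<R̃ (suc zero) (coreIndex (I i)) (ℕ.s≤s (ℕ.s≤s ℕ.z≤n))
      ; 0<c     = λ i → 0<Q₀ (coreIndex (I i))
      ; r-skew  = λ i j → R̃-skew (coreIndex (I i)) (coreIndex (I j))
      ; r-order = λ {i} {j} j<i → <⇒≤ (0<R̃ (coreIndex (I i)) (coreIndex (I j)) (ℕ.s≤s (ℕ.s≤s (opposite-mono j<i))))
      }

    open Setting D
    open Steps D

    -- `K` also wants entries at `X`, which `inc` never reaches. Filling in those of a descent lets
    -- `falling-step` serve for the mutations of `R̃` too.
    core-stage : ℕ → Params N
    core-stage t = state down (L ℕ.∸ t) t

    coreWeights : ℕ → Weights (Core N)
    coreWeights t u v = K (core-stage t) (inc u) (inc v)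

    loop : ∀ {n} {B : Mat n} → SkewSymmetric B → ∀ i → B i i ≡ 0ℤ
    loop {B = B} sk = skew-diag {M = B} sk

    label-R̃ : Labels coreIndex R̃ (coreWeights 0)
    label-R̃ P     P     = loop {B = R̃} R̃-skew zero
    label-R̃ P     Q     = refl
    label-R̃ P     (I i) = sym (neg-involutive _)
    label-R̃ Q     P     = R̃-skew (suc zero) zero
    label-R̃ Q     Q     = loop {B = R̃} R̃-skew (suc zero)
    label-R̃ Q     (I i) = refl
    label-R̃ (I i) P     = R̃-skew (coreIndex (I i)) zero
    label-R̃ (I i) Q     = R̃-skew (coreIndex (I i)) (suc zero)
    label-R̃ (I i) (I j) = refl

    core-mutates : ∀ t → t ℕ.< L → Mutates Q (coreWeights t) (λ u v → coreWeights (suc t) (swapCore u) (swapCore v))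
    core-mutates t t<L = record
      { left  = λ v → trans (cong₂ M′ (inc-swap Q) (inc-swap v)) (Mutates.left full (inc v))
      ; right = λ u → trans (cong₂ M′ (inc-swap u) (inc-swap Q)) (Mutates.right full (inc u))
      ; away  = λ u v p q → trans (cong₂ M′ (inc-swap u) (inc-swap v)) (Mutates.away full (inc u) (inc v) (p ∘ inc-injective) (q ∘ inc-injective))
      }
      where
      M′ : Weights (Vtx N)
      M′ = K (core-stage (suc t))
      full : Mutates Q (K (core-stage t)) (λ u v → M′ (swap₁₂ u) (swap₁₂ v))
      full = subst (λ s → Mutates Q (K (state down s t)) (λ u v → M′ (swap₁₂ u) (swap₁₂ v)))
        (sym (ℕ.+-∸-assoc 1 t<L)) (mutates-Q r-skew r-skew (falling-step (L ℕ.∸ suc t) t))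

    label-restrict : Labels coreIndex (restrict Q₀) (coreWeights L)
    label-restrict u v = begin
      restrict Q₀ (coreIndex u) (coreIndex v)                          ≡⟨ cong (λ B → B (coreIndex u) (coreIndex v)) restricted ⟩
      μs (seqR̃ p (suc k′)) R̃ (coreIndex u) (coreIndex v)               ≡⟨ cong (λ xs → μs xs R̃ (coreIndex u) (coreIndex v)) sequence ⟩
      μs (take L path) R̃ (coreIndex u) (coreIndex v)                   ≡⟨ cong₂ (μs (take L path) R̃) (sym (even u)) (sym (even v)) ⟩
      μs (take L path) R̃ (walk L coreIndex u) (walk L coreIndex v)     ≡⟨ Labels-alternate P Q swapCore swapCore-involutive refl refl coreWeights L L ℕ.≤-refl core-mutates {B = R̃} coreIndex coreIndex-injective label-R̃ u v ⟩
      coreWeights L u v                                                ∎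
      where
      open ≡-Reasoning
      path : List (Fin (3 ℕ.+ p))
      path = alternate L (suc zero) zero
      sequence : seqR̃ p (suc k′) ≡ take L path
      sequence = trans (alt≡alternate (suc k′) (suc zero) zero)
        (sym (take-all L path (ℕ.≤-reflexive (length-alternate {A = Fin (3 ℕ.+ p)} L (suc zero) zero))))
      walk : ℕ → (Core N → Fin (3 ℕ.+ p)) → Core N → Fin (3 ℕ.+ p)
      walk = after P Q swapCore swapCore-involutive refl refl
      even : ∀ u → walk L coreIndex u ≡ coreIndex u
      even = after-even P Q swapCore swapCore-involutive refl refl (suc k′) coreIndex

    label-core : ∀ u v → Q₀ (vertexIndex (inc u)) (vertexIndex (inc v)) ≡ K (core-stage L) (inc u) (inc v)
    label-core u v = trans (cong₂ Q₀ (vertexIndex-inc u) (vertexIndex-inc v)) (label-restrict u v)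

    label₀ : Labels (vertexIndex {p}) Q₀ (K start)
    label₀ P     P     = label-core P P
    label₀ P     Q     = label-core P Q
    label₀ P     X     = sym (neg-involutive _)
    label₀ P     (I i) = label-core P (I i)
    label₀ Q     P     = label-core Q P
    label₀ Q     Q     = label-core Q Q
    label₀ Q     X     = sym (neg-involutive _)
    label₀ Q     (I i) = label-core Q (I i)
    label₀ X     P     = Q₀-skew vn zero
    label₀ X     Q     = trans (Q₀-skew vn (suc zero)) (sym (neg-involutive _))
    label₀ X     X     = loop {B = Q₀} Q₀-skew vn
    label₀ X     (I i) = Q₀-skew vn (inject₁ (coreIndex (I i)))
    label₀ (I i) P     = label-core (I i) P
    label₀ (I i) Q     = label-core (I i) Q
    label₀ (I i) X     = sym (neg-involutive _)
    label₀ (I i) (I j) = label-core (I i) (I j)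

    open Trace {p} {k′} D Q₀ label₀

    stages-distinct : Late.OutOfPhase D → ∀ ℓ m → ℓ ℕ.< m → m ℕ.≤ 4 ℕ.+ p ℕ.+ 4 ℕ.* suc k′ ℕ.∸ 1 →
      ¬ Isomorphic (Qat p (suc k′) Q₀ ℓ) (Qat p (suc k′) Q₀ m) × ¬ Isomorphic (Qat p (suc k′) Q₀ ℓ) (opp (Qat p (suc k′) Q₀ m))
    stages-distinct phase ℓ m ℓ<m m≤ with stage-at phase ℓ (ℕ.≤-trans (ℕ.<⇒≤ ℓ<m) m≤) | stage-at phase m m≤
    ... | x , time-x , real-x | y , time-y , real-y = realised-apart {B = Qat p (suc k′) Q₀ ℓ} {Qat p (suc k′) Q₀ m} {params x} {params y} real-x real-y
            (stages-apart x y (λ eq → ℕ.<⇒≢ ℓ<m (trans (sym time-x) (trans eq time-y))))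
      where open Stages D phase

  out-of-phase : ∀ p k′ (R̃ : Mat (3 ℕ.+ p)) R̃-skew 2≤R̃ Q₀ Q₀-skew restricted 2≤Q₀ →
    1 ℕ.≤ p ⊎ (p ≡ 0 × Q₀ v1 (suc (suc (suc zero))) ≢ Qat p (suc k′) Q₀ (1 ℕ.+ 2 ℕ.* suc k′) (suc zero) (suc (suc zero))) →
    Late.OutOfPhase (Setup.D {p} {k′} R̃ R̃-skew 2≤R̃ Q₀ Q₀-skew restricted 2≤Q₀)
  out-of-phase (suc p) k′ _ _ _ _ _ _ _ _                    = inj₁ (zero , suc zero , λ ())
  out-of-phase zero    k′ R̃ sk 2≤R̃ Q₀ sk₀ res 2≤Q₀ (inj₂ (_ , ne)) = inj₂ λ { zero eq → ne (trans eq
    (sym (trans (cong (λ l → Qat 0 (suc k′) Q₀ (suc l) (suc zero) (suc (suc zero))) (ℕ.*-comm 2 (suc k′)))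
      (Trace.Qat-turning-label {0} {k′} S.D Q₀ S.label₀ Q (I zero))))) }
    where module S = Setup {0} {k′} R̃ sk 2≤R̃ Q₀ sk₀ res 2≤Q₀

open import Data.Nat using (ℕ; suc; _+_; _*_; _∸_; _<_; _≤_)
import Data.Fin
open import Data.Integer as ℤ using (ℤ; +_)
open import Data.Fin using (Fin; zero; suc; inject₁; fromℕ)
open import Data.Product using (_×_)
open import Data.Sum using (_⊎_)
open import Relation.Binary.PropositionalEquality using (_≡_; _≢_)
open import Relation.Nullary using (¬_)

theorem5p3 : ∀ (p k : ℕ) → 0 < k →
    (R̃ : Mat (3 + p)) → SkewSymmetric R̃ →
    (∀ (i j : Fin (3 + p)) → Data.Fin._<_ i j → (+ 2) ℤ.≤ R̃ i j) →
    (Q : Mat (4 + p)) → SkewSymmetric Q →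
    restrict Q ≡ μs (seqR̃ p k) R̃ →
    (∀ (i : Fin (3 + p)) → (+ 2) ℤ.≤ Q (inject₁ i) (vn {p})) →
    (1 ≤ p ⊎ (p ≡ 0 × Q v1 (suc (suc (suc zero))) ≢ Qat p k Q (1 + 2 * k) (suc zero) (suc (suc zero)))) →
    ∀ (ℓ m : ℕ) → ℓ < m → m ≤ 4 + p + 4 * k ∸ 1 →
    ¬ Isomorphic (Qat p k Q ℓ) (Qat p k Q m) × ¬ Isomorphic (Qat p k Q ℓ) (opp (Qat p k Q m))
theorem5p3 p (suc k) _ R̃ R̃-skew 2≤R̃ Q Q-skew restricted 2≤Q generic =
  MutationCycle.Setup.stages-distinct R̃ R̃-skew 2≤R̃ Q Q-skew restricted 2≤Q
    (MutationCycle.out-of-phase p k R̃ R̃-skew 2≤R̃ Q Q-skew restricted 2≤Q generic)
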